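{- Let $b\ge 1$ be a constant integer. Consider Naïve Sort under random adjacent rank swaps, in the model described in the context where every sorting step is followed by exactly $b$ mixing steps. Then there exists a constant $c=c(b)>0$ such that, for all sufficiently large $n$, for every initial permutation $\pi_0\in S_n$ and every integer $m\ge 16\cdot128\cdot4\cdot(b+1)\,n^2$, \[ \Pr\big[\mathrm{dev}(\pi_m)\le c\,n\big]\ \ge\ 1-n^{ -2}. \]
   Context: Let $n\ge 2$, $[n]=\{1,\dots,n\}$, and $S_n$ the set of permutations of $[n]$. For $\pi\in S_n$, $\mathrm{dev}(\pi)=\sum_{i\in[n]}|\pi(i)-i|$ (total deviation). The process is a sequence $\pi_0,\pi_1,\dots\in S_n$; the steps are: one sorting step, then $b$ mixing steps, then one sorting step, then $b$ mixing steps, and so on. Sorting step $t$ (Naïve Sort): choose $i\in[n-1]$ uniformly at random; if $\pi_{t-1}(i)>\pi_{t-1}(i+1)$, $\pi_t$ is $\pi_{t-1}$ with the entries at positions $i,i+1$ exchanged; otherwise $\pi_t=\pi_{t-1}$. Mixing step $t$ (random adjacent rank swap): choose $i\in[n-1]$ uniformly at random and let $\pi_t$ be obtained from $\pi_{t-1}$ by exchanging the values $i$ and $i+1$, i.e. $\pi_t(k)=i+1$ if $\pi_{t-1}(k)=i$, $\pi_t(k)=i$ if $\pi_{t-1}(k)=i+1$, and $\pi_t(k)=\pi_{t-1}(k)$ otherwise. All random choices are independent. -}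

module Defs where

open import Data.Nat using (ℕ; zero; suc; _+_; _*_; _≤_; _<_; _≤?_; _<?_; _%_; ∣_-_∣)
open import Data.Nat.Properties using (_≟_)
open import Data.Fin using (Fin; toℕ; inject₁) renaming (suc to fsuc)
open import Data.Fin.Permutation using (Permutation′; transpose; _∘ₚ_; _⟨$⟩ʳ_)
open import Data.List using (List; map; allFin)
open import Data.Nat.ListAction using (sum)
open import Relation.Nullary using (yes; no)

-- Permutations of [n] are permutations of Fin n (value j ∈ [n] is Fin element j-1).
-- The process is indexed by n = suc k; the random index i ∈ [n-1] is an element of Fin k,
-- referring to positions/values  inject₁ i  and  suc i  of Fin (suc k).

dev : ∀ {n} → Permutation′ n → ℕ
dev {n} π = sum (map (λ i → ∣ toℕ (π ⟨$⟩ʳ i) - toℕ i ∣) (allFin n))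

-- Naïve Sort step with chosen index i: swap positions i, i+1 if out of order.
-- (τ ∘ₚ π) ⟨$⟩ʳ x = π ⟨$⟩ʳ (τ ⟨$⟩ʳ x)
sortStep : ∀ {k} → Fin k → Permutation′ (suc k) → Permutation′ (suc k)
sortStep i π with toℕ (π ⟨$⟩ʳ fsuc i) <? toℕ (π ⟨$⟩ʳ inject₁ i)
... | yes _ = transpose (inject₁ i) (fsuc i) ∘ₚ π
... | no  _ = π

-- random adjacent rank swap with chosen index i: exchange the values i, i+1.
-- (π ∘ₚ τ) ⟨$⟩ʳ x = τ ⟨$⟩ʳ (π ⟨$⟩ʳ x)
mixStep : ∀ {k} → Fin k → Permutation′ (suc k) → Permutation′ (suc k)
mixStep i π = π ∘ₚ transpose (inject₁ i) (fsuc i)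

-- The step number t+1 (t = number of steps already performed) is a sorting step
-- iff t ≡ 0 mod (b+1); otherwise a mixing step.  So: sort, b mixes, sort, b mixes, ...
step : ∀ {k} (b t : ℕ) → Fin k → Permutation′ (suc k) → Permutation′ (suc k)
step b t i π with t % suc b ≟ 0
... | yes _ = sortStep i π
... | no  _ = mixStep i π

-- goodCount b c t r π : number of choice sequences (i_{t+1},…,i_{t+r}) ∈ Fin k ^ r
-- (each equally likely, probability k^{-r}) for which, starting from π after t steps
-- and performing r further steps, the final permutation σ satisfies dev σ ≤ c * (suc k).
goodCount : ∀ {k} (b c t r : ℕ) → Permutation′ (suc k) → ℕ
goodCount {k} b c t zero π with dev π ≤? c * suc k
... | yes _ = 1
... | no  _ = 0
goodCount {k} b c t (suc r) π =
  sum (map (λ i → goodCount b c (suc t) r (step b t i π)) (allFin k))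

{-# OPTIONS --safe #-}
-- Split the last part of the process into windows of geometrically decreasing length, the window at
-- scale A consisting of about A n sorting steps.  Within a window compare the permutation π with the
-- sequence σ that starts at π and undergoes only the sorting steps, with the same choices.
--
-- Mixing: a joint sorting step does not increase any convex function of the entrywise differences of
-- π and σ, while a mixing step moves entries symmetrically.  Hence the product over all positions of
-- 1 + x exp (γ (π - σ)) is, up to a slow growth of x, a supermartingale, and all but an exponentially
-- small fraction of the entries move by at most a small multiple of A, since mixing is diffusive.
--
-- Sorting: for a threshold s, the number h j of entries ≥ s among the first j evolves under sorting
-- like a totally asymmetric exclusion process, and 4 ^ h averages over neighbouring sites.  Truncate
-- the displacements at A, which by contraction in ℓ¹ costs no more than what is cut off.  Then the
-- excess of 4 ^ h over its sorted value is at most exponential in A and decays exponentially during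
-- the window, both in mean and, via a product supermartingale over sites, with exponentially small
-- failure probability.
--
-- So after the window the displacements beyond A / 4 sum to at most twice those that exceeded A,
-- plus a term summable over the scales.  The scales descend from n to a constant depending on b.
module Submission where

open import Defs
open import Data.Nat using (ℕ; zero; suc; _+_; _*_; _∸_; _^_; _≤_; _<_; _≤?_; _<?_; _%_; _/_; _⊓_; _⊔_; ∣_-_∣; z≤n; s≤s; NonZero; >-nonZero)
open import Data.Nat.Properties
open import Data.Nat.DivMod using (m≡m%n+[m/n]*n; m%n<n; /-monoˡ-≤; m%n%n≡m%n; %-distribˡ-+; m*n%n≡0)
open import Data.Nat.ListAction using (sum)
open import Data.Nat.Tactic.RingSolver using (solve-∀)
open import Data.Fin using (Fin; toℕ; inject₁) renaming (zero to fzero; suc to fsuc)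
import Data.Fin as F
open import Data.Fin.Properties using (toℕ<n; toℕ-injective; toℕ-inject₁)
open import Data.Fin.Permutation using (Permutation′; _⟨$⟩ʳ_; _⟨$⟩ˡ_; inverseˡ)
import Data.Fin.Permutation.Components as PC
import Algebra.Properties.CommutativeMonoid.Sum as CMSum
open import Data.List using (List; []; _∷_; map; allFin; tabulate; _++_; length)
open import Data.List.Properties using (map-tabulate)
open import Data.Product using (∃; _×_; _,_; proj₁; proj₂)
open import Data.Sum using (_⊎_; inj₁; inj₂)
open import Data.Empty using (⊥; ⊥-elim)
open import Function using (_∘_; id)
open import Relation.Nullary using (yes; no)
open import Relation.Binary.PropositionalEquality using (_≡_; _≢_; refl; sym; trans; cong; cong₂; subst; subst₂)

-- Everything is counted in ℕ: `Ex` is an expectation times the number of outcomes, and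
-- supermartingales carry their denominators as explicit powers. The obstacle is the range of
-- scales, from a constant up to n. A window at scale A shrinks the mean excess by a factor
-- exponential in A, so the first moment gives a failure probability of order n^(-3) only while A is
-- at least of order log n. Below that only concentration over the roughly n sites helps, and the
-- sites are dependent. Hence the quantities in product form: one random step changes few factors,
-- and the second-order terms have a favourable sign or are small, so that the bound is again a
-- product. Each window fails with probability at most 1 / (4 n^3), and there are at most n windows.
-- The parameter q = 16384 (b + 1) makes the tilt (q + 1) / q weak enough for diffusion: in the
-- window of scale A = 32 q u mixing inflates the weights by at most 4^u, whereas the cut-off A / 4
-- = 8 q u gains 256^u.

Σ< : ℕ → (ℕ → ℕ) → ℕ
Σ< zero    f = 0
Σ< (suc n) f = f 0 + Σ< n (λ x → f (suc x))

Π< : ℕ → (ℕ → ℕ) → ℕ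
Π< zero    f = 1
Π< (suc n) f = f 0 * Π< n (λ x → f (suc x))

Σ-mono : ∀ n {f g : ℕ → ℕ} → (∀ x → x < n → f x ≤ g x) → Σ< n f ≤ Σ< n g
Σ-mono zero    h = z≤n
Σ-mono (suc n) h = +-mono-≤ (h 0 (s≤s z≤n)) (Σ-mono n (λ x x<n → h (suc x) (s≤s x<n)))

Σ-cong : ∀ n {f g : ℕ → ℕ} → (∀ x → x < n → f x ≡ g x) → Σ< n f ≡ Σ< n g
Σ-cong zero    h = refl
Σ-cong (suc n) h = cong₂ _+_ (h 0 (s≤s z≤n)) (Σ-cong n (λ x x<n → h (suc x) (s≤s x<n)))

Σ-+ : ∀ n (f g : ℕ → ℕ) → Σ< n (λ x → f x + g x) ≡ Σ< n f + Σ< n g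
Σ-+ zero    f g = refl
Σ-+ (suc n) f g = trans (cong (f 0 + g 0 +_) (Σ-+ n _ _)) (lem (f 0) (g 0) _ _)
  where
  lem : ∀ a b c d → a + b + (c + d) ≡ a + c + (b + d)
  lem = solve-∀

Σ-* : ∀ n c (f : ℕ → ℕ) → Σ< n (λ x → c * f x) ≡ c * Σ< n f
Σ-* zero    c f = sym (*-zeroʳ c)
Σ-* (suc n) c f = trans (cong (c * f 0 +_) (Σ-* n c _)) (sym (*-distribˡ-+ c (f 0) _))

Σ-const : ∀ n c → Σ< n (λ _ → c) ≡ n * c
Σ-const zero    c = refl
Σ-const (suc n) c = cong (c +_) (Σ-const n c)

Σ-last : ∀ n (f : ℕ → ℕ) → Σ< (suc n) f ≡ Σ< n f + f n
Σ-last zero    f = +-comm (f 0) 0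
Σ-last (suc n) f = trans (cong (f 0 +_) (Σ-last n _)) (sym (+-assoc (f 0) _ _))

Σ-comm : ∀ m n (f : ℕ → ℕ → ℕ) → Σ< m (λ x → Σ< n (f x)) ≡ Σ< n (λ y → Σ< m (λ x → f x y))
Σ-comm zero    n f = sym (trans (Σ-const n 0) (*-zeroʳ n))
Σ-comm (suc m) n f =
  trans (cong (Σ< n (f 0) +_) (Σ-comm m n (λ x → f (suc x))))
        (sym (Σ-+ n (f 0) (λ y → Σ< m (λ x → f (suc x) y))))

Σ-term≤ : ∀ n (f : ℕ → ℕ) {x} → x < n → f x ≤ Σ< n f
Σ-term≤ (suc n) f {zero}  _         = m≤m+n _ _
Σ-term≤ (suc n) f {suc x} (s≤s x<n) = ≤-trans (Σ-term≤ n (λ y → f (suc y)) x<n) (m≤n+m _ (f 0))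

Σ-shift≤ : ∀ n (f : ℕ → ℕ) → Σ< n (λ x → f (suc x)) ≤ Σ< (suc n) f
Σ-shift≤ n f = m≤n+m _ (f 0)

Π-mono : ∀ n {f g : ℕ → ℕ} → (∀ x → x < n → f x ≤ g x) → Π< n f ≤ Π< n g
Π-mono zero    h = ≤-refl
Π-mono (suc n) h = *-mono-≤ (h 0 (s≤s z≤n)) (Π-mono n (λ x x<n → h (suc x) (s≤s x<n)))

Π-cong : ∀ n {f g : ℕ → ℕ} → (∀ x → x < n → f x ≡ g x) → Π< n f ≡ Π< n g
Π-cong zero    h = refl
Π-cong (suc n) h = cong₂ _*_ (h 0 (s≤s z≤n)) (Π-cong n (λ x x<n → h (suc x) (s≤s x<n)))

Π-* : ∀ n (f g : ℕ → ℕ) → Π< n (λ x → f x * g x) ≡ Π< n f * Π< n g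
Π-* zero    f g = refl
Π-* (suc n) f g = trans (cong (f 0 * g 0 *_) (Π-* n _ _)) (lem (f 0) (g 0) _ _)
  where
  lem : ∀ a b c d → a * b * (c * d) ≡ a * c * (b * d)
  lem = solve-∀

Π-const : ∀ n c → Π< n (λ _ → c) ≡ c ^ n
Π-const zero    c = refl
Π-const (suc n) c = cong (c *_) (Π-const n c)

Π-^ : ∀ n c (f : ℕ → ℕ) → Π< n (λ x → c ^ f x) ≡ c ^ Σ< n f
Π-^ zero    c f = refl
Π-^ (suc n) c f = trans (cong (c ^ f 0 *_) (Π-^ n c _)) (sym (^-distribˡ-+-* c (f 0) _))

-- The remainder `R` is fixed before `g`, so the sequences before and after an update of two
-- adjacent sites are compared with the same `R`.
Σ-pair : ∀ n i (f : ℕ → ℕ) → suc i < n → ∃ λ R → ∀ g →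
         (∀ x → x ≢ i → x ≢ suc i → g x ≡ f x) → Σ< n g ≡ R + (g i + g (suc i))
Σ-pair (suc (suc n)) zero f _ = Σ< n (λ x → f (suc (suc x))) , λ g h →
  trans (cong (λ S → g 0 + (g 1 + S)) (Σ-cong n (λ x _ → h (suc (suc x)) (λ ()) (λ ()))))
        (lem (g 0) (g 1) _)
  where
  lem : ∀ a b c → a + (b + c) ≡ c + (a + b)
  lem = solve-∀
Σ-pair (suc n) (suc i) f (s≤s i<n) with Σ-pair n i (λ x → f (suc x)) i<n
... | R , eq = f 0 + R , λ g h →
  trans (cong₂ _+_ (h 0 (λ ()) (λ ()))
          (eq (λ x → g (suc x)) (λ x p q → h (suc x) (p ∘ suc-injective) (q ∘ suc-injective))))
        (sym (+-assoc (f 0) R _))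

Π-pair : ∀ n i (f : ℕ → ℕ) → suc i < n → ∃ λ R → ∀ g →
         (∀ x → x ≢ i → x ≢ suc i → g x ≡ f x) → Π< n g ≡ R * (g i * g (suc i))
Π-pair (suc (suc n)) zero f _ = Π< n (λ x → f (suc (suc x))) , λ g h →
  trans (cong (λ S → g 0 * (g 1 * S)) (Π-cong n (λ x _ → h (suc (suc x)) (λ ()) (λ ()))))
        (lem (g 0) (g 1) _)
  where
  lem : ∀ a b c → a * (b * c) ≡ c * (a * b)
  lem = solve-∀
Π-pair (suc n) (suc i) f (s≤s i<n) with Π-pair n i (λ x → f (suc x)) i<n
... | R , eq = f 0 * R , λ g h →
  trans (cong₂ _*_ (h 0 (λ ()) (λ ()))
          (eq (λ x → g (suc x)) (λ x p q → h (suc x) (p ∘ suc-injective) (q ∘ suc-injective))))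
        (sym (*-assoc (f 0) R _))

upd : ℕ → ℕ → (ℕ → ℕ) → ℕ → ℕ
upd zero    y f zero    = y
upd zero    y f (suc x) = f (suc x)
upd (suc i) y f zero    = f 0
upd (suc i) y f (suc x) = upd i y (λ z → f (suc z)) x

upd-at : ∀ i y f → upd i y f i ≡ y
upd-at zero    y f = refl
upd-at (suc i) y f = upd-at i y (λ z → f (suc z))

upd-off : ∀ i y f x → x ≢ i → upd i y f x ≡ f x
upd-off zero    y f zero    ne = ⊥-elim (ne refl)
upd-off zero    y f (suc x) ne = refl
upd-off (suc i) y f zero    ne = refl
upd-off (suc i) y f (suc x) ne = upd-off i y (λ z → f (suc z)) x (ne ∘ cong suc)

-- Dividing out factor i without division; it is the partial derivative of the product with respect
-- to that factor.
Π-without : ℕ → ℕ → (ℕ → ℕ) → ℕ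
Π-without n i f = Π< n (upd i 1 f)

Π-split : ∀ n i (f g : ℕ → ℕ) → i < n → (∀ x → x ≢ i → g x ≡ f x) → Π< n g ≡ g i * Π-without n i f
Π-split (suc n) zero f g _ h =
  cong (g 0 *_) (trans (Π-cong n (λ x _ → h (suc x) (λ ()))) (sym (+-identityʳ _)))
Π-split (suc n) (suc i) f g (s≤s i<n) h =
  trans (cong₂ _*_ (h 0 (λ ())) (Π-split n i (λ x → f (suc x)) (λ x → g (suc x)) i<n
          (λ x p → h (suc x) (p ∘ suc-injective))))
        (lem (f 0) (g (suc i)) _)
  where
  lem : ∀ a b c → a * (b * c) ≡ b * (a * c)
  lem = solve-∀

-- Weierstrass' product inequality, in a form without subtraction.
Π-perturb : ∀ n A (b y : ℕ → ℕ) → (∀ x → x < n → A ≤ b x + y x) →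
            A * Π< n (λ x → b x + y x) ≤ A * Π< n b + Σ< n y * Π< n (λ x → b x + y x)
Π-perturb zero A b y h = m≤m+n _ _
Π-perturb (suc n) A b y h = begin
  A * ((b 0 + y 0) * P)                          ≡⟨ e₁ A (b 0) (y 0) P ⟩
  b 0 * (A * P) + A * (y 0 * P)                  ≤⟨ +-mono-≤ (*-monoʳ-≤ (b 0) (Π-perturb n A _ _ (λ x l → h (suc x) (s≤s l)))) (*-monoˡ-≤ (y 0 * P) (h 0 (s≤s z≤n))) ⟩
  b 0 * (A * B + S * P) + (b 0 + y 0) * (y 0 * P) ≤⟨ m≤m+n _ (y 0 * (S * P)) ⟩
  b 0 * (A * B + S * P) + (b 0 + y 0) * (y 0 * P) + y 0 * (S * P) ≡⟨ e₂ A (b 0) (y 0) P B S ⟩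
  A * (b 0 * B) + (y 0 + S) * ((b 0 + y 0) * P)  ∎
  where
  open ≤-Reasoning
  P = Π< n (λ x → b (suc x) + y (suc x))
  B = Π< n (λ x → b (suc x))
  S = Σ< n (λ x → y (suc x))
  e₁ : ∀ A b y P → A * ((b + y) * P) ≡ b * (A * P) + A * (y * P)
  e₁ = solve-∀
  e₂ : ∀ A b y P B S → b * (A * B + S * P) + (b + y) * (y * P) + y * (S * P) ≡ A * (b * B) + (y + S) * ((b + y) * P)
  e₂ = solve-∀

-- Only the terms of order zero and one in `y` are kept. This absorbs a first-order correction,
-- given as a sum over sites, into the factors and so restores product form.
Π-expand : ∀ n (a y : ℕ → ℕ) → Π< n a + Σ< n (λ v → Π-without n v a * y v) ≤ Π< n (λ x → a x + y x)
Π-expand zero a y = ≤-refl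
Π-expand (suc n) a y = begin
  a 0 * P + ((1 * P) * y 0 + Σ< n (λ v → (a 0 * Π-without n v a') * y (suc v)))
    ≡⟨ cong (λ T → a 0 * P + ((1 * P) * y 0 + T)) (trans (Σ-cong n (λ v _ → *-assoc (a 0) _ _)) (Σ-* n (a 0) _)) ⟩
  a 0 * P + ((1 * P) * y 0 + a 0 * S)            ≡⟨ e (a 0) P (y 0) S ⟩
  a 0 * (P + S) + y 0 * P                        ≤⟨ +-mono-≤ (*-monoʳ-≤ (a 0) IH) (*-monoʳ-≤ (y 0) (m+n≤o⇒m≤o P IH)) ⟩
  a 0 * R + y 0 * R                              ≡⟨ *-distribʳ-+ R (a 0) (y 0) ⟨
  (a 0 + y 0) * R                                ∎
  where
  open ≤-Reasoning
  a' = λ x → a (suc x)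
  P = Π< n a'
  S = Σ< n (λ v → Π-without n v a' * y (suc v))
  R = Π< n (λ x → a (suc x) + y (suc x))
  IH : P + S ≤ R
  IH = Π-expand n a' (λ x → y (suc x))
  e : ∀ a P y S → a * P + ((1 * P) * y + a * S) ≡ a * (P + S) + y * P
  e = solve-∀

-- Sequences on all of ℕ allow recursion on neighbouring indices i and i + 1. The default 0 keeps
-- upper bounds such as `val≤n` true at every index.
ext : ∀ {n} → (Fin n → ℕ) → ℕ → ℕ
ext {zero}  F x       = 0
ext {suc n} F zero    = F fzero
ext {suc n} F (suc x) = ext (F ∘ fsuc) x

ext-toℕ : ∀ {n} (F : Fin n → ℕ) i → ext F (toℕ i) ≡ F i
ext-toℕ F fzero    = refl
ext-toℕ F (fsuc i) = ext-toℕ (F ∘ fsuc) i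

ext-elim : ∀ {n} (F : Fin n → ℕ) (P : ℕ → ℕ → Set) → (∀ i → P (toℕ i) (F i)) → ∀ x → x < n → P x (ext F x)
ext-elim {suc n} F P h zero    _         = h fzero
ext-elim {suc n} F P h (suc x) (s≤s x<n) = ext-elim (F ∘ fsuc) (P ∘ suc) (h ∘ fsuc) x x<n

sum-ext : ∀ {n} (F : Fin n → ℕ) → sum (map F (allFin n)) ≡ Σ< n (ext F)
sum-ext F = trans (cong sum (map-tabulate id F)) (go F)
  where
  go : ∀ {n} (F : Fin n → ℕ) → sum (tabulate F) ≡ Σ< n (ext F)
  go {zero}  F = refl
  go {suc n} F = cong (F fzero +_) (go (F ∘ fsuc))

-- Sorting and mixing as operations on sequences

Seq : Set
Seq = ℕ → ℕ

srt : ℕ → Seq → Seq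
srt zero    τ zero          = τ 0 ⊓ τ 1
srt zero    τ (suc zero)    = τ 0 ⊔ τ 1
srt zero    τ (suc (suc x)) = τ (suc (suc x))
srt (suc i) τ zero          = τ 0
srt (suc i) τ (suc x)       = srt i (λ y → τ (suc y)) x

srt-lo : ∀ i τ → srt i τ i ≡ τ i ⊓ τ (suc i)
srt-lo zero    τ = refl
srt-lo (suc i) τ = srt-lo i (λ y → τ (suc y))

srt-hi : ∀ i τ → srt i τ (suc i) ≡ τ i ⊔ τ (suc i)
srt-hi zero    τ = refl
srt-hi (suc i) τ = srt-hi i (λ y → τ (suc y))

srt-off : ∀ i τ x → x ≢ i → x ≢ suc i → srt i τ x ≡ τ x
srt-off zero    τ zero          p q = ⊥-elim (p refl)
srt-off zero    τ (suc zero)    p q = ⊥-elim (q refl)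
srt-off zero    τ (suc (suc x)) p q = refl
srt-off (suc i) τ zero          p q = refl
srt-off (suc i) τ (suc x)       p q = srt-off i (λ y → τ (suc y)) x (p ∘ cong suc) (q ∘ cong suc)

srt-≤ : ∀ i τ {m} → (∀ x → τ x ≤ m) → ∀ x → srt i τ x ≤ m
srt-≤ zero    τ h zero          = ≤-trans (m⊓n≤m _ _) (h 0)
srt-≤ zero    τ h (suc zero)    = ⊔-lub (h 0) (h 1)
srt-≤ zero    τ h (suc (suc x)) = h _
srt-≤ (suc i) τ h zero          = h 0
srt-≤ (suc i) τ h (suc x)       = srt-≤ i (λ y → τ (suc y)) (h ∘ suc) x

sw : ℕ → ℕ → ℕ
sw zero    zero          = 1
sw zero    (suc zero)    = 0
sw zero    (suc (suc v)) = suc (suc v)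
sw (suc i) zero          = 0
sw (suc i) (suc v)       = suc (sw i v)

sw-lo : ∀ i → sw i i ≡ suc i
sw-lo zero    = refl
sw-lo (suc i) = cong suc (sw-lo i)

sw-hi : ∀ i → sw i (suc i) ≡ i
sw-hi zero    = refl
sw-hi (suc i) = cong suc (sw-hi i)

sw-off : ∀ i v → v ≢ i → v ≢ suc i → sw i v ≡ v
sw-off zero    zero          p q = ⊥-elim (p refl)
sw-off zero    (suc zero)    p q = ⊥-elim (q refl)
sw-off zero    (suc (suc v)) p q = refl
sw-off (suc i) zero          p q = refl
sw-off (suc i) (suc v)       p q = cong suc (sw-off i v (p ∘ cong suc) (q ∘ cong suc))

-- Permutations as sequences of values

val inv : ∀ {n} → Permutation′ n → Seq
val π = ext (λ i → toℕ (π ⟨$⟩ʳ i))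
inv π = ext (λ i → toℕ (π ⟨$⟩ˡ i))

val-toℕ : ∀ {n} (π : Permutation′ n) i → val π (toℕ i) ≡ toℕ (π ⟨$⟩ʳ i)
val-toℕ π = ext-toℕ _

val<n : ∀ {n} (π : Permutation′ n) x → x < n → val π x < n
val<n {n} π = ext-elim _ (λ _ y → y < n) (λ i → toℕ<n _)

ext-out : ∀ {n} (F : Fin n → ℕ) x → n ≤ x → ext F x ≡ 0
ext-out {zero}  F x       _         = refl
ext-out {suc n} F (suc x) (s≤s n≤x) = ext-out (F ∘ fsuc) x n≤x

val≤n : ∀ {n} (π : Permutation′ n) x → val π x ≤ n
val≤n {n} π x with x <? n
... | yes x<n = <⇒≤ (val<n π x x<n)
... | no  x≮n = subst (_≤ n) (sym (ext-out (λ i → toℕ (π ⟨$⟩ʳ i)) x (≮⇒≥ x≮n))) z≤n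

-- Sorting acts on positions and mixing on values; this and `Π-reindex` pass from one index to the
-- other.
Σ-reindex : ∀ {n} (π : Permutation′ n) (F : ℕ → ℕ → ℕ) → Σ< n (λ x → F x (val π x)) ≡ Σ< n (λ v → F (inv π v) v)
Σ-reindex {n} π F =
  trans (sym (toΣ (λ x → F x (val π x)) f₁ (λ i → cong (F (toℕ i)) (val-toℕ π i))))
  (trans (sum-cong-≗ (λ i → cong (λ j → F j (toℕ (π ⟨$⟩ʳ i))) (cong toℕ (sym (inverseˡ π)))))
  (trans (sym (sum-permute f₂ π)) (toΣ (λ v → F (inv π v) v) f₂ (λ v → cong (λ j → F j (toℕ v)) (ext-toℕ _ v)))))
  where
  open CMSum +-0-commutativeMonoid using (sum-permute; sum-cong-≗) renaming (sum to sumF)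
  f₁ : Fin n → ℕ
  f₁ i = F (toℕ i) (toℕ (π ⟨$⟩ʳ i))
  f₂ : Fin n → ℕ
  f₂ v = F (toℕ (π ⟨$⟩ˡ v)) (toℕ v)
  toΣ : ∀ {n} (g : ℕ → ℕ) (f : Fin n → ℕ) → (∀ i → g (toℕ i) ≡ f i) → sumF f ≡ Σ< n g
  toΣ {zero}  g f h = refl
  toΣ {suc n} g f h = cong₂ _+_ (sym (h fzero)) (toΣ (λ x → g (suc x)) (f ∘ fsuc) (h ∘ fsuc))

Π-reindex : ∀ {n} (π : Permutation′ n) (F : ℕ → ℕ → ℕ) → Π< n (λ x → F x (val π x)) ≡ Π< n (λ v → F (inv π v) v)
Π-reindex {n} π F =
  trans (sym (toΠ (λ x → F x (val π x)) f₁ (λ i → cong (F (toℕ i)) (val-toℕ π i))))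
  (trans (sum-cong-≗ (λ i → cong (λ j → F j (toℕ (π ⟨$⟩ʳ i))) (cong toℕ (sym (inverseˡ π)))))
  (trans (sym (sum-permute f₂ π)) (toΠ (λ v → F (inv π v) v) f₂ (λ v → cong (λ j → F j (toℕ v)) (ext-toℕ _ v)))))
  where
  open CMSum *-1-commutativeMonoid using (sum-permute; sum-cong-≗) renaming (sum to prodF)
  f₁ : Fin n → ℕ
  f₁ i = F (toℕ i) (toℕ (π ⟨$⟩ʳ i))
  f₂ : Fin n → ℕ
  f₂ v = F (toℕ (π ⟨$⟩ˡ v)) (toℕ v)
  toΠ : ∀ {n} (g : ℕ → ℕ) (f : Fin n → ℕ) → (∀ i → g (toℕ i) ≡ f i) → prodF f ≡ Π< n g
  toΠ {zero}  g f h = refl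
  toΠ {suc n} g f h = cong₂ _*_ (sym (h fzero)) (toΠ (λ x → g (suc x)) (f ∘ fsuc) (h ∘ fsuc))

toℕ-≢ : ∀ {n} {x y : Fin n} → x ≢ y → toℕ x ≢ toℕ y
toℕ-≢ p = p ∘ toℕ-injective

transpose-sw : ∀ {k} (i : Fin k) (y : Fin (suc k)) → toℕ (PC.transpose (inject₁ i) (fsuc i) y) ≡ sw (toℕ i) (toℕ y)
transpose-sw i y with y F.≟ inject₁ i
... | yes refl = trans (sym (sw-lo (toℕ i))) (cong (sw (toℕ i)) (sym (toℕ-inject₁ i)))
... | no p with y F.≟ fsuc i
...   | yes refl = trans (toℕ-inject₁ i) (sym (sw-hi (toℕ i)))
...   | no q = sym (sw-off (toℕ i) (toℕ y) (λ e → toℕ-≢ p (trans e (sym (toℕ-inject₁ i)))) (toℕ-≢ q))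

val-mix : ∀ {k} (i : Fin k) (π : Permutation′ (suc k)) x → x < suc k → val (mixStep i π) x ≡ sw (toℕ i) (val π x)
val-mix i π = ext-elim _ (λ x y → y ≡ sw (toℕ i) (val π x))
  (λ y → trans (transpose-sw i (π ⟨$⟩ʳ y)) (cong (sw (toℕ i)) (sym (val-toℕ π y))))

val-sort : ∀ {k} (i : Fin k) (π : Permutation′ (suc k)) x → x < suc k → val (sortStep i π) x ≡ srt (toℕ i) (val π) x
val-sort {k} i π = ext-elim _ (λ x y → y ≡ srt (toℕ i) (val π) x) go
  where
  vlo : val π (toℕ i) ≡ toℕ (π ⟨$⟩ʳ inject₁ i)
  vlo = trans (cong (val π) (sym (toℕ-inject₁ i))) (val-toℕ π (inject₁ i))
  vhi : val π (suc (toℕ i)) ≡ toℕ (π ⟨$⟩ʳ fsuc i)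
  vhi = val-toℕ π (fsuc i)
  offy : ∀ {y : Fin (suc k)} → y ≢ inject₁ i → toℕ y ≢ toℕ i
  offy p e = toℕ-≢ p (trans e (sym (toℕ-inject₁ i)))
  go : ∀ y → toℕ (sortStep i π ⟨$⟩ʳ y) ≡ srt (toℕ i) (val π) (toℕ y)
  go y with toℕ (π ⟨$⟩ʳ fsuc i) <? toℕ (π ⟨$⟩ʳ inject₁ i)
  go y | yes lt with y F.≟ inject₁ i
  ... | yes refl = sym (trans (cong (srt (toℕ i) (val π)) (toℕ-inject₁ i))
                    (trans (srt-lo (toℕ i) (val π)) (trans (cong₂ _⊓_ vlo vhi) (m≥n⇒m⊓n≡n (<⇒≤ lt)))))
  ... | no p with y F.≟ fsuc i
  ...   | yes refl = sym (trans (srt-hi (toℕ i) (val π)) (trans (cong₂ _⊔_ vlo vhi) (m≥n⇒m⊔n≡m (<⇒≤ lt))))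
  ...   | no q = trans (sym (val-toℕ π y)) (sym (srt-off (toℕ i) (val π) (toℕ y) (offy p) (toℕ-≢ q)))
  go y | no ge with y F.≟ inject₁ i
  ... | yes refl = sym (trans (cong (srt (toℕ i) (val π)) (toℕ-inject₁ i))
                    (trans (srt-lo (toℕ i) (val π)) (trans (cong₂ _⊓_ vlo vhi) (m≤n⇒m⊓n≡m (≮⇒≥ ge)))))
  ... | no p with y F.≟ fsuc i
  ...   | yes refl = sym (trans (srt-hi (toℕ i) (val π)) (trans (cong₂ _⊔_ vlo vhi) (m≤n⇒m⊔n≡n (≮⇒≥ ge))))
  ...   | no q = trans (sym (val-toℕ π y)) (sym (srt-off (toℕ i) (val π) (toℕ y) (offy p) (toℕ-≢ q)))

-- Kinds of steps, expectations without division, supermartingales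

data Kind : Set where
  srtK mixK : Kind

count : (Kind → ℕ) → List Kind → ℕ
count w []       = 0
count w (c ∷ cs) = w c + count w cs

isSort isMix : Kind → ℕ
isSort srtK = 1
isSort mixK = 0
isMix srtK = 0
isMix mixK = 1

nsort nmix : List Kind → ℕ
nsort = count isSort
nmix  = count isMix

ΣF : ∀ {k} → (Fin k → ℕ) → ℕ
ΣF {k} F = Σ< k (ext F)

ΣF-≤ : ∀ {k} (F : Fin k → ℕ) (G : ℕ → ℕ) → (∀ i → F i ≤ G (toℕ i)) → ΣF F ≤ Σ< k G
ΣF-≤ {k} F G h = Σ-mono k (ext-elim F (λ x y → y ≤ G x) h)

ΣF-mono : ∀ {k} (F G : Fin k → ℕ) → (∀ i → F i ≤ G i) → ΣF F ≤ ΣF G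
ΣF-mono F G h = ΣF-≤ F (ext G) (λ i → subst (F i ≤_) (sym (ext-toℕ G i)) (h i))

ΣF-cong : ∀ {k} (F G : Fin k → ℕ) → (∀ i → F i ≡ G i) → ΣF F ≡ ΣF G
ΣF-cong F G h = ≤-antisym (ΣF-mono F G (λ i → ≤-reflexive (h i))) (ΣF-mono G F (λ i → ≤-reflexive (sym (h i))))

ΣF-+ : ∀ {k} (F G : Fin k → ℕ) → ΣF (λ i → F i + G i) ≡ ΣF F + ΣF G
ΣF-+ {zero}  F G = refl
ΣF-+ {suc k} F G = trans (cong (F fzero + G fzero +_) (ΣF-+ (F ∘ fsuc) (G ∘ fsuc))) (lem (F fzero) (G fzero) _ _)
  where
  lem : ∀ a b c d → a + b + (c + d) ≡ a + c + (b + d)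
  lem = solve-∀

ΣF-* : ∀ {k} c (F : Fin k → ℕ) → ΣF (λ i → c * F i) ≡ c * ΣF F
ΣF-* {zero}  c F = sym (*-zeroʳ c)
ΣF-* {suc k} c F = trans (cong (c * F fzero +_) (ΣF-* c (F ∘ fsuc))) (sym (*-distribˡ-+ c (F fzero) _))

ΣF-const : ∀ {k} c → ΣF {k} (λ _ → c) ≡ k * c
ΣF-const {zero}  c = refl
ΣF-const {suc k} c = cong (c +_) (ΣF-const {k} c)

module _ {X : Set} {k : ℕ} (act : Kind → Fin k → X → X) where

  -- k ^ length cs times the expectation of f after the steps cs.
  Ex : List Kind → (X → ℕ) → X → ℕ
  Ex []       f s = f s
  Ex (c ∷ cs) f s = ΣF (λ i → Ex cs f (act c i s))

  Ex-mono : ∀ cs {f g : X → ℕ} → (∀ s → f s ≤ g s) → ∀ s → Ex cs f s ≤ Ex cs g s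
  Ex-mono []       h s = h s
  Ex-mono (c ∷ cs) h s = ΣF-mono _ _ (λ i → Ex-mono cs h (act c i s))

  Ex-mono-inv : (Inv : X → Set) → (∀ c i s → Inv s → Inv (act c i s)) →
                ∀ cs {f g : X → ℕ} → (∀ s → Inv s → f s ≤ g s) → ∀ s → Inv s → Ex cs f s ≤ Ex cs g s
  Ex-mono-inv Inv p []       h s v = h s v
  Ex-mono-inv Inv p (c ∷ cs) h s v = ΣF-mono _ _ (λ i → Ex-mono-inv Inv p cs h (act c i s) (p c i s v))

  Ex-+ : ∀ cs (f g : X → ℕ) s → Ex cs (λ x → f x + g x) s ≡ Ex cs f s + Ex cs g s
  Ex-+ []       f g s = refl
  Ex-+ (c ∷ cs) f g s = trans (ΣF-cong _ _ (λ i → Ex-+ cs f g (act c i s))) (ΣF-+ {k} _ _)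

  Ex-* : ∀ cs a (f : X → ℕ) s → Ex cs (λ x → a * f x) s ≡ a * Ex cs f s
  Ex-* []       a f s = refl
  Ex-* (c ∷ cs) a f s = trans (ΣF-cong _ _ (λ i → Ex-* cs a f (act c i s))) (ΣF-* {k} a _)

  Ex-const : ∀ cs a s → Ex cs (λ _ → a) s ≡ k ^ length cs * a
  Ex-const []       a s = sym (+-identityʳ a)
  Ex-const (c ∷ cs) a s =
    trans (ΣF-cong _ _ (λ i → Ex-const cs a (act c i s)))
          (trans (ΣF-const {k} _) (sym (*-assoc k (k ^ length cs) a)))

  Ex-++ : ∀ cs ds (f : X → ℕ) s → Ex (cs ++ ds) f s ≡ Ex cs (Ex ds f) s
  Ex-++ []       ds f s = refl
  Ex-++ (c ∷ cs) ds f s = ΣF-cong _ _ (λ i → Ex-++ cs ds f (act c i s))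

  norm : (Kind → ℕ) → List Kind → ℕ
  norm N []       = 1
  norm N (c ∷ cs) = N c * norm N cs

  -- Backward induction on the steps still to come: `V cs` may depend on `cs`, so its parameters
  -- anticipate the remaining growth, and `V []` is the quantity to be estimated. `N c` is the
  -- denominator that a step of kind `c` introduces.
  Ex-super : (Inv : X → Set) → (∀ c i s → Inv s → Inv (act c i s)) →
             (N : Kind → ℕ) (V : List Kind → X → ℕ) →
             (∀ c cs s → Inv s → N c * ΣF (λ i → V cs (act c i s)) ≤ k * V (c ∷ cs) s) →
             ∀ cs s → Inv s → norm N cs * Ex cs (V []) s ≤ k ^ length cs * V cs s
  Ex-super Inv p N V h []       s v = ≤-refl
  Ex-super Inv p N V h (c ∷ cs) s v = begin
    N c * norm N cs * ΣF (λ i → Ex cs (V []) (act c i s))          ≡⟨ *-assoc (N c) _ _ ⟩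
    N c * (norm N cs * ΣF (λ i → Ex cs (V []) (act c i s)))        ≡⟨ cong (N c *_) (ΣF-* {k} (norm N cs) _) ⟨
    N c * ΣF (λ i → norm N cs * Ex cs (V []) (act c i s))          ≤⟨ *-monoʳ-≤ (N c) (ΣF-mono _ _ (λ i → Ex-super Inv p N V h cs (act c i s) (p c i s v))) ⟩
    N c * ΣF (λ i → k ^ length cs * V cs (act c i s))              ≡⟨ cong (N c *_) (ΣF-* {k} (k ^ length cs) _) ⟩
    N c * (k ^ length cs * ΣF (λ i → V cs (act c i s)))            ≡⟨ lem (N c) (k ^ length cs) _ ⟩
    k ^ length cs * (N c * ΣF (λ i → V cs (act c i s)))            ≤⟨ *-monoʳ-≤ (k ^ length cs) (h c cs s v) ⟩
    k ^ length cs * (k * V (c ∷ cs) s)                             ≡⟨ lem₂ (k ^ length cs) k _ ⟩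
    k * k ^ length cs * V (c ∷ cs) s                               ∎
    where
    open ≤-Reasoning
    lem : ∀ a b c → a * (b * c) ≡ b * (a * c)
    lem = solve-∀
    lem₂ : ∀ a b c → a * (b * c) ≡ b * a * c
    lem₂ = solve-∀

-- Exponential weights for the deviation caused by mixing

-- π runs the real process, σ only its sorting steps, and τ the same sorting steps from another
-- start. The shared index `i` is the coupling.
act : ∀ {k} → Kind → Fin k → Permutation′ (suc k) × Seq × Seq → Permutation′ (suc k) × Seq × Seq
act srtK i (π , σ , τ) = sortStep i π , srt (toℕ i) σ , srt (toℕ i) τ
act mixK i (π , σ , τ) = mixStep i π , σ , τ

-- The last sum is a first-order correction: factor v is replaced by `G v * c v`. For G v = ((q + 1)
-- / q) ^ (± v) the natural choice is N = q (q + 1), because the discrete Laplacian of G is then G /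
-- (q (q + 1)).
MixBound : ℕ → ℕ → (ℕ → ℕ) → Set
MixBound k N G = ∀ α (c : ℕ → ℕ) →
  N * Σ< k (λ i → Π< (suc k) (λ v → α + G (sw i v) * c v))
    ≤ N * (k * Π< (suc k) (λ v → α + G v * c v))
      + Σ< (suc k) (λ v → Π-without (suc k) v (λ w → α + G w * c w) * (G v * c v))

module _ (k : ℕ) (G : ℕ → ℕ) (α : ℕ) (c : ℕ → ℕ) where
  private
    n = suc k
    f : ℕ → ℕ
    f v = α + G v * c v
    P = Π< n f
    Q : ℕ → ℕ
    Q i = Π< n (λ v → α + G (sw i v) * c v)
    T : ℕ → ℕ
    T v = Π-without n v f * c v

    swapped : ∀ i → i < k → ∃ λ R → (P ≡ R * (f i * f (suc i)))
              × (Q i ≡ R * ((α + G (suc i) * c i) * (α + G i * c (suc i))))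
              × (Π-without n i f ≡ R * f (suc i)) × (Π-without n (suc i) f ≡ R * f i)
    swapped i i<k with Π-pair n i f (s≤s i<k)
    ... | R , eq = R , eq f (λ _ _ _ → refl)
                 , trans (eq _ (λ x p q → cong (λ w → α + G w * c x) (sw-off i x p q)))
                         (cong₂ (λ u w → R * ((α + G u * c i) * (α + G w * c (suc i)))) (sw-lo i) (sw-hi i))
                 , trans (eq _ (λ x p q → upd-off i 1 f x p))
                         (trans (cong₂ (λ u w → R * (u * w)) (upd-at i 1 f) (upd-off i 1 f (suc i) (λ e → <⇒≢ (n<1+n i) (sym e))))
                                (cong (R *_) (*-identityˡ _)))
                 , trans (eq _ (λ x p q → upd-off (suc i) 1 f x q))
                         (trans (cong₂ (λ u w → R * (u * w)) (upd-off (suc i) 1 f i (<⇒≢ (n<1+n i))) (upd-at (suc i) 1 f))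
                                (cong (R *_) (*-identityʳ _)))

  -- The product is affine in each weight, and `T v` is its derivative with respect to `G v`.
  -- Exchanging the weights of i and i + 1 changes it by `T i * e` minus `T (suc i) * e` minus the
  -- second-order term R e^2 c(i) c(i+1), whose sign allows it to be dropped.
  swap-inc : ∀ e i → i < k → G (suc i) ≡ G i + e → Q i + T (suc i) * e ≤ P + T i * e
  swap-inc e i i<k Ge with swapped i i<k
  ... | R , p , q , wi , wj
    rewrite p | q | wi | wj | Ge =
    ≤-trans (m≤m+n _ (R * (e * e * c i * c (suc i)))) (≤-reflexive (lem R α (G i) e (c i) (c (suc i))))
    where
    lem : ∀ R α g e c d → R * ((α + (g + e) * c) * (α + g * d)) + R * (α + g * c) * d * e + R * (e * e * c * d)
          ≡ R * ((α + g * c) * (α + (g + e) * d)) + R * (α + (g + e) * d) * c * e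
    lem = solve-∀

  swap-dec : ∀ e i → i < k → G i ≡ G (suc i) + e → Q i + T i * e ≤ P + T (suc i) * e
  swap-dec e i i<k Ge with swapped i i<k
  ... | R , p , q , wi , wj
    rewrite p | q | wi | wj | Ge =
    ≤-trans (m≤m+n _ (R * (e * e * c i * c (suc i)))) (≤-reflexive (lem R α (G (suc i)) e (c i) (c (suc i))))
    where
    lem : ∀ R α g e c d → R * ((α + g * c) * (α + (g + e) * d)) + R * (α + g * d) * c * e + R * (e * e * c * d)
          ≡ R * ((α + (g + e) * c) * (α + g * d)) + R * (α + (g + e) * c) * d * e
    lem = solve-∀

  private
    finish : ∀ N (u w : ℕ → ℕ) → (∀ i → i < k → Q i + u i ≤ P + w i) →
             N * Σ< k w ≤ Σ< n (λ v → T v * G v) + N * Σ< k u →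
             N * Σ< k Q ≤ N * (k * P) + Σ< n (λ v → Π-without n v f * (G v * c v))
    finish N u w step flow = +-cancelʳ-≤ (N * Σ< k u) _ _ (begin
      N * Σ< k Q + N * Σ< k u              ≡⟨ *-distribˡ-+ N _ _ ⟨
      N * (Σ< k Q + Σ< k u)                ≡⟨ cong (N *_) (Σ-+ k Q u) ⟨
      N * Σ< k (λ i → Q i + u i)           ≤⟨ *-monoʳ-≤ N (Σ-mono k step) ⟩
      N * Σ< k (λ i → P + w i)             ≡⟨ cong (N *_) (trans (Σ-+ k _ w) (cong (_+ Σ< k w) (Σ-const k P))) ⟩
      N * (k * P + Σ< k w)                 ≡⟨ *-distribˡ-+ N _ _ ⟩
      N * (k * P) + N * Σ< k w             ≤⟨ +-monoʳ-≤ (N * (k * P)) flow ⟩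
      N * (k * P) + (Σ< n (λ v → T v * G v) + N * Σ< k u) ≡⟨ +-assoc (N * (k * P)) _ _ ⟨
      N * (k * P) + Σ< n (λ v → T v * G v) + N * Σ< k u
        ≡⟨ cong (λ S → N * (k * P) + S + N * Σ< k u) (Σ-cong n (λ v _ → lem (Π-without n v f) (c v) (G v))) ⟩
      N * (k * P) + Σ< n (λ v → Π-without n v f * (G v * c v)) + N * Σ< k u ∎)
      where
      open ≤-Reasoning
      lem : ∀ a b d → a * b * d ≡ a * (d * b)
      lem = solve-∀

    scale : ∀ N m (S e : ℕ → ℕ) → N * Σ< m (λ i → S i * e i) ≡ Σ< m (λ i → S i * (N * e i))
    scale N m S e = trans (sym (Σ-* m N _)) (Σ-cong m (λ i _ → lem N (S i) (e i)))
      where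
      lem : ∀ a b d → a * (b * d) ≡ b * (a * d)
      lem = solve-∀

  -- Summation by parts: comparing coefficients of `T v` reduces the claim to N (e v - e (v - 1)) ≤
  -- G v, a bound on the discrete Laplacian. At the end 0 nothing is subtracted, hence the separate
  -- condition there; at the other end the boundary term helps.
  mix-inc : ∀ N (e : ℕ → ℕ) → (∀ i → i < k → G (suc i) ≡ G i + e i) →
            N * e 0 ≤ G 0 → (∀ i → suc i < k → N * e (suc i) ≤ G (suc i) + N * e i) →
            N * Σ< k Q ≤ N * (k * P) + Σ< n (λ v → Π-without n v f * (G v * c v))
  mix-inc N e Ge b0 bs = finish N _ _ (λ i i<k → swap-inc (e i) i i<k (Ge i i<k)) flow
    where
    flowk : ∀ m → (∀ i → suc i < m → N * e (suc i) ≤ G (suc i) + N * e i) →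
            Σ< m (λ i → T i * (N * e i)) ≤ Σ< (suc m) (λ v → T v * G v) + Σ< m (λ i → T (suc i) * (N * e i))
    flowk zero    h = z≤n
    flowk (suc m) h = begin
      T 0 * (N * e 0) + Σ< m (λ i → T (suc i) * (N * e (suc i)))
        ≤⟨ +-mono-≤ (*-monoʳ-≤ (T 0) b0) (Σ-mono m (λ i i<m → *-monoʳ-≤ (T (suc i)) (h i (s≤s i<m)))) ⟩
      T 0 * G 0 + Σ< m (λ i → T (suc i) * (G (suc i) + N * e i))
        ≡⟨ cong (T 0 * G 0 +_) (trans (Σ-cong m (λ i _ → *-distribˡ-+ (T (suc i)) _ _)) (Σ-+ m _ _)) ⟩
      T 0 * G 0 + (Σ< m (λ i → T (suc i) * G (suc i)) + Σ< m (λ i → T (suc i) * (N * e i)))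
        ≤⟨ +-monoʳ-≤ (T 0 * G 0) (+-mono-≤ (sub m (λ i → T (suc i) * G (suc i))) (sub m (λ i → T (suc i) * (N * e i)))) ⟩
      T 0 * G 0 + (Σ< (suc m) (λ i → T (suc i) * G (suc i)) + Σ< (suc m) (λ i → T (suc i) * (N * e i)))
        ≡⟨ +-assoc (T 0 * G 0) _ _ ⟨
      Σ< (suc (suc m)) (λ v → T v * G v) + Σ< (suc m) (λ i → T (suc i) * (N * e i)) ∎
      where
      open ≤-Reasoning
      sub : ∀ m (g : ℕ → ℕ) → Σ< m g ≤ Σ< (suc m) g
      sub m g = ≤-trans (m≤m+n _ (g m)) (≤-reflexive (sym (Σ-last m g)))
    flow : N * Σ< k (λ i → T i * e i) ≤ Σ< n (λ v → T v * G v) + N * Σ< k (λ i → T (suc i) * e i)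
    flow = subst₂ (λ a b → a ≤ Σ< n (λ v → T v * G v) + b)
             (sym (scale N k T e)) (sym (scale N k (λ i → T (suc i)) e)) (flowk k bs)

  -- For a decreasing weight the ends exchange their roles, so the extra condition sits at i + 1 =
  -- k.
  mix-dec : ∀ N (e : ℕ → ℕ) → (∀ i → i < k → G i ≡ G (suc i) + e i) →
            (∀ i → suc i < k → N * e i ≤ G (suc i) + N * e (suc i)) → (∀ i → suc i ≡ k → N * e i ≤ G (suc i)) →
            N * Σ< k Q ≤ N * (k * P) + Σ< n (λ v → Π-without n v f * (G v * c v))
  mix-dec N e Ge bs bl = finish N _ _ (λ i i<k → swap-dec (e i) i i<k (Ge i i<k)) flow
    where
    flowk : ∀ m → (∀ i → suc i < m → N * e i ≤ G (suc i) + N * e (suc i)) → (∀ i → suc i ≡ m → N * e i ≤ G (suc i)) →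
            Σ< m (λ i → T (suc i) * (N * e i)) ≤ Σ< (suc m) (λ v → T v * G v) + Σ< m (λ i → T i * (N * e i))
    flowk zero    h l = z≤n
    flowk (suc m) h l = begin
      Σ< (suc m) (λ i → T (suc i) * (N * e i))  ≡⟨ Σ-last m _ ⟩
      Σ< m (λ i → T (suc i) * (N * e i)) + T (suc m) * (N * e m)
        ≤⟨ +-mono-≤ (Σ-mono m (λ i i<m → *-monoʳ-≤ (T (suc i)) (h i (s≤s i<m)))) (*-monoʳ-≤ (T (suc m)) (l m refl)) ⟩
      Σ< m (λ i → T (suc i) * (G (suc i) + N * e (suc i))) + T (suc m) * G (suc m)
        ≡⟨ cong (_+ T (suc m) * G (suc m)) (trans (Σ-cong m (λ i _ → *-distribˡ-+ (T (suc i)) _ _)) (Σ-+ m _ _)) ⟩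
      Σ< m (λ i → T (suc i) * G (suc i)) + Σ< m (λ i → T (suc i) * (N * e (suc i))) + T (suc m) * G (suc m)
        ≡⟨ swp (Σ< m (λ i → T (suc i) * G (suc i))) _ _ ⟩
      (Σ< m (λ i → T (suc i) * G (suc i)) + T (suc m) * G (suc m)) + Σ< m (λ i → T (suc i) * (N * e (suc i)))
        ≡⟨ cong (_+ Σ< m (λ i → T (suc i) * (N * e (suc i)))) (Σ-last m (λ i → T (suc i) * G (suc i))) ⟨
      Σ< (suc m) (λ i → T (suc i) * G (suc i)) + Σ< m (λ i → T (suc i) * (N * e (suc i)))
        ≤⟨ +-mono-≤ (Σ-shift≤ (suc m) (λ v → T v * G v)) (Σ-shift≤ m (λ i → T i * (N * e i))) ⟩
      Σ< (suc (suc m)) (λ v → T v * G v) + Σ< (suc m) (λ i → T i * (N * e i)) ∎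
      where
      open ≤-Reasoning
      swp : ∀ a b d → a + b + d ≡ a + d + b
      swp = solve-∀
    flow : N * Σ< k (λ i → T (suc i) * e i) ≤ Σ< n (λ v → T v * G v) + N * Σ< k (λ i → T i * e i)
    flow = subst₂ (λ a b → a ≤ Σ< n (λ v → T v * G v) + b)
             (sym (scale N k (λ i → T (suc i)) e)) (sym (scale N k T e)) (flowk k bs bl)

pow-suc∸ : ∀ q {i n} → i < n → q ^ (n ∸ i) ≡ q * q ^ (n ∸ suc i)
pow-suc∸ q {i} {n} i<n = cong (q ^_) (+-∸-assoc 1 i<n)

-- The common denominator of all the powers of (q + 1) / q: up to the boundary summand, `G v * R s`
-- is `unit k q` times the tilt.
unit : ℕ → ℕ → ℕ
unit k q = suc q ^ suc k * q ^ suc k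

-- Weights with G v R s ≈ ((q + 1) / q) ^ (± (v - s)): `cross` makes the product over all positions
-- nonincreasing under a joint sorting step, `mix` controls its growth under a mixing step.
record Weights (k q : ℕ) : Set where
  field
    G R  : ℕ → ℕ
    gap  : ℕ → ℕ → ℕ
    mix  : MixBound k (q * suc q) G
    cross : ∀ A b {v v' s s'} → v ≤ v' → s' ≤ s → v' ≤ suc k → s ≤ suc k →
            (A + G v * (b * R s')) * (A + G v' * (b * R s)) ≤ (A + G v * (b * R s)) * (A + G v' * (b * R s'))
    low  : ∀ {v s} D → v ≤ suc k → s ≤ suc k →
           unit k q * suc q ^ D * suc q ^ (gap v s ∸ D) ≤ (unit k q * suc q ^ D + G v * (q ^ D * R s)) * q ^ (gap v s ∸ D)
    up   : ∀ {v} → v ≤ suc k → G v * R v ≤ suc (suc q) * unit k q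

-- Expanded, the two sides differ only in the terms linear in A, where this is the rearrangement
-- inequality x w + y u ≤ x u + y w.
cross-lem : ∀ A b {x y u w} → x ≤ y → u ≤ w →
            (A + x * (b * w)) * (A + y * (b * u)) ≤ (A + x * (b * u)) * (A + y * (b * w))
cross-lem A b {x} {y} {u} {w} x≤y u≤w with m≤n⇒∃[o]m+o≡n x≤y | m≤n⇒∃[o]m+o≡n u≤w
... | g , refl | r , refl = ≤-trans (m≤m+n _ (A * b * g * r)) (≤-reflexive (lem A b x g u r))
  where
  lem : ∀ A b x g u r → (A + x * (b * (u + r))) * (A + (x + g) * (b * u)) + A * b * g * r
                      ≡ (A + x * (b * u)) * (A + (x + g) * (b * (u + r)))
  lem = solve-∀

pow-shift-≤ : ∀ q {s s'} n → s' ≤ s → s ≤ n → q ^ s * suc q ^ (n ∸ s) ≤ q ^ s' * suc q ^ (n ∸ s')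
pow-shift-≤ q {s} {s'} n s'≤s s≤n with m≤n⇒∃[o]m+o≡n s'≤s | m≤n⇒∃[o]m+o≡n s≤n
... | d , refl | r , refl = begin
  q ^ (s' + d) * p ^ (s' + d + r ∸ (s' + d)) ≡⟨ cong₂ (λ a e → a * p ^ e) (^-distribˡ-+-* q s' d) (m+n∸m≡n (s' + d) r) ⟩
  q ^ s' * q ^ d * p ^ r                     ≤⟨ *-monoˡ-≤ (p ^ r) (*-monoʳ-≤ (q ^ s') (^-monoˡ-≤ d (n≤1+n q))) ⟩
  q ^ s' * p ^ d * p ^ r                     ≡⟨ *-assoc (q ^ s') _ _ ⟩
  q ^ s' * (p ^ d * p ^ r)                   ≡⟨ cong (q ^ s' *_) (^-distribˡ-+-* p d r) ⟨
  q ^ s' * p ^ (d + r)                       ≡⟨ cong (λ e → q ^ s' * p ^ e) (trans (cong (_∸ s') (+-assoc s' d r)) (m+n∸m≡n s' (d + r))) ⟨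
  q ^ s' * p ^ (s' + d + r ∸ s')             ∎
  where
  open ≤-Reasoning
  p = suc q

pow-shift'-≤ : ∀ q {s s'} n → s' ≤ s → s ≤ n → suc q ^ s' * q ^ (n ∸ s') ≤ suc q ^ s * q ^ (n ∸ s)
pow-shift'-≤ q {s} {s'} n s'≤s s≤n with m≤n⇒∃[o]m+o≡n s'≤s | m≤n⇒∃[o]m+o≡n s≤n
... | d , refl | r , refl = begin
  p ^ s' * q ^ (s' + d + r ∸ s')             ≡⟨ cong (λ e → p ^ s' * q ^ e) (trans (cong (_∸ s') (+-assoc s' d r)) (m+n∸m≡n s' (d + r))) ⟩
  p ^ s' * q ^ (d + r)                       ≡⟨ cong (p ^ s' *_) (^-distribˡ-+-* q d r) ⟩
  p ^ s' * (q ^ d * q ^ r)                   ≤⟨ *-monoʳ-≤ (p ^ s') (*-monoˡ-≤ (q ^ r) (^-monoˡ-≤ d (n≤1+n q))) ⟩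
  p ^ s' * (p ^ d * q ^ r)                   ≡⟨ *-assoc (p ^ s') _ _ ⟨
  p ^ s' * p ^ d * q ^ r                     ≡⟨ cong₂ (λ a e → a * q ^ e) (^-distribˡ-+-* p s' d) (m+n∸m≡n (s' + d) r) ⟨
  p ^ (s' + d) * q ^ (s' + d + r ∸ (s' + d)) ∎
  where
  open ≤-Reasoning
  p = suc q

-- The exponents add up: here p ^ v q ^ (n-v) q ^ s p ^ (n-s) = p ^ n q ^ n (p / q) ^ (v-s).
low-lem : ∀ p q n v s D → s ≤ v → v ≤ n → ∀ c → p ^ v * q ^ (n ∸ v) ≤ c → 
          p ^ n * q ^ n * p ^ D * p ^ (v ∸ s ∸ D) ≤ (p ^ n * q ^ n * p ^ D + c * (q ^ D * (q ^ s * p ^ (n ∸ s)))) * q ^ (v ∸ s ∸ D)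
low-lem p q n v s D s≤v v≤n c c≥ with m≤n⇒∃[o]m+o≡n s≤v
... | o , refl rewrite m+n∸m≡n s o with ≤-total o D
...   | inj₁ le rewrite m≤n⇒m∸n≡0 le = *-monoˡ-≤ 1 (m≤m+n (p ^ n * q ^ n * p ^ D) (c * (q ^ D * (q ^ s * p ^ (n ∸ s)))))
...   | inj₂ ge with m≤n⇒∃[o]m+o≡n ge | m≤n⇒∃[o]m+o≡n v≤n
...     | d , refl | r , refl
  rewrite m+n∸m≡n (s + (D + d)) r | m+n∸m≡n D d | trans (cong (_∸ s) (+-assoc s (D + d) r)) (m+n∸m≡n s (D + d + r)) = begin
  p ^ (v + r) * q ^ (v + r) * p ^ D * p ^ d ≡⟨ cong₂ (λ a b → a * b * p ^ D * p ^ d) (^-distribˡ-+-* p v r) (trans (^-distribˡ-+-* q v r) (cong (_* q ^ r) (trans (^-distribˡ-+-* q s (D + d)) (cong (q ^ s *_) (^-distribˡ-+-* q D d))))) ⟩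
  p ^ v * p ^ r * (q ^ s * (q ^ D * q ^ d) * q ^ r) * p ^ D * p ^ d ≡⟨ lem (p ^ v) (p ^ r) (q ^ s) (q ^ D) (q ^ d) (q ^ r) (p ^ D) (p ^ d) ⟩
  p ^ v * q ^ r * (q ^ D * (q ^ s * (p ^ D * p ^ d * p ^ r))) * q ^ d ≤⟨ *-monoˡ-≤ (q ^ d) (*-monoˡ-≤ _ c≥) ⟩
  c * (q ^ D * (q ^ s * (p ^ D * p ^ d * p ^ r))) * q ^ d ≡⟨ cong (λ a → c * (q ^ D * (q ^ s * a)) * q ^ d) (trans (^-distribˡ-+-* p (D + d) r) (cong (_* p ^ r) (^-distribˡ-+-* p D d))) ⟨
  c * (q ^ D * (q ^ s * p ^ (D + d + r))) * q ^ d ≤⟨ *-monoˡ-≤ (q ^ d) (m≤n+m (c * (q ^ D * (q ^ s * p ^ (D + d + r)))) (p ^ (s + (D + d) + r) * q ^ (s + (D + d) + r) * p ^ D)) ⟩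
  (p ^ (v + r) * q ^ (v + r) * p ^ D + c * (q ^ D * (q ^ s * p ^ (D + d + r)))) * q ^ d ∎
  where
  open ≤-Reasoning
  lem : ∀ pv pr qs qD qd qr pD pd → pv * pr * (qs * (qD * qd) * qr) * pD * pd ≡ pv * qr * (qD * (qs * (pD * pd * pr))) * qd
  lem = solve-∀

-- Weights for π above σ.  The summand (q + 1) q ^ n makes the discrete Laplacian
-- inequality hold at the reflecting end 0 as well.
above : ∀ k q → Weights k q
above k q = record
  { G = G ; R = R ; gap = _∸_
  ; mix = λ α c → mix-inc k G α c (q * p) e Ge b0 bs
  ; cross = λ A b v≤v' s'≤s v'≤n s≤n → cross-lem A b (+-monoˡ-≤ (p * q ^ n) (pow-shift'-≤ q n v≤v' v'≤n)) (pow-shift-≤ q n s'≤s s≤n)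
  ; low = low
  ; up = up }
  where
  n p : ℕ
  n = suc k
  p = suc q
  G R e : ℕ → ℕ
  G v = p ^ v * q ^ (n ∸ v) + p * q ^ n
  R s = q ^ s * p ^ (n ∸ s)
  e i = p ^ i * q ^ (n ∸ suc i)
  Ge : ∀ i → i < k → G (suc i) ≡ G i + e i
  Ge i i<k rewrite pow-suc∸ q (m<n⇒m<1+n i<k) = lem (p ^ i) q (q ^ (n ∸ suc i)) (q ^ n)
    where
    lem : ∀ a q b c → suc q * a * b + suc q * c ≡ a * (q * b) + suc q * c + a * b
    lem = solve-∀
  b0 : q * p * e 0 ≤ G 0
  b0 = ≤-trans (≤-reflexive (lem q (q ^ k))) (m≤n+m (p * q ^ n) (1 * q ^ n))
    where
    lem : ∀ q a → q * suc q * (1 * a) ≡ suc q * (q * a)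
    lem = solve-∀
  bs : ∀ i → suc i < k → q * p * e (suc i) ≤ G (suc i) + q * p * e i
  bs i i<k rewrite pow-suc∸ q {suc i} {n} (m<n⇒m<1+n i<k) =
    ≤-trans (m≤m+n _ (p * q ^ n)) (≤-reflexive (lem q (p ^ i) (q ^ (n ∸ suc (suc i))) (q ^ n)))
    where
    lem : ∀ q a b c → q * suc q * (suc q * a * b) + suc q * c ≡ suc q * a * (q * b) + suc q * c + q * suc q * (a * (q * b))
    lem = solve-∀
  low : ∀ {v s} D → v ≤ n → s ≤ n → unit k q * p ^ D * p ^ (v ∸ s ∸ D) ≤ (unit k q * p ^ D + G v * (q ^ D * R s)) * q ^ (v ∸ s ∸ D)
  low {v} {s} D v≤n s≤n with ≤-total s v
  ... | inj₁ s≤v = low-lem p q n v s D s≤v v≤n (G v) (m≤m+n _ _)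
  ... | inj₂ v≤s rewrite m≤n⇒m∸n≡0 v≤s | 0∸n≡0 D = *-monoˡ-≤ 1 (m≤m+n (unit k q * p ^ D) (G v * (q ^ D * R s)))
  -- On the diagonal v = s the geometric part is exactly one `unit`, and the boundary summand adds
  -- at most q + 1 more.
  up : ∀ {v} → v ≤ n → G v * R v ≤ suc p * unit k q
  up {v} v≤n with m≤n⇒∃[o]m+o≡n v≤n
  ... | r , n≡ = begin
    (p ^ v * q ^ (n ∸ v) + p * q ^ n) * R v             ≡⟨ *-distribʳ-+ (R v) (p ^ v * q ^ (n ∸ v)) (p * q ^ n) ⟩
    p ^ v * q ^ (n ∸ v) * R v + p * q ^ n * R v         ≤⟨ +-mono-≤ (≤-reflexive full) (*-monoʳ-≤ (p * q ^ n) (pow-shift-≤ q n z≤n v≤n)) ⟩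
    unit k q + p * q ^ n * (1 * p ^ n)                  ≡⟨ lem p (p ^ n) (q ^ n) ⟩
    suc p * unit k q                                    ∎
    where
    open ≤-Reasoning
    lem : ∀ p a b → a * b + p * b * (1 * a) ≡ (1 + p) * (a * b)
    lem = solve-∀
    full : p ^ v * q ^ (n ∸ v) * R v ≡ unit k q
    full = trans (lem₂ (p ^ v) (q ^ (n ∸ v)) (q ^ v) (p ^ (n ∸ v)))
             (cong₂ _*_ (trans (sym (^-distribˡ-+-* p v (n ∸ v))) (cong (p ^_) (m+[n∸m]≡n v≤n)))
                        (trans (sym (^-distribˡ-+-* q v (n ∸ v))) (cong (q ^_) (m+[n∸m]≡n v≤n))))
      where
      lem₂ : ∀ a b c d → a * b * (c * d) ≡ (a * d) * (c * b)
      lem₂ = solve-∀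

-- Mirror image of `above`. The same summand (q + 1) q ^ n now serves the reflecting end at the top
-- value k, where `bl` is an equality.
below : ∀ k q → Weights k q
below k q = record
  { G = G ; R = R ; gap = λ v s → s ∸ v
  ; mix = λ α c → mix-dec k G α c (q * p) e Ge bs bl
  ; cross = λ A b {v} {v'} {s} {s'} v≤v' s'≤s v'≤n s≤n →
      subst₂ _≤_ (*-comm (A + G v' * (b * R s)) _) (*-comm (A + G v' * (b * R s')) _)
        (cross-lem A b (+-monoˡ-≤ (p * q ^ n) (pow-shift-≤ q n v≤v' v'≤n)) (pow-shift'-≤ q n s'≤s s≤n))
  ; low = low
  ; up = up }
  where
  n p : ℕ
  n = suc k
  p = suc q
  G R e : ℕ → ℕ
  G v = q ^ v * p ^ (n ∸ v) + p * q ^ n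
  R s = p ^ s * q ^ (n ∸ s)
  e i = q ^ i * p ^ (n ∸ suc i)
  Ge : ∀ i → i < k → G i ≡ G (suc i) + e i
  Ge i i<k rewrite pow-suc∸ p (m<n⇒m<1+n i<k) = lem (q ^ i) q (p ^ (n ∸ suc i)) (q ^ n)
    where
    lem : ∀ a q b c → a * (suc q * b) + suc q * c ≡ q * a * b + suc q * c + a * b
    lem = solve-∀
  bl : ∀ i → suc i ≡ k → q * p * e i ≤ G (suc i)
  bl i refl rewrite m+n∸n≡m 1 i = ≤-reflexive (lem q (q ^ i))
    where
    lem : ∀ q a → q * suc q * (a * (suc q * 1)) ≡ q * a * (suc q * 1) + suc q * (q * (q * a))
    lem = solve-∀
  bs : ∀ i → suc i < k → q * p * e i ≤ G (suc i) + q * p * e (suc i)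
  bs i i<k rewrite pow-suc∸ p {suc i} {n} (m<n⇒m<1+n i<k) =
    ≤-trans (m≤m+n _ (p * q ^ n)) (≤-reflexive (lem q (q ^ i) (p ^ (n ∸ suc (suc i))) (q ^ n)))
    where
    lem : ∀ q a b c → q * suc q * (a * (suc q * b)) + suc q * c ≡ q * a * (suc q * b) + suc q * c + q * suc q * (q * a * b)
    lem = solve-∀
  low : ∀ {v s} D → v ≤ n → s ≤ n → unit k q * p ^ D * p ^ (s ∸ v ∸ D) ≤ (unit k q * p ^ D + G v * (q ^ D * R s)) * q ^ (s ∸ v ∸ D)
  low {v} {s} D v≤n s≤n with ≤-total s v
  ... | inj₁ s≤v rewrite m≤n⇒m∸n≡0 s≤v | 0∸n≡0 D = *-monoˡ-≤ 1 (m≤m+n (unit k q * p ^ D) (G v * (q ^ D * R s)))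
  ... | inj₂ v≤s = ≤-trans (low-lem p q n s v D v≤s s≤n (R s) ≤-refl)
                     (*-monoˡ-≤ (q ^ (s ∸ v ∸ D)) (+-monoʳ-≤ (unit k q * p ^ D)
                       (≤-trans (≤-reflexive (lem (R s) (q ^ D) _)) (*-monoˡ-≤ (q ^ D * R s) (m≤m+n (q ^ v * p ^ (n ∸ v)) (p * q ^ n))))))
    where
    lem : ∀ r d g → r * (d * g) ≡ g * (d * r)
    lem = solve-∀
  up : ∀ {v} → v ≤ n → G v * R v ≤ suc p * unit k q
  up {v} v≤n = begin
    (q ^ v * p ^ (n ∸ v) + p * q ^ n) * R v             ≡⟨ *-distribʳ-+ (R v) (q ^ v * p ^ (n ∸ v)) (p * q ^ n) ⟩
    q ^ v * p ^ (n ∸ v) * R v + p * q ^ n * R v         ≤⟨ +-mono-≤ (≤-reflexive full) (*-monoʳ-≤ (p * q ^ n) (≤-trans (pow-shift'-≤ q n v≤n ≤-refl) (≤-reflexive (trans (cong (λ d → p ^ n * q ^ d) (n∸n≡0 n)) (*-identityʳ _))))) ⟩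
    unit k q + p * q ^ n * p ^ n                        ≡⟨ lem p (p ^ n) (q ^ n) ⟩
    suc p * unit k q                                    ∎
    where
    open ≤-Reasoning
    lem : ∀ p a b → a * b + p * b * a ≡ (1 + p) * (a * b)
    lem = solve-∀
    full : q ^ v * p ^ (n ∸ v) * R v ≡ unit k q
    full = trans (lem₂ (q ^ v) (p ^ (n ∸ v)) (p ^ v) (q ^ (n ∸ v)))
             (cong₂ _*_ (trans (sym (^-distribˡ-+-* p v (n ∸ v))) (cong (p ^_) (m+[n∸m]≡n v≤n)))
                        (trans (sym (^-distribˡ-+-* q v (n ∸ v))) (cong (q ^_) (m+[n∸m]≡n v≤n))))
      where
      lem₂ : ∀ a b c d → a * b * (c * d) ≡ (c * b) * (a * d)
      lem₂ = solve-∀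

-- Elementary inequalities for powers

^-distribʳ-* : ∀ m a b → (a * b) ^ m ≡ a ^ m * b ^ m
^-distribʳ-* m a b =
  trans (sym (Π-const m (a * b))) (trans (Π-* m _ _) (cong₂ _*_ (Π-const m a) (Π-const m b)))

bernoulli : ∀ x m → x ^ suc m + suc m * x ^ m ≤ suc x ^ suc m
bernoulli x zero    = ≤-reflexive (lem x)
  where
  lem : ∀ x → x * 1 + (1 + 0) * 1 ≡ (1 + x) * 1
  lem = solve-∀
bernoulli x (suc m) = begin
  x * (x * a) + (2 + m) * (x * a)            ≤⟨ m≤m+n _ ((1 + m) * a) ⟩
  x * (x * a) + (2 + m) * (x * a) + (1 + m) * a ≡⟨ lem x m a ⟩
  suc x * (x * a + suc m * a)                ≤⟨ *-monoʳ-≤ (suc x) (bernoulli x m) ⟩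
  suc x * (suc x ^ suc m)                    ∎
  where
  open ≤-Reasoning
  a = x ^ m
  lem : ∀ x m a → x * (x * a) + (2 + m) * (x * a) + (1 + m) * a ≡ (1 + x) * (x * a + (1 + m) * a)
  lem = solve-∀

-- Bernoulli's inequality gives (1 + 1/q) ^ q ≥ 2, so every q powers gain a factor 2; the r leftover
-- powers lose nothing.
double-pow : ∀ q m r → 1 ≤ q → 2 ^ m * q ^ (q * m + r) ≤ suc q ^ (q * m + r)
double-pow q@(suc j) m r _ = begin
  2 ^ m * q ^ (q * m + r)        ≡⟨ cong (2 ^ m *_) (^-distribˡ-+-* q (q * m) r) ⟩
  2 ^ m * (q ^ (q * m) * q ^ r)  ≡⟨ *-assoc (2 ^ m) _ _ ⟨
  2 ^ m * q ^ (q * m) * q ^ r    ≡⟨ cong (λ t → 2 ^ m * t * q ^ r) (sym (^-*-assoc q q m)) ⟩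
  2 ^ m * (q ^ q) ^ m * q ^ r    ≡⟨ cong (_* q ^ r) (^-distribʳ-* m 2 (q ^ q)) ⟨
  (2 * q ^ q) ^ m * q ^ r        ≤⟨ *-mono-≤ (^-monoˡ-≤ m base) (^-monoˡ-≤ r (n≤1+n q)) ⟩
  (suc q ^ q) ^ m * suc q ^ r    ≡⟨ cong (_* suc q ^ r) (^-*-assoc (suc q) q m) ⟩
  suc q ^ (q * m) * suc q ^ r    ≡⟨ ^-distribˡ-+-* (suc q) (q * m) r ⟨
  suc q ^ (q * m + r)            ∎
  where
  open ≤-Reasoning
  base : 2 * q ^ q ≤ suc q ^ q
  base = subst (_≤ suc q ^ q) (cong (q ^ q +_) (sym (+-identityʳ (q ^ q)))) (bernoulli q j)

-- By Bernoulli's inequality (1 - 1/(z + 1)) ^ w ≥ 1 - w/(z + 1) ≥ 1/2.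
half : ∀ z w → 2 * w ≤ suc z → suc z ^ w ≤ 2 * z ^ w
half z w h = *-cancelʳ-≤ _ _ Z (+-cancelʳ-≤ (Z ^ w * Z) _ _ (begin
  Z ^ w * Z + Z ^ w * Z           ≤⟨ +-mono-≤ (go w) (go w) ⟩
  (z ^ w * Z + w * Z ^ w) + (z ^ w * Z + w * Z ^ w) ≡⟨ lem (z ^ w) Z w (Z ^ w) ⟩
  2 * z ^ w * Z + Z ^ w * (2 * w) ≤⟨ +-monoʳ-≤ (2 * z ^ w * Z) (*-monoʳ-≤ (Z ^ w) h) ⟩
  2 * z ^ w * Z + Z ^ w * Z       ∎))
  where
  open ≤-Reasoning
  Z = suc z
  lem : ∀ a Z w b → (a * Z + w * b) + (a * Z + w * b) ≡ 2 * a * Z + b * (2 * w)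
  lem = solve-∀
  go : ∀ w → Z ^ w * Z ≤ z ^ w * Z + w * Z ^ w
  go zero    = m≤m+n _ _
  go (suc w) = begin
    Z * Z ^ w * Z                            ≡⟨ *-assoc Z (Z ^ w) Z ⟩
    Z * (Z ^ w * Z)                          ≤⟨ *-monoʳ-≤ Z (go w) ⟩
    Z * (z ^ w * Z + w * Z ^ w)              ≡⟨ lem₂ z (z ^ w) w (Z ^ w) ⟩
    z * z ^ w * Z + (z ^ w * Z + w * (Z * Z ^ w)) ≤⟨ +-monoʳ-≤ (z * z ^ w * Z) (+-monoˡ-≤ _ (*-monoˡ-≤ Z (^-monoˡ-≤ w (n≤1+n z)))) ⟩
    z * z ^ w * Z + (Z ^ w * Z + w * (Z * Z ^ w)) ≡⟨ cong (λ t → z * z ^ w * Z + (t + w * (Z * Z ^ w))) (*-comm (Z ^ w) Z) ⟩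
    z * z ^ w * Z + suc w * (Z * Z ^ w)      ∎
    where
    lem₂ : ∀ z a w b → (1 + z) * (a * (1 + z) + w * b) ≡ z * a * (1 + z) + (a * (1 + z) + w * ((1 + z) * b))
    lem₂ = solve-∀

half-pow : ∀ z w m a → 1 ≤ z → 2 * w ≤ suc z → a ≤ w * m → suc z ^ a ≤ 2 ^ m * z ^ a
half-pow z@(suc _) w m a _ h a≤ with m≤n⇒∃[o]m+o≡n a≤
... | r , eq = *-cancelʳ-≤ _ _ (z ^ r) {{m^n≢0 z r}} (begin
  suc z ^ a * z ^ r        ≤⟨ *-monoʳ-≤ (suc z ^ a) (^-monoˡ-≤ r (n≤1+n z)) ⟩
  suc z ^ a * suc z ^ r    ≡⟨ trans (sym (^-distribˡ-+-* (suc z) a r)) (trans (cong (suc z ^_) eq) (sym (^-*-assoc (suc z) w m))) ⟩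
  (suc z ^ w) ^ m          ≤⟨ ^-monoˡ-≤ m (half z w h) ⟩
  (2 * z ^ w) ^ m          ≡⟨ ^-distribʳ-* m 2 (z ^ w) ⟩
  2 ^ m * (z ^ w) ^ m      ≡⟨ cong (2 ^ m *_) (trans (^-*-assoc z w m) (trans (cong (z ^_) (sym eq)) (^-distribˡ-+-* z a r))) ⟩
  2 ^ m * (z ^ a * z ^ r)  ≡⟨ *-assoc (2 ^ m) _ _ ⟨
  2 ^ m * z ^ a * z ^ r    ∎)
  where open ≤-Reasoning

-- The indicator of a ≤ b as a number; its `Ex` counts the outcomes in an event.
le : ℕ → ℕ → ℕ
le zero    b       = 1
le (suc a) zero    = 0
le (suc a) (suc b) = le a b

le-true : ∀ {a b} → a ≤ b → le a b ≡ 1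
le-true z≤n       = refl
le-true (s≤s a≤b) = le-true a≤b

le-false : ∀ {a b} → b < a → le a b ≡ 0
le-false {suc a} {zero}  _         = refl
le-false {suc a} {suc b} (s≤s b<a) = le-false b<a

le≤1 : ∀ a b → le a b ≤ 1
le≤1 zero    b       = ≤-refl
le≤1 (suc a) zero    = z≤n
le≤1 (suc a) (suc b) = le≤1 a b

le-markov : ∀ {a b c d} → (a ≤ b → c ≤ d) → c * le a b ≤ d
le-markov {a} {b} {c} h with a ≤? b
... | yes a≤b rewrite le-true a≤b | *-identityʳ c = h a≤b
... | no  a≰b rewrite le-false (≰⇒> a≰b) | *-zeroʳ c = z≤n

le-mono : ∀ {a b c d} → (a ≤ b → c ≤ d) → le a b ≤ le c d
le-mono {a} {b} {c} {d} h = subst (_≤ le c d) (*-identityˡ _) (le-markov {a} {b} {1} (λ a≤b → ≤-reflexive (sym (le-true (h a≤b)))))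

-- The product supermartingale for mixing

Inv : ∀ {k} → Permutation′ (suc k) × Seq × Seq → Set
Inv {k} (π , σ , τ) = ∀ x → σ x ≤ suc k

Inv-act : ∀ {k} c (i : Fin k) s → Inv s → Inv (act c i s)
Inv-act srtK i (π , σ , τ) h = srt-≤ (toℕ i) σ h
Inv-act mixK i (π , σ , τ) h = h

module Noise {k q : ℕ} (W : Weights k q) (1≤k : 1 ≤ k) (1≤q : 1 ≤ q) where
  open Weights W
  n N z : ℕ
  n = suc k
  N = q * suc q
  z = N * k

  1≤N : 1 ≤ N
  1≤N = *-mono-≤ 1≤q (s≤s (z≤n {q}))

  1≤z : 1 ≤ z
  1≤z = *-mono-≤ 1≤N 1≤k

  -- By `Π-expand` the correction in `MixBound` enters the factors. After division by the power of
  -- z, each coefficient `c v` grows by 1 + 1/z per mixing step, with z = q (q + 1) k.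
  mix-step : ∀ α (c : ℕ → ℕ) →
    z ^ n * Σ< k (λ i → Π< n (λ v → α + G (sw i v) * c v)) ≤ k * Π< n (λ v → z * α + G v * (suc z * c v))
  mix-step α c = *-cancelˡ-≤ N {{>-nonZero 1≤N}} (begin
    N * (z ^ n * S)                        ≡⟨ l₁ N (z ^ n) S ⟩
    z ^ n * (N * S)                        ≤⟨ *-monoʳ-≤ (z ^ n) (mix α c) ⟩
    z ^ n * (N * (k * P) + Σ< n (λ v → Π-without n v f * X v)) ≡⟨ *-distribˡ-+ (z ^ n) _ _ ⟩
    z ^ n * (N * (k * P)) + z ^ n * Σ< n (λ v → Π-without n v f * X v) ≡⟨ cong₂ _+_ (l₂ (z ^ n) N k P) (trans (sym (Σ-* n (z ^ n) (λ v → Π-without n v f * X v))) (trans (Σ-cong n pull) (Σ-* n z (λ v → Π-without n v zf * X v)))) ⟩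
    z * (z ^ n * P) + z * Σ< n (λ v → Π-without n v zf * X v) ≡⟨ *-distribˡ-+ z _ _ ⟨
    z * (z ^ n * P + Σ< n (λ v → Π-without n v zf * X v)) ≡⟨ cong (λ t → z * (t + Σ< n (λ v → Π-without n v zf * X v))) (trans (Π-* n (λ _ → z) f) (cong (_* P) (Π-const n z))) ⟨
    z * (Π< n zf + Σ< n (λ v → Π-without n v zf * X v)) ≤⟨ *-monoʳ-≤ z (Π-expand n zf X) ⟩
    z * Π< n (λ v → zf v + X v)            ≡⟨ cong (z *_) (Π-cong n (λ v _ → l₃ z α (G v) (c v))) ⟩
    z * Π< n (λ v → z * α + G v * (suc z * c v)) ≡⟨ *-assoc N k _ ⟩
    N * (k * Π< n (λ v → z * α + G v * (suc z * c v))) ∎)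
    where
    open ≤-Reasoning
    S = Σ< k (λ i → Π< n (λ v → α + G (sw i v) * c v))
    X f zf : ℕ → ℕ
    X v = G v * c v
    f v = α + X v
    zf v = z * f v
    P = Π< n f
    l₁ : ∀ a b c → a * (b * c) ≡ b * (a * c)
    l₁ = solve-∀
    l₂ : ∀ a b c d → a * (b * (c * d)) ≡ b * c * (a * d)
    l₂ = solve-∀
    l₃ : ∀ z α g c → z * (α + g * c) + g * c ≡ z * α + g * ((1 + z) * c)
    l₃ = solve-∀
    pull : ∀ v → v < n → z ^ n * (Π-without n v f * X v) ≡ z * (Π-without n v zf * X v)
    pull v v<n = trans (sym (*-assoc (z ^ n) _ (X v))) (trans (cong (_* X v) eq) (*-assoc z _ (X v)))
      where
      eq : z ^ n * Π-without n v f ≡ z * Π-without n v zf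
      eq = trans (sym (trans (Π-* n (λ _ → z) (upd v 1 f)) (cong (_* Π-without n v f) (Π-const n z))))
             (trans (Π-split n v zf (λ x → z * upd v 1 f x) v<n (λ x p → cong (z *_) (upd-off v 1 f x p)))
                    (cong (_* Π-without n v zf) (trans (cong (z *_) (upd-at v 1 f)) (*-identityʳ z))))

  Φ : ℕ → ℕ → Seq → Seq → ℕ
  Φ A b p s = Π< n (λ x → A + G (p x) * (b * R (s x)))

  sort-step : ∀ A b i p s → i < k → (∀ x → p x ≤ n) → (∀ x → s x ≤ n) → Φ A b (srt i p) (srt i s) ≤ Φ A b p s
  sort-step A b i p s i<k pn sn with Π-pair n i (λ x → A + G (p x) * (b * R (s x))) (s≤s i<k)
  ... | r , eq = begin
    Φ A b (srt i p) (srt i s)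
      ≡⟨ eq _ (λ x e e' → cong₂ m (srt-off i p x e e') (srt-off i s x e e')) ⟩
    r * (m (srt i p i) (srt i s i) * m (srt i p (suc i)) (srt i s (suc i)))
      ≡⟨ cong (r *_) (cong₂ _*_ (cong₂ m (srt-lo i p) (srt-lo i s)) (cong₂ m (srt-hi i p) (srt-hi i s))) ⟩
    r * (m (p i ⊓ p (suc i)) (s i ⊓ s (suc i)) * m (p i ⊔ p (suc i)) (s i ⊔ s (suc i)))
      ≤⟨ *-monoʳ-≤ r (rearrange (pn i) (pn (suc i)) (sn i) (sn (suc i))) ⟩
    r * (m (p i) (s i) * m (p (suc i)) (s (suc i)))  ≡⟨ eq _ (λ _ _ _ → refl) ⟨
    Φ A b p s ∎
    where
    open ≤-Reasoning
    m : ℕ → ℕ → ℕ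
    m v t = A + G v * (b * R t)
    rearrange : ∀ {v v' t t'} → v ≤ n → v' ≤ n → t ≤ n → t' ≤ n → m (v ⊓ v') (t ⊓ t') * m (v ⊔ v') (t ⊔ t') ≤ m v t * m v' t'
    rearrange {v} {v'} {t} {t'} v≤ v'≤ t≤ t'≤ with ≤-total v v' | ≤-total t t'
    ... | inj₁ vv | inj₁ tt rewrite m≤n⇒m⊓n≡m vv | m≤n⇒m⊔n≡n vv | m≤n⇒m⊓n≡m tt | m≤n⇒m⊔n≡n tt = ≤-refl
    ... | inj₁ vv | inj₂ tt rewrite m≤n⇒m⊓n≡m vv | m≤n⇒m⊔n≡n vv | m≥n⇒m⊓n≡n tt | m≥n⇒m⊔n≡m tt = cross A b vv tt v'≤ t≤
    ... | inj₂ vv | inj₁ tt rewrite m≥n⇒m⊓n≡n vv | m≥n⇒m⊔n≡m vv | m≤n⇒m⊓n≡m tt | m≤n⇒m⊔n≡n tt = ≤-trans (cross A b vv tt v≤ t'≤) (≤-reflexive (*-comm (m v' t') (m v t)))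
    ... | inj₂ vv | inj₂ tt rewrite m≥n⇒m⊓n≡n vv | m≥n⇒m⊔n≡m vv | m≥n⇒m⊓n≡n tt | m≥n⇒m⊔n≡m tt = ≤-reflexive (*-comm (m v' t') (m v t))

  St : Set
  St = Permutation′ (suc k) × Seq × Seq

  -- The ratio of the two coefficients is β / α at the end and larger by a factor 1 + 1/z for each
  -- mixing step still to come.
  V : ℕ → ℕ → List Kind → St → ℕ
  V α β cs (π , σ , τ) = Φ (z ^ nmix cs * α) (suc z ^ nmix cs * β) (val π) σ

  weight : Kind → ℕ
  weight srtK = 1
  weight mixK = z ^ n

  V-step : ∀ α β c cs s → Inv s → weight c * ΣF (λ i → V α β cs (act c i s)) ≤ k * V α β (c ∷ cs) s
  V-step α β srtK cs (π , σ , τ) h = begin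
    1 * ΣF (λ i → Φ A b (val (sortStep i π)) (srt (toℕ i) σ))   ≡⟨ *-identityˡ _ ⟩
    ΣF (λ i → Φ A b (val (sortStep i π)) (srt (toℕ i) σ))       ≤⟨ ΣF-mono _ _ one ⟩
    ΣF {k} (λ _ → Φ A b (val π) σ)                              ≡⟨ ΣF-const {k} _ ⟩
    k * Φ A b (val π) σ                                         ∎
    where
    open ≤-Reasoning
    A b : ℕ
    A = z ^ nmix cs * α
    b = suc z ^ nmix cs * β
    one : ∀ i → Φ A b (val (sortStep i π)) (srt (toℕ i) σ) ≤ Φ A b (val π) σ
    one i = ≤-trans (≤-reflexive (Π-cong n (λ x x<n → cong (λ y → A + G y * (b * R (srt (toℕ i) σ x))) (val-sort i π x x<n))))
                    (sort-step A b (toℕ i) (val π) σ (toℕ<n i) (val≤n π) h)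
  V-step α β mixK cs (π , σ , τ) h = begin
    z ^ n * ΣF (λ i → Φ A b (val (mixStep i π)) σ)              ≤⟨ *-monoʳ-≤ (z ^ n) (ΣF-≤ _ (λ i → Π< n (λ v → A + G (sw i v) * c v)) one) ⟩
    z ^ n * Σ< k (λ i → Π< n (λ v → A + G (sw i v) * c v))      ≤⟨ mix-step A c ⟩
    k * Π< n (λ v → z * A + G v * (suc z * c v))                ≡⟨ cong (k *_) (Π-reindex π (λ x v → z * A + G v * (suc z * (b * R (σ x))))) ⟨
    k * Π< n (λ x → z * A + G (val π x) * (suc z * (b * R (σ x))))
      ≡⟨ cong (k *_) (Π-cong n (λ x _ → cong₂ (λ u w → u + G (val π x) * w) (sym (*-assoc z (z ^ nmix cs) α))
           (trans (sym (*-assoc (suc z) b _)) (cong (_* R (σ x)) (sym (*-assoc (suc z) (suc z ^ nmix cs) β)))))) ⟩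
    k * V α β (mixK ∷ cs) (π , σ , τ)                           ∎
    where
    open ≤-Reasoning
    A b : ℕ
    A = z ^ nmix cs * α
    b = suc z ^ nmix cs * β
    c : ℕ → ℕ
    c v = b * R (σ (inv π v))
    one : ∀ i → Φ A b (val (mixStep i π)) σ ≤ Π< n (λ v → A + G (sw (toℕ i) v) * c v)
    one i = ≤-reflexive (trans (Π-cong n (λ x x<n → cong (λ y → A + G y * (b * R (σ x))) (val-mix i π x x<n)))
                               (Π-reindex π (λ x v → A + G (sw (toℕ i) v) * (b * R (σ x)))))

  norm-weight : ∀ cs → norm (act {k}) weight cs ≡ z ^ (n * nmix cs)
  norm-weight []         = cong (z ^_) (sym (*-zeroʳ n))
  norm-weight (srtK ∷ cs) = trans (+-identityʳ _) (norm-weight cs)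
  norm-weight (mixK ∷ cs) = trans (cong (z ^ n *_) (norm-weight cs))
    (trans (sym (^-distribˡ-+-* z n _)) (cong (z ^_) (sym (*-suc n (nmix cs)))))

  excess : ℕ → St → ℕ
  excess D (π , σ , τ) = Σ< n (λ x → gap (val π x) (σ x) ∸ D)

  -- By `low` each factor is at least α ((q + 1) / q) ^ (gap ∸ D), and q units of excess are worth a
  -- factor 2.
  V-end : ∀ D L s → Inv s → q * L ≤ excess D s → (unit k q * suc q ^ D) ^ n * 2 ^ L ≤ V (unit k q * suc q ^ D) (q ^ D) [] s
  V-end D L s@(π , σ , τ) h qL≤ with m≤n⇒∃[o]m+o≡n qL≤
  ... | r , eq = *-cancelʳ-≤ _ _ (q ^ E) {{m^n≢0 q E {{>-nonZero 1≤q}}}} (begin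
    α ^ n * 2 ^ L * q ^ E             ≡⟨ *-assoc (α ^ n) _ _ ⟩
    α ^ n * (2 ^ L * q ^ E)           ≤⟨ *-monoʳ-≤ (α ^ n) (subst (λ e → 2 ^ L * q ^ e ≤ suc q ^ e) eq (double-pow q L r 1≤q)) ⟩
    α ^ n * suc q ^ E                 ≡⟨ cong₂ _*_ (Π-const n α) (Π-^ n (suc q) g) ⟨
    Π< n (λ _ → α) * Π< n (λ x → suc q ^ g x) ≡⟨ Π-* n (λ _ → α) (λ x → suc q ^ g x) ⟨
    Π< n (λ x → α * suc q ^ g x)      ≤⟨ Π-mono n (λ x _ → low D (val≤n π x) (h x)) ⟩
    Π< n (λ x → (α + G (val π x) * (q ^ D * R (σ x))) * q ^ g x) ≡⟨ Π-* n (λ x → α + G (val π x) * (q ^ D * R (σ x))) (λ x → q ^ g x) ⟩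
    Φ α (q ^ D) (val π) σ * Π< n (λ x → q ^ g x) ≡⟨ cong₂ _*_ (cong₂ (λ a b → Φ a b (val π) σ) (sym (+-identityʳ α)) (sym (+-identityʳ (q ^ D)))) (Π-^ n q g) ⟩
    V α (q ^ D) [] s * q ^ E          ∎)
    where
    open ≤-Reasoning
    α E : ℕ
    α = unit k q * suc q ^ D
    g : ℕ → ℕ
    g x = gap (val π x) (σ x) ∸ D
    E = excess D s

  -- At the start σ = π, so `up` applies to every factor. The cut-off 8 q u gains 2 ^ (8u), the
  -- mixing steps cost at most 2 ^ (2u), and 2 ^ (6u) is left against the 2 + q of `up`.
  V-start : ∀ u w π τ cs → 2 * w ≤ suc z → nmix cs ≤ w * (2 * u) → let α = unit k q * suc q ^ (8 * (q * u)) in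
    (2 ^ (6 * u)) ^ n * V α (q ^ (8 * (q * u))) cs (π , val π , τ) ≤ (z ^ nmix cs * α) ^ n * (2 ^ (6 * u) + (2 + q)) ^ n
  V-start u w π τ cs 2w≤ a≤ = begin
    C ^ n * V α β cs (π , val π , τ)        ≡⟨ cong (_* V α β cs (π , val π , τ)) (Π-const n C) ⟨
    Π< n (λ _ → C) * V α β cs (π , val π , τ) ≡⟨ Π-* n (λ _ → C) (λ x → A + G (val π x) * (b * R (val π x))) ⟨
    Π< n (λ x → C * (A + G (val π x) * (b * R (val π x)))) ≤⟨ Π-mono n (λ x _ → term (val π x) (val≤n π x)) ⟩
    Π< n (λ _ → A * (C + (2 + q)))          ≡⟨ Π-const n (A * (C + (2 + q))) ⟩
    (A * (C + (2 + q))) ^ n                 ≡⟨ ^-distribʳ-* n A (C + (2 + q)) ⟩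
    A ^ n * (C + (2 + q)) ^ n               ∎
    where
    open ≤-Reasoning
    D C β α A b : ℕ
    D = 8 * (q * u)
    C = 2 ^ (6 * u)
    β = q ^ D
    α = unit k q * suc q ^ D
    A = z ^ nmix cs * α
    b = suc z ^ nmix cs * β
    ratio : 2 ^ (8 * u) * q ^ D ≤ suc q ^ D
    ratio = subst (λ e → 2 ^ (8 * u) * q ^ e ≤ suc q ^ e) (trans (+-identityʳ _) (lem q u)) (double-pow q (8 * u) 0 1≤q)
      where
      lem : ∀ q u → q * (8 * u) ≡ 8 * (q * u)
      lem = solve-∀
    bU : C * b ≤ z ^ nmix cs * suc q ^ D
    bU = begin
      C * (suc z ^ nmix cs * β)               ≤⟨ *-monoʳ-≤ C (*-monoˡ-≤ β (half-pow z w (2 * u) (nmix cs) 1≤z 2w≤ a≤)) ⟩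
      C * (2 ^ (2 * u) * z ^ nmix cs * β)     ≡⟨ lem C (2 ^ (2 * u)) (z ^ nmix cs) β ⟩
      z ^ nmix cs * (2 ^ (2 * u) * C * β)     ≡⟨ cong (λ t → z ^ nmix cs * (t * β)) (trans (sym (^-distribˡ-+-* 2 (2 * u) (6 * u))) (cong (2 ^_) (lem₂ u))) ⟩
      z ^ nmix cs * (2 ^ (8 * u) * β)         ≤⟨ *-monoʳ-≤ (z ^ nmix cs) ratio ⟩
      z ^ nmix cs * suc q ^ D                 ∎
      where
      lem : ∀ C t a β → C * (t * a * β) ≡ a * (t * C * β)
      lem = solve-∀
      lem₂ : ∀ u → 2 * u + 6 * u ≡ 8 * u
      lem₂ = solve-∀
    term : ∀ v → v ≤ n → C * (A + G v * (b * R v)) ≤ A * (C + (2 + q))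
    term v v≤n = begin
      C * (A + G v * (b * R v))               ≡⟨ lem C A (G v) b (R v) ⟩
      A * C + (C * b) * (G v * R v)           ≤⟨ +-monoʳ-≤ (A * C) (*-mono-≤ bU (up v≤n)) ⟩
      A * C + (z ^ nmix cs * suc q ^ D) * ((2 + q) * unit k q) ≡⟨ lem₂ (unit k q) C (z ^ nmix cs) (suc q ^ D) q ⟩
      A * (C + (2 + q))                       ∎
      where
      lem : ∀ C A g b r → C * (A + g * (b * r)) ≡ A * C + (C * b) * (g * r)
      lem = solve-∀
      lem₂ : ∀ U C a d q → a * (U * d) * C + (a * d) * ((2 + q) * U) ≡ a * (U * d) * (C + (2 + q))
      lem₂ = solve-∀

  noise-bound : ∀ u w L π τ cs → 2 * w ≤ suc z → nmix cs ≤ w * (2 * u) →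
    (2 ^ (6 * u)) ^ n * (2 ^ L * Ex act cs (λ s → le (q * L) (excess (8 * (q * u)) s)) (π , val π , τ))
      ≤ k ^ length cs * (2 ^ (6 * u) + (2 + q)) ^ n
  noise-bound u w L π τ cs 2w≤ a≤ = *-cancelˡ-≤ (z ^ (n * a) * α ^ n) {{m*n≢0 _ _ {{m^n≢0 z (n * a) {{>-nonZero 1≤z}}}} {{m^n≢0 α n {{α≢0}}}}}} (begin
    (z ^ (n * a) * α ^ n) * (C ^ n * (2 ^ L * E))     ≡⟨ l₁ (z ^ (n * a)) (α ^ n) (C ^ n) (2 ^ L) E ⟩
    C ^ n * (z ^ (n * a) * (α ^ n * 2 ^ L * E))       ≡⟨ cong (λ t → C ^ n * (z ^ (n * a) * t)) (Ex-* act cs (α ^ n * 2 ^ L) _ s₀) ⟨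
    C ^ n * (z ^ (n * a) * Ex act cs (λ s → α ^ n * 2 ^ L * le (q * L) (excess D s)) s₀)
      ≤⟨ *-monoʳ-≤ (C ^ n) (*-monoʳ-≤ (z ^ (n * a)) (Ex-mono-inv act Inv Inv-act cs (λ s h → le-markov {q * L} (V-end D L s h)) s₀ inv₀)) ⟩
    C ^ n * (z ^ (n * a) * Ex act cs (V α β []) s₀)   ≡⟨ cong (λ t → C ^ n * (t * Ex act cs (V α β []) s₀)) (norm-weight cs) ⟨
    C ^ n * (norm (act {k}) weight cs * Ex act cs (V α β []) s₀) ≤⟨ *-monoʳ-≤ (C ^ n) (Ex-super act Inv Inv-act weight (V α β) (V-step α β) cs s₀ inv₀) ⟩
    C ^ n * (k ^ length cs * V α β cs s₀)             ≡⟨ l₂ (C ^ n) (k ^ length cs) (V α β cs s₀) ⟩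
    k ^ length cs * (C ^ n * V α β cs s₀)             ≤⟨ *-monoʳ-≤ (k ^ length cs) (V-start u w π τ cs 2w≤ a≤) ⟩
    k ^ length cs * ((z ^ a * α) ^ n * F)             ≡⟨ cong (λ t → k ^ length cs * (t * F)) (trans (^-distribʳ-* n (z ^ a) α) (cong (_* α ^ n) (trans (^-*-assoc z a n) (cong (z ^_) (*-comm a n))))) ⟩
    k ^ length cs * ((z ^ (n * a) * α ^ n) * F)       ≡⟨ l₂ (k ^ length cs) (z ^ (n * a) * α ^ n) F ⟩
    (z ^ (n * a) * α ^ n) * (k ^ length cs * F)       ∎)
    where
    open ≤-Reasoning
    D C β α a E F : ℕ
    D = 8 * (q * u)
    C = 2 ^ (6 * u)
    β = q ^ D
    α = unit k q * suc q ^ D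
    a = nmix cs
    s₀ : St
    s₀ = π , val π , τ
    inv₀ : Inv s₀
    inv₀ = val≤n π
    E = Ex act cs (λ s → le (q * L) (excess D s)) s₀
    F = (C + (2 + q)) ^ n
    α≢0 : NonZero α
    α≢0 = m*n≢0 _ _ {{m*n≢0 _ _ {{m^n≢0 (suc q) n}} {{m^n≢0 q n {{>-nonZero 1≤q}}}}}} {{m^n≢0 (suc q) D}}
    l₁ : ∀ x y c t e → (x * y) * (c * (t * e)) ≡ c * (x * (y * t * e))
    l₁ = solve-∀
    l₂ : ∀ x y t → x * (y * t) ≡ y * (x * t)
    l₂ = solve-∀

-- Height functions of 0-1 thresholds

le-⊓ : ∀ s a b → le s (a ⊓ b) ≡ le s a * le s b
le-⊓ zero    a       b       = refl
le-⊓ (suc s) zero    b       = refl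
le-⊓ (suc s) (suc a) zero    = sym (*-zeroʳ (le s a))
le-⊓ (suc s) (suc a) (suc b) = le-⊓ s a b

le-⊓⊔ : ∀ s a b → le s (a ⊓ b) + le s (a ⊔ b) ≡ le s a + le s b
le-⊓⊔ zero    a       b       = refl
le-⊓⊔ (suc s) zero    b       = refl
le-⊓⊔ (suc s) (suc a) zero    = sym (+-identityʳ _)
le-⊓⊔ (suc s) (suc a) (suc b) = le-⊓⊔ s a b

height : ℕ → ℕ → Seq → ℕ
height s j τ = Σ< j (λ x → le s (τ x))

-- For j ≠ i + 1 the first j positions contain both exchanged positions or neither.
height-off : ∀ s j i τ → j ≢ suc i → height s j (srt i τ) ≡ height s j τ
height-off s j i τ j≢ with j ≤? i
... | yes j≤i = Σ-cong j (λ x x<j → cong (le s) (srt-off i τ x (<⇒≢ (<-≤-trans x<j j≤i)) (<⇒≢ (<-≤-trans x<j (m≤n⇒m≤1+n j≤i)))))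
... | no  j≰i with Σ-pair j i (λ x → le s (τ x)) (≤∧≢⇒< (≰⇒> j≰i) (j≢ ∘ sym))
...   | r , eq = trans (eq _ (λ x p q → cong (le s) (srt-off i τ x p q)))
    (trans (cong (r +_) (trans (cong₂ (λ a b → le s a + le s b) (srt-lo i τ) (srt-hi i τ)) (le-⊓⊔ s (τ i) (τ (suc i)))))
           (sym (eq _ (λ _ _ _ → refl))))

height-at : ∀ s i τ → height s (suc i) (srt i τ) ≡ height s i τ + le s (τ i) * le s (τ (suc i))
height-at s i τ = trans (Σ-last i _)
  (cong₂ _+_ (height-off s i i τ (<⇒≢ (n<1+n i))) (trans (cong (le s) (srt-lo i τ)) (le-⊓ s (τ i) (τ (suc i)))))

height-≤ : ∀ s j i τ → height s j (srt i τ) ≤ height s j τ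
height-≤ s j i τ with j ≟ suc i
... | no  ne   = ≤-reflexive (height-off s j i τ ne)
... | yes refl = ≤-trans (≤-reflexive (height-at s i τ)) (≤-trans (+-monoʳ-≤ (height s i τ) (≤-trans (*-monoʳ-≤ (le s (τ i)) (le≤1 s _)) (≤-reflexive (*-identityʳ _)))) (≤-reflexive (sym (Σ-last i _))))

-- Equality holds when the two bits agree. The weights 4/5 and 1/5 are those for which both 1 and 4
-- ^ j are fixed by the averaging.
bits : ∀ h x y → x ≤ 1 → y ≤ 1 → 5 * 4 ^ (h + x * y) ≤ 4 * 4 ^ h + 4 ^ (h + x + y)
bits h x y x≤ y≤ = begin
  5 * 4 ^ (h + x * y)            ≡⟨ cong (5 *_) (^-distribˡ-+-* 4 h (x * y)) ⟩
  5 * (4 ^ h * 4 ^ (x * y))      ≡⟨ lem (4 ^ h) _ ⟩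
  4 ^ h * (5 * 4 ^ (x * y))      ≤⟨ *-monoʳ-≤ (4 ^ h) (table x y x≤ y≤) ⟩
  4 ^ h * (4 + 4 ^ (x + y))      ≡⟨ lem₂ (4 ^ h) (4 ^ (x + y)) ⟩
  4 * 4 ^ h + 4 ^ h * 4 ^ (x + y) ≡⟨ cong (4 * 4 ^ h +_) (trans (sym (^-distribˡ-+-* 4 h (x + y))) (cong (4 ^_) (sym (+-assoc h x y)))) ⟩
  4 * 4 ^ h + 4 ^ (h + x + y)    ∎
  where
  open ≤-Reasoning
  lem : ∀ a b → 5 * (a * b) ≡ a * (5 * b)
  lem = solve-∀
  lem₂ : ∀ a b → a * (4 + b) ≡ 4 * a + a * b
  lem₂ = solve-∀
  table : ∀ x y → x ≤ 1 → y ≤ 1 → 5 * 4 ^ (x * y) ≤ 4 + 4 ^ (x + y)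
  table zero       zero       _ _ = m≤m+n 5 0
  table zero       (suc zero) _ _ = m≤m+n 5 3
  table (suc zero) zero       _ _ = m≤m+n 5 3
  table (suc zero) (suc zero) _ _ = m≤m+n 20 0
  table (suc (suc x)) _ (s≤s ()) _
  table zero (suc (suc y)) _ (s≤s ())
  table (suc zero) (suc (suc y)) _ (s≤s ())

∸-split : ∀ x y u v → (x + y) ∸ (u + v) ≤ (x ∸ u) + (y ∸ v)
∸-split x y u v = m≤n+o⇒m∸n≤o (x + y) (u + v) (begin
  x + y                        ≤⟨ +-mono-≤ (m≤n+m∸n x u) (m≤n+m∸n y v) ⟩
  u + (x ∸ u) + (v + (y ∸ v))  ≡⟨ lem u (x ∸ u) v (y ∸ v) ⟩
  u + v + ((x ∸ u) + (y ∸ v))  ∎)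
  where
  open ≤-Reasoning
  lem : ∀ a b c d → a + b + (c + d) ≡ a + c + (b + d)
  lem = solve-∀

-- Subtracting a solution of the averaging equation and truncating at 0 keeps the inequality, since
-- the positive part is subadditive.
∸-average : ∀ a c a₁ c₁ a₂ c₂ → 5 * a ≤ 4 * a₁ + a₂ → 5 * c ≡ 4 * c₁ + c₂ → 5 * (a ∸ c) ≤ 4 * (a₁ ∸ c₁) + (a₂ ∸ c₂)
∸-average a c a₁ c₁ a₂ c₂ ha hc = begin
  5 * (a ∸ c)                     ≡⟨ *-distribˡ-∸ 5 a c ⟩
  5 * a ∸ 5 * c                   ≤⟨ ∸-mono ha (≤-reflexive (sym hc)) ⟩
  4 * a₁ + a₂ ∸ (4 * c₁ + c₂)     ≤⟨ ∸-split (4 * a₁) a₂ (4 * c₁) c₂ ⟩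
  (4 * a₁ ∸ 4 * c₁) + (a₂ ∸ c₂)   ≡⟨ cong (_+ (a₂ ∸ c₂)) (*-distribˡ-∸ 4 a₁ c₁) ⟨
  4 * (a₁ ∸ c₁) + (a₂ ∸ c₂)       ∎
  where open ≤-Reasoning

-- This is 4 ^ n (4 ^ height - 1 - 4 ^ (j - m))⁺ 2 ^ (m - j).  Both 1 and 4 ^ j are harmonic for the
-- averaging inequality `bits`, and the tilt 2 ^ (- j) balances its two sides.
pot : ℕ → ℕ → ℕ → ℕ → Seq → ℕ
pot n m s j τ = 2 ^ (2 * n ∸ (m + j)) * (4 ^ (m + height s j τ) ∸ (4 ^ m + 4 ^ j))

pot-off : ∀ n m s j i τ → j ≢ suc i → pot n m s j (srt i τ) ≡ pot n m s j τ
pot-off n m s j i τ ne = cong (λ h → 2 ^ (2 * n ∸ (m + j)) * (4 ^ (m + h) ∸ (4 ^ m + 4 ^ j))) (height-off s j i τ ne)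

pot-≤ : ∀ n m s j i τ → pot n m s j (srt i τ) ≤ pot n m s j τ
pot-≤ n m s j i τ = *-monoʳ-≤ (2 ^ (2 * n ∸ (m + j))) (∸-monoˡ-≤ (4 ^ m + 4 ^ j) (^-monoʳ-≤ 4 (+-monoʳ-≤ m (height-≤ s j i τ))))

pot-ring : ∀ n m s i τ → m ≤ n → suc i < n → 5 * pot n m s (suc i) (srt i τ) ≤ 2 * pot n m s i τ + 2 * pot n m s (suc (suc i)) τ
pot-ring n m s i τ m≤n i<n = begin
  5 * (2 ^ e₁ * d₁)                 ≡⟨ l₁ (2 ^ e₁) d₁ ⟩
  2 ^ e₁ * (5 * d₁)                 ≤⟨ *-monoʳ-≤ (2 ^ e₁) (∸-average _ (4 ^ m + 4 ^ suc i) _ (4 ^ m + 4 ^ i) _ (4 ^ m + 4 ^ suc (suc i)) five (l₃ (4 ^ m) (4 ^ i))) ⟩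
  2 ^ e₁ * (4 * d₀ + d₂)            ≡⟨ cong (λ e → 2 ^ e * (4 * d₀ + d₂)) E₁ ⟩
  2 * 2 ^ e₂ * (4 * d₀ + d₂)        ≡⟨ l₂ (2 ^ e₂) d₀ d₂ ⟩
  2 * (2 * (2 * 2 ^ e₂) * d₀) + 2 * (2 ^ e₂ * d₂) ≡⟨ cong (λ e → 2 * (2 ^ e * d₀) + 2 * (2 ^ e₂ * d₂)) (sym E₀) ⟩
  2 * (2 ^ e₀ * d₀) + 2 * (2 ^ e₂ * d₂) ∎
  where
  open ≤-Reasoning
  e₀ e₁ e₂ d₀ d₁ d₂ : ℕ
  e₀ = 2 * n ∸ (m + i)
  e₁ = 2 * n ∸ (m + suc i)
  e₂ = 2 * n ∸ (m + suc (suc i))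
  d₀ = 4 ^ (m + height s i τ) ∸ (4 ^ m + 4 ^ i)
  d₁ = 4 ^ (m + height s (suc i) (srt i τ)) ∸ (4 ^ m + 4 ^ suc i)
  d₂ = 4 ^ (m + height s (suc (suc i)) τ) ∸ (4 ^ m + 4 ^ suc (suc i))
  -- No truncation occurs in the exponents, so a step in j changes the tilt by exactly 2. The
  -- weights 4 and 1 thereby become 2 and 2, and their sum 4 being less than 5 is the source of the
  -- decay.
  room : m + suc (suc i) ≤ 2 * n
  room = +-mono-≤ m≤n (≤-trans i<n (m≤m+n n 0))
  E₁ : e₁ ≡ suc e₂
  E₁ = trans (+-∸-assoc 1 (subst (_≤ 2 * n) (+-suc m (suc i)) room)) (cong (λ t → suc (2 * n ∸ t)) (sym (+-suc m (suc i))))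
  E₀ : e₀ ≡ suc (suc e₂)
  E₀ = trans (trans (+-∸-assoc 1 (≤-trans (n≤1+n _) (subst (_≤ 2 * n) (trans (+-suc m (suc i)) (cong suc (+-suc m i))) room))) (cong (λ t → suc (2 * n ∸ t)) (sym (+-suc m i)))) (cong suc E₁)
  l₁ : ∀ a d → 5 * (a * d) ≡ a * (5 * d)
  l₁ = solve-∀
  l₂ : ∀ a d₀ d₂ → 2 * a * (4 * d₀ + d₂) ≡ 2 * (2 * (2 * a) * d₀) + 2 * (a * d₂)
  l₂ = solve-∀
  l₃ : ∀ a b → 5 * (a + 4 * b) ≡ 4 * (a + b) + (a + 4 * (4 * b))
  l₃ = solve-∀
  x y H : ℕ
  x = le s (τ i)
  y = le s (τ (suc i))
  H = height s i τ
  H₂ : height s (suc (suc i)) τ ≡ H + x + y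
  H₂ = trans (Σ-last (suc i) (λ x → le s (τ x))) (cong (_+ y) (Σ-last i (λ x → le s (τ x))))
  five : 5 * 4 ^ (m + height s (suc i) (srt i τ)) ≤ 4 * 4 ^ (m + H) + 4 ^ (m + height s (suc (suc i)) τ)
  five rewrite height-at s i τ | H₂ =
    subst₂ (λ a b → 5 * 4 ^ a ≤ 4 * 4 ^ (m + H) + 4 ^ b) (+-assoc m H (x * y))
      (trans (+-assoc (m + H) x y) (trans (+-assoc m H (x + y)) (cong (m +_) (sym (+-assoc H x y)))))
      (bits (m + H) x y (le≤1 s _) (le≤1 s _))

-- In one random update a site becomes at most 2/5 of the sum of its two neighbours.
module Averaging (k : ℕ) (1≤k : 1 ≤ k) (A : ℕ) (1≤A : 1 ≤ A) (y : ℕ → ℕ) (y' : ℕ → ℕ → ℕ)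
                 (y0 : y 0 ≡ 0) (yn : y (suc k) ≡ 0)
                 (off : ∀ i j → j ≢ suc i → y' i j ≡ y j)
                 (ring : ∀ i → i < k → 5 * y' i (suc i) ≤ 2 * y i + 2 * y (suc (suc i))) where
  Y : ℕ
  Y = Σ< k (λ j → y (suc j))

  neighbours : Σ< k (λ i → y i + y (suc (suc i))) ≤ 2 * Y
  neighbours = begin
    Σ< k (λ i → y i + y (suc (suc i)))        ≡⟨ Σ-+ k y (λ i → y (suc (suc i))) ⟩
    Σ< k y + Σ< k (λ i → y (suc (suc i)))     ≤⟨ +-mono-≤ below' above' ⟩
    Y + Y                                     ≡⟨ cong (Y +_) (sym (+-identityʳ Y)) ⟩
    2 * Y                                     ∎
    where
    open ≤-Reasoning
    below' : Σ< k y ≤ Y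
    below' = begin
      Σ< k y                  ≤⟨ m≤m+n _ (y k) ⟩
      Σ< k y + y k            ≡⟨ Σ-last k y ⟨
      y 0 + Y                 ≡⟨ cong (_+ Y) y0 ⟩
      Y                       ∎
    above' : Σ< k (λ i → y (suc (suc i))) ≤ Y
    above' = begin
      Σ< k (λ i → y (suc (suc i)))             ≤⟨ m≤n+m _ (y 1) ⟩
      y 1 + Σ< k (λ i → y (suc (suc i)))       ≡⟨ Σ-last k (λ j → y (suc j)) ⟩
      Y + y (suc k)                            ≡⟨ trans (cong (Y +_) yn) (+-identityʳ Y) ⟩
      Y                                        ∎

  Σ-one : ∀ m (f g : ℕ → ℕ) i → i < m → (∀ x → x ≢ i → g x ≡ f x) → Σ< m g + f i ≡ Σ< m f + g i
  Σ-one (suc m) f g zero    _         h =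
    trans (cong (λ S → g 0 + S + f 0) (Σ-cong m (λ x _ → h (suc x) (λ ())))) (lem (g 0) _ (f 0))
    where
    lem : ∀ a b c → a + b + c ≡ c + b + a
    lem = solve-∀
  Σ-one (suc m) f g (suc i) (s≤s i<m) h =
    trans (+-assoc (g 0) _ _) (trans (cong₂ _+_ (h 0 (λ ())) (Σ-one m (λ x → f (suc x)) (λ x → g (suc x)) i i<m (λ x p → h (suc x) (p ∘ suc-injective)))) (sym (+-assoc (f 0) _ _)))

  -- An updated site loses its value, and each site feeds at most 2/5 of itself into either
  -- neighbour: a net loss of 1/5 of the total, spread over k choices. The ends carry nothing.
  mean : 5 * Σ< k (λ i → Σ< k (λ j → y' i (suc j))) + Y ≤ 5 * (k * Y)
  mean = +-cancelʳ-≤ (4 * Y) _ _ (begin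
    5 * S + Y + 4 * Y                         ≡⟨ l₁ S Y ⟩
    5 * (S + Y)                               ≡⟨ cong (5 *_) (Σ-+ k _ _) ⟨
    5 * Σ< k (λ i → Σ< k (λ j → y' i (suc j)) + y (suc i)) ≡⟨ cong (5 *_) (Σ-cong k (λ i i<k → Σ-one k (λ j → y (suc j)) (λ j → y' i (suc j)) i i<k (λ x p → off i (suc x) (p ∘ suc-injective)))) ⟩
    5 * Σ< k (λ i → Y + y' i (suc i))         ≡⟨ cong (5 *_) (trans (Σ-+ k (λ _ → Y) _) (cong (_+ Σ< k (λ i → y' i (suc i))) (Σ-const k Y))) ⟩
    5 * (k * Y + Σ< k (λ i → y' i (suc i)))   ≡⟨ trans (*-distribˡ-+ 5 (k * Y) _) (cong (5 * (k * Y) +_) (sym (Σ-* k 5 _))) ⟩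
    5 * (k * Y) + Σ< k (λ i → 5 * y' i (suc i)) ≤⟨ +-monoʳ-≤ (5 * (k * Y)) (Σ-mono k ring) ⟩
    5 * (k * Y) + Σ< k (λ i → 2 * y i + 2 * y (suc (suc i))) ≡⟨ cong (5 * (k * Y) +_) (trans (Σ-cong k (λ i _ → sym (*-distribˡ-+ 2 (y i) _))) (Σ-* k 2 (λ i → y i + y (suc (suc i))))) ⟩
    5 * (k * Y) + 2 * Σ< k (λ i → y i + y (suc (suc i))) ≤⟨ +-monoʳ-≤ (5 * (k * Y)) (*-monoʳ-≤ 2 neighbours) ⟩
    5 * (k * Y) + 2 * (2 * Y)                 ≡⟨ cong (5 * (k * Y) +_) (l₂ Y) ⟩
    5 * (k * Y) + 4 * Y                       ∎)
    where
    open ≤-Reasoning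
    S = Σ< k (λ i → Σ< k (λ j → y' i (suc j)))
    l₁ : ∀ S Y → 5 * S + Y + 4 * Y ≡ 5 * (S + Y)
    l₁ = solve-∀
    l₂ : ∀ Y → 2 * (2 * Y) ≡ 4 * Y
    l₂ = solve-∀

  module _ (small : ∀ i → i < k → 16 * y (suc i) ≤ A) where
    P : ℕ
    P = Π< k (λ j → A + y (suc j))
    P' : ℕ → ℕ
    P' i = Π< k (λ j → A + y' i (suc j))

    -- The relative change has denominator A + y rather than A. Since 16 y ≤ A, this costs at most a
    -- factor 17/16, whence 80/85 = 16/17 for the loss; 34/85 = 2/5 is the gain from the neighbours.
    one : ∀ i → i < k → 85 * (A * P' i) + 80 * (y (suc i) * P) ≤ 85 * (A * P) + 34 * ((y i + y (suc (suc i))) * P)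
    one i i<k = begin
      85 * (A * P' i) + 80 * (y (suc i) * P)          ≡⟨ cong₂ (λ u w → 85 * (A * u) + 80 * (y (suc i) * w)) p' p ⟩
      85 * (A * ((A + v') * Q)) + 80 * (v * ((A + v) * Q)) ≡⟨ l₁ A v' Q v ⟩
      85 * (A * A * Q) + 17 * A * Q * (5 * v') + (80 * A * v * Q + 5 * v * Q * (16 * v))
        ≤⟨ +-mono-≤ (+-monoʳ-≤ (85 * (A * A * Q)) (*-monoʳ-≤ (17 * A * Q) (ring i i<k))) (+-monoʳ-≤ (80 * A * v * Q) (*-monoʳ-≤ (5 * v * Q) (small i i<k))) ⟩
      85 * (A * A * Q) + 17 * A * Q * (2 * a + 2 * c) + (80 * A * v * Q + 5 * v * Q * A)
        ≤⟨ m≤m+n _ (34 * ((a + c) * (v * Q))) ⟩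
      85 * (A * A * Q) + 17 * A * Q * (2 * a + 2 * c) + (80 * A * v * Q + 5 * v * Q * A) + 34 * ((a + c) * (v * Q))
        ≡⟨ l₂ A Q a c v ⟩
      85 * (A * ((A + v) * Q)) + 34 * ((a + c) * ((A + v) * Q)) ≡⟨ cong (λ w → 85 * (A * w) + 34 * ((a + c) * w)) p ⟨
      85 * (A * P) + 34 * ((a + c) * P)               ∎
      where
      open ≤-Reasoning
      a c v v' Q : ℕ
      a = y i
      c = y (suc (suc i))
      v = y (suc i)
      v' = y' i (suc i)
      Q = Π-without k i (λ j → A + y (suc j))
      p : P ≡ (A + v) * Q
      p = Π-split k i _ _ i<k (λ _ _ → refl)
      p' : P' i ≡ (A + v') * Q
      p' = Π-split k i _ _ i<k (λ x ne → cong (A +_) (off i (suc x) (ne ∘ suc-injective)))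
      l₁ : ∀ A v' Q v → 85 * (A * ((A + v') * Q)) + 80 * (v * ((A + v) * Q)) ≡ 85 * (A * A * Q) + 17 * A * Q * (5 * v') + (80 * A * v * Q + 5 * v * Q * (16 * v))
      l₁ = solve-∀
      l₂ : ∀ A Q a c v → 85 * (A * A * Q) + 17 * A * Q * (2 * a + 2 * c) + (80 * A * v * Q + 5 * v * Q * A) + 34 * ((a + c) * (v * Q)) ≡ 85 * (A * ((A + v) * Q)) + 34 * ((a + c) * ((A + v) * Q))
      l₂ = solve-∀

    S : ℕ
    S = Σ< k P'

    summed : 85 * (A * S) + 12 * (Y * P) ≤ 85 * (A * (k * P))
    summed = +-cancelʳ-≤ (68 * (Y * P)) _ _ (begin
      85 * (A * S) + 12 * (Y * P) + 68 * (Y * P)      ≡⟨ l₁ (A * S) (Y * P) ⟩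
      85 * (A * S) + 80 * (Y * P)                     ≡⟨ cong₂ _+_ (pull 85 A P') (trans (cong (80 *_) (trans (*-comm Y P) (sym (Σ-* k P (λ i → y (suc i)))))) (sym (Σ-* k 80 _))) ⟩
      Σ< k (λ i → 85 * (A * P' i)) + Σ< k (λ i → 80 * (P * y (suc i))) ≡⟨ Σ-+ k _ _ ⟨
      Σ< k (λ i → 85 * (A * P' i) + 80 * (P * y (suc i))) ≤⟨ Σ-mono k (λ i i<k → subst (λ t → 85 * (A * P' i) + 80 * t ≤ 85 * (A * P) + 34 * ((y i + y (suc (suc i))) * P)) (*-comm (y (suc i)) P) (one i i<k)) ⟩
      Σ< k (λ i → 85 * (A * P) + 34 * ((y i + y (suc (suc i))) * P)) ≡⟨ trans (Σ-+ k (λ _ → 85 * (A * P)) _) (cong₂ _+_ (Σ-const k _) (trans (Σ-* k 34 _) (cong (34 *_) (trans (Σ-cong k (λ i _ → *-comm _ P)) (Σ-* k P (λ i → y i + y (suc (suc i)))))))) ⟩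
      k * (85 * (A * P)) + 34 * (P * Σ< k (λ i → y i + y (suc (suc i)))) ≤⟨ +-monoʳ-≤ (k * (85 * (A * P))) (*-monoʳ-≤ 34 (*-monoʳ-≤ P neighbours)) ⟩
      k * (85 * (A * P)) + 34 * (P * (2 * Y))         ≡⟨ l₂ k A P Y ⟩
      85 * (A * (k * P)) + 68 * (Y * P)               ∎)
      where
      open ≤-Reasoning
      pull : ∀ c A (f : ℕ → ℕ) → c * (A * Σ< k f) ≡ Σ< k (λ i → c * (A * f i))
      pull c A f = trans (cong (c *_) (sym (Σ-* k A f))) (sym (Σ-* k c _))
      l₁ : ∀ a b → 85 * a + 12 * b + 68 * b ≡ 85 * a + 80 * b
      l₁ = solve-∀
      l₂ : ∀ k A P Y → k * (85 * (A * P)) + 34 * (P * (2 * Y)) ≡ 85 * (A * (k * P)) + 68 * (Y * P)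
      l₂ = solve-∀

    -- Summing over i leaves 80 - 2 * 34 = 12 parts in 85, which exceeds 1/8; the surplus 11 A S is
    -- covered by the same estimate without its gain.
    eighth : 8 * (A * S) + Y * P ≤ 8 * (A * (k * P))
    eighth = *-cancelˡ-≤ 12 (begin
      12 * (8 * (A * S) + Y * P)                      ≡⟨ l₁ (A * S) (Y * P) ⟩
      (85 * (A * S) + 12 * (Y * P)) + 11 * (A * S)    ≤⟨ +-mono-≤ summed (*-monoʳ-≤ 11 AS≤) ⟩
      85 * (A * (k * P)) + 11 * (A * (k * P))         ≡⟨ l₂ (A * (k * P)) ⟩
      12 * (8 * (A * (k * P)))                        ∎)
      where
      open ≤-Reasoning
      AS≤ : A * S ≤ A * (k * P)
      AS≤ = *-cancelˡ-≤ {A * S} {A * (k * P)} 85 (≤-trans (m≤m+n (85 * (A * S)) (12 * (Y * P))) summed)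
      l₁ : ∀ a b → 12 * (8 * a + b) ≡ (85 * a + 12 * b) + 11 * a
      l₁ = solve-∀
      l₂ : ∀ a → 85 * a + 11 * a ≡ 12 * (8 * a)
      l₂ = solve-∀

    -- `eighth` multiplies the product by at most 1 - Y/(8 k A) in mean. By `Π-perturb` this is
    -- dominated by shrinking every y by 8k / (8k + 1), so the bound is again a product and can be
    -- iterated.
    product-step : suc (8 * k) ^ k * S ≤ k * Π< k (λ j → suc (8 * k) * A + 8 * k * y (suc j))
    product-step = *-cancelˡ-≤ (8 * (A * g)) {{>-nonZero (*-mono-≤ {1} {8} (s≤s z≤n) (*-mono-≤ 1≤A (s≤s (z≤n {8 * k}))))}} (+-cancelʳ-≤ (g * (C * (Y * P))) _ _ (begin
      8 * (A * g) * (C * S) + g * (C * (Y * P))       ≡⟨ l₁ A g C S (Y * P) ⟩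
      g * C * (8 * (A * S) + Y * P)                   ≤⟨ *-monoʳ-≤ (g * C) eighth ⟩
      g * C * (8 * (A * (k * P)))                     ≡⟨ l₂ g C A k P ⟩
      8 * k * (g * A * (C * P))                       ≡⟨ cong (λ t → 8 * k * (g * A * t)) (trans (cong (_* P) (sym (Π-const k g))) (trans (sym (Π-* k _ _)) (Π-cong k (λ j _ → l₃ k A (y (suc j)))))) ⟩
      8 * k * (g * A * T)                             ≤⟨ *-monoʳ-≤ (8 * k) (Π-perturb k (g * A) _ _ (λ x _ → ≤-trans (m≤m+n (g * A) _) (m≤m+n _ _))) ⟩
      8 * k * (g * A * R + Y * T)                     ≡⟨ *-distribˡ-+ (8 * k) _ _ ⟩
      8 * k * (g * A * R) + 8 * k * (Y * T)           ≤⟨ +-mono-≤ (≤-reflexive (l₄ k g A R)) (*-monoˡ-≤ (Y * T) (n≤1+n (8 * k))) ⟩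
      8 * (A * g) * (k * R) + g * (Y * T)             ≡⟨ cong (λ t → 8 * (A * g) * (k * R) + g * t) (trans (cong (Y *_) (trans (Π-cong k (λ j _ → sym (l₃ k A (y (suc j))))) (trans (Π-* k _ _) (cong (_* P) (Π-const k g))))) (l₅ Y C P)) ⟩
      8 * (A * g) * (k * R) + g * (C * (Y * P))       ∎))
      where
      open ≤-Reasoning
      g C R T : ℕ
      g = suc (8 * k)
      C = g ^ k
      R = Π< k (λ j → g * A + 8 * k * y (suc j))
      T = Π< k (λ j → g * A + 8 * k * y (suc j) + y (suc j))
      l₁ : ∀ A g C S W → 8 * (A * g) * (C * S) + g * (C * W) ≡ g * C * (8 * (A * S) + W)
      l₁ = solve-∀
      l₂ : ∀ g C A k P → g * C * (8 * (A * (k * P))) ≡ 8 * k * (g * A * (C * P))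
      l₂ = solve-∀
      l₃ : ∀ k A y → (1 + 8 * k) * (A + y) ≡ (1 + 8 * k) * A + 8 * k * y + y
      l₃ = solve-∀
      l₄ : ∀ k g A R → 8 * k * (g * A * R) ≡ 8 * (A * g) * (k * R)
      l₄ = solve-∀
      l₅ : ∀ Y C P → Y * (C * P) ≡ C * (Y * P)
      l₅ = solve-∀

-- The potentials along a sorting process

-- Convexity: (1 + y) dominates the piecewise linear interpolation of 2 ^ y on [0 , 1].
Π≥2^ : ∀ α → 1 ≤ α → ∀ m (y : ℕ → ℕ) → (∀ x → x < m → y x ≤ α) →
       ∀ c r → r ≤ α → c * α + r ≤ Σ< m y → 2 ^ c * (α + r) * α ^ m ≤ α * Π< m (λ x → α + y x)
Π≥2^ α 1≤α zero y h zero zero r≤ le = ≤-reflexive (lem α)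
  where
  lem : ∀ a → 1 * (a + 0) * 1 ≡ a * 1
  lem = solve-∀
Π≥2^ α 1≤α zero y h (suc c) r r≤ le = ⊥-elim (<⇒≱ 1≤α (≤-trans (m≤m+n α (c * α + r)) (subst (_≤ 0) (+-assoc α _ r) le)))
Π≥2^ α 1≤α (suc m) y h c r r≤ le with y 0 ≤? r
... | yes y≤r with m≤n⇒∃[o]m+o≡n y≤r
...   | d , refl = begin
  2 ^ c * (α + (v + d)) * (α * α ^ m)           ≤⟨ m≤m+n _ (2 ^ c * (v * d) * α ^ m) ⟩
  2 ^ c * (α + (v + d)) * (α * α ^ m) + 2 ^ c * (v * d) * α ^ m ≡⟨ l₁ (2 ^ c) α v d (α ^ m) ⟩
  (α + v) * (2 ^ c * (α + d) * α ^ m)           ≤⟨ *-monoʳ-≤ (α + v) (Π≥2^ α 1≤α m _ (λ x l → h (suc x) (s≤s l)) c d (≤-trans (m≤n+m d v) r≤) rest) ⟩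
  (α + v) * (α * Π< m (λ x → α + y (suc x)))    ≡⟨ l₂ α v _ ⟩
  α * Π< (suc m) (λ x → α + y x)                ∎
  where
  open ≤-Reasoning
  v = y 0
  rest : c * α + d ≤ Σ< m (λ x → y (suc x))
  rest = +-cancelˡ-≤ v _ _ (subst (_≤ v + Σ< m (λ x → y (suc x))) (l₃ (c * α) v d) le)
    where
    l₃ : ∀ c v d → c + (v + d) ≡ v + (c + d)
    l₃ = solve-∀
  l₁ : ∀ t α v d a → t * (α + (v + d)) * (α * a) + t * (v * d) * a ≡ (α + v) * (t * (α + d) * a)
  l₁ = solve-∀
  l₂ : ∀ α v p → (α + v) * (α * p) ≡ α * ((α + v) * p)
  l₂ = solve-∀
Π≥2^ α 1≤α (suc m) y h zero r r≤ le | no y≰r = begin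
  1 * (α + r) * (α * α ^ m)                     ≡⟨ l₁ (α + r) α (α ^ m) ⟩
  α * ((α + r) * α ^ m)                         ≤⟨ *-monoʳ-≤ α (*-mono-≤ (+-monoʳ-≤ α (<⇒≤ (≰⇒> y≰r))) (≤-trans (≤-reflexive (sym (Π-const m α))) (Π-mono m (λ x _ → m≤m+n α _)))) ⟩
  α * Π< (suc m) (λ x → α + y x)                ∎
  where
  open ≤-Reasoning
  l₁ : ∀ b α a → 1 * b * (α * a) ≡ α * (b * a)
  l₁ = solve-∀
Π≥2^ α 1≤α (suc m) y h (suc c) r r≤ le | no y≰r with m≤n⇒∃[o]m+o≡n (<⇒≤ (≰⇒> y≰r)) | m≤n⇒∃[o]m+o≡n (h 0 (s≤s z≤n))
... | e , re | f , vf = begin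
  2 * 2 ^ c * (α + r) * (α * α ^ m)             ≤⟨ m≤m+n _ (2 ^ c * (e * f) * α ^ m) ⟩
  2 * 2 ^ c * (α + r) * (α * α ^ m) + 2 ^ c * (e * f) * α ^ m ≡⟨ cong (λ t → 2 * 2 ^ c * (t + r) * (t * α ^ m) + 2 ^ c * (e * f) * α ^ m) (sym α≡) ⟩
  2 * 2 ^ c * (r + e + f + r) * ((r + e + f) * α ^ m) + 2 ^ c * (e * f) * α ^ m ≡⟨ l₁ (2 ^ c) r e f (α ^ m) ⟩
  (r + e + f + (r + e)) * (2 ^ c * (r + e + f + (r + f)) * α ^ m) ≡⟨ cong₂ (λ t v → (t + v) * (2 ^ c * (t + (r + f)) * α ^ m)) α≡ re ⟩
  (α + v) * (2 ^ c * (α + (r + f)) * α ^ m)     ≤⟨ *-monoʳ-≤ (α + v) (Π≥2^ α 1≤α m _ (λ x l → h (suc x) (s≤s l)) c (r + f) (subst (r + f ≤_) α≡ (+-monoˡ-≤ f (m≤m+n r e))) rest) ⟩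
  (α + v) * (α * Π< m (λ x → α + y (suc x)))    ≡⟨ l₂ α v _ ⟩
  α * Π< (suc m) (λ x → α + y x)                ∎
  where
  open ≤-Reasoning
  v = y 0
  α≡ : r + e + f ≡ α
  α≡ = trans (cong (_+ f) re) vf
  rest : c * α + (r + f) ≤ Σ< m (λ x → y (suc x))
  rest = +-cancelˡ-≤ (r + e) _ _ (subst₂ _≤_ (trans (cong (λ t → t + c * α + r) (sym α≡)) (l₃ r e f (c * α))) (cong (_+ Σ< m (λ x → y (suc x))) (sym re)) le)
    where
    l₃ : ∀ r e f c → r + e + f + c + r ≡ r + e + (c + (r + f))
    l₃ = solve-∀
  l₁ : ∀ t r e f a → 2 * t * (r + e + f + r) * ((r + e + f) * a) + t * (e * f) * a ≡ (r + e + f + (r + e)) * (t * (r + e + f + (r + f)) * a)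
  l₁ = solve-∀
  l₂ : ∀ α v p → (α + v) * (α * p) ≡ α * ((α + v) * p)
  l₂ = solve-∀

module Sorting (k : ℕ) (1≤k : 1 ≤ k) (M : ℕ → ℕ) (M≤ : ∀ s → M s ≤ suc k) (F : ℕ) (1≤F : 1 ≤ F) where
  n α : ℕ
  n = suc k
  α = 16 * F

  1≤α : 1 ≤ α
  1≤α = *-mono-≤ {1} {16} (s≤s z≤n) 1≤F

  profile : ℕ → Seq → ℕ
  profile j τ = Σ< n (λ s → pot n (M s) s j τ)

  field-0 : ∀ τ → profile 0 τ ≡ 0
  field-0 τ = trans (Σ-cong n (λ s _ → trans (cong (2 ^ (2 * n ∸ (M s + 0)) *_) (m≤n⇒m∸n≡0 (≤-trans (≤-reflexive (cong (4 ^_) (+-identityʳ (M s)))) (m≤m+n (4 ^ M s) 1)))) (*-zeroʳ (2 ^ (2 * n ∸ (M s + 0)))))) (trans (Σ-const n 0) (*-zeroʳ n))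

  -- Both clauses survive sorting because heights never rise. The first makes the profile vanish at
  -- the right end; the second provides the smallness that `Averaging` asks of product factors, with
  -- α = 16 F.
  SInv : Seq → Set
  SInv τ = (∀ s → s < n → M s + height s n τ ≤ n) × (∀ j → j < k → profile (suc j) τ ≤ F)

  field-n : ∀ τ → SInv τ → profile n τ ≡ 0
  field-n τ (h , _) = trans (Σ-cong n (λ s s<n → trans (cong (2 ^ (2 * n ∸ (M s + n)) *_) (m≤n⇒m∸n≡0 (≤-trans (^-monoʳ-≤ 4 (h s s<n)) (m≤n+m (4 ^ n) (4 ^ M s))))) (*-zeroʳ (2 ^ (2 * n ∸ (M s + n)))))) (trans (Σ-const n 0) (*-zeroʳ n))

  field-off : ∀ i j τ → j ≢ suc i → profile j (srt i τ) ≡ profile j τ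
  field-off i j τ ne = Σ-cong n (λ s _ → pot-off n (M s) s j i τ ne)

  field-≤ : ∀ i j τ → profile j (srt i τ) ≤ profile j τ
  field-≤ i j τ = Σ-mono n (λ s _ → pot-≤ n (M s) s j i τ)

  field-ring : ∀ τ i → i < k → 5 * profile (suc i) (srt i τ) ≤ 2 * profile i τ + 2 * profile (suc (suc i)) τ
  field-ring τ i i<k = begin
    5 * profile (suc i) (srt i τ)                         ≡⟨ Σ-* n 5 (λ s → pot n (M s) s (suc i) (srt i τ)) ⟨
    Σ< n (λ s → 5 * pot n (M s) s (suc i) (srt i τ))     ≤⟨ Σ-mono n (λ s _ → pot-ring n (M s) s i τ (M≤ s) (s≤s i<k)) ⟩
    Σ< n (λ s → 2 * pot n (M s) s i τ + 2 * pot n (M s) s (suc (suc i)) τ) ≡⟨ trans (Σ-+ n (λ s → 2 * pot n (M s) s i τ) (λ s → 2 * pot n (M s) s (suc (suc i)) τ)) (cong₂ _+_ (Σ-* n 2 (λ s → pot n (M s) s i τ)) (Σ-* n 2 (λ s → pot n (M s) s (suc (suc i)) τ))) ⟩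
    2 * profile i τ + 2 * profile (suc (suc i)) τ          ∎
    where open ≤-Reasoning

  total : Seq → ℕ
  total τ = Σ< k (λ i → profile (suc i) τ)

  SInv-srt : ∀ i τ → SInv τ → SInv (srt i τ)
  SInv-srt i τ (h , f) = (λ s s<n → ≤-trans (+-monoʳ-≤ (M s) (height-≤ s n i τ)) (h s s<n)) , (λ j j<k → ≤-trans (field-≤ i (suc j) τ) (f j j<k))

  St : Set
  St = Permutation′ (suc k) × Seq × Seq

  InvT : St → Set
  InvT (π , σ , τ) = SInv τ

  InvT-act : ∀ c (i : Fin k) s → InvT s → InvT (act c i s)
  InvT-act srtK i (π , σ , τ) h = SInv-srt (toℕ i) τ h
  InvT-act mixK i (π , σ , τ) h = h

  total-mean : ∀ τ → SInv τ → 5 * Σ< k (λ i → total (srt i τ)) + total τ ≤ 5 * (k * total τ)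
  total-mean τ h = Averaging.mean k 1≤k 1 (s≤s z≤n) (λ j → profile j τ) (λ i j → profile j (srt i τ))
    (field-0 τ) (field-n τ h) (λ i j → field-off i j τ) (field-ring τ)

  Ψ : ℕ → ℕ → Seq → ℕ
  Ψ a b τ = Π< k (λ i → a + b * profile (suc i) τ)

  Ψ-step : ∀ a b τ → 1 ≤ a → SInv τ → (∀ j → j < k → 16 * (b * profile (suc j) τ) ≤ a) →
           suc (8 * k) ^ k * Σ< k (λ i → Ψ a b (srt i τ)) ≤ k * Ψ (suc (8 * k) * a) (8 * k * b) τ
  Ψ-step a b τ 1≤a h small = ≤-trans
    (Averaging.product-step k 1≤k a 1≤a (λ j → b * profile j τ) (λ i j → b * profile j (srt i τ))
      (trans (cong (b *_) (field-0 τ)) (*-zeroʳ b)) (trans (cong (b *_) (field-n τ h)) (*-zeroʳ b))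
      (λ i j ne → cong (b *_) (field-off i j τ ne))
      (λ i i<k → subst₂ _≤_ (l₁ b _) (l₂ b (profile i τ) (profile (suc (suc i)) τ)) (*-monoʳ-≤ b (field-ring τ i i<k))) small)
    (≤-reflexive (cong (k *_) (Π-cong k (λ j _ → cong (suc (8 * k) * a +_) (sym (*-assoc (8 * k) b _))))))
    where
    l₁ : ∀ b f → b * (5 * f) ≡ 5 * (b * f)
    l₁ = solve-∀
    l₂ : ∀ b f g → b * (2 * f + 2 * g) ≡ 2 * (b * f) + 2 * (b * g)
    l₂ = solve-∀

  w : ℕ
  w = 5 * k ∸ 1

  5k≡ : 5 * k ≡ suc w
  5k≡ = sym (m+[n∸m]≡n {1} {5 * k} (≤-trans 1≤k (m≤m+n k _)))

  V₁ : List Kind → St → ℕ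
  V₁ cs (π , σ , τ) = w ^ nsort cs * total τ

  N₁ : Kind → ℕ
  N₁ srtK = suc w
  N₁ mixK = 1

  V₁-step : ∀ c cs s → InvT s → N₁ c * ΣF (λ i → V₁ cs (act c i s)) ≤ k * V₁ (c ∷ cs) s
  V₁-step srtK cs (π , σ , τ) h = begin
    suc w * ΣF {k} (λ i → W * total (srt (toℕ i) τ))      ≤⟨ *-monoʳ-≤ (suc w) (ΣF-≤ {k} _ (λ i → W * total (srt i τ)) (λ i → ≤-refl)) ⟩
    suc w * Σ< k (λ i → W * total (srt i τ))          ≡⟨ cong (suc w *_) (Σ-* k W _) ⟩
    suc w * (W * S)                                   ≡⟨ l₁ (suc w) W S ⟩
    W * (suc w * S)                                   ≤⟨ *-monoʳ-≤ W core ⟩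
    W * (w * (k * total τ))                           ≡⟨ l₂ W w k (total τ) ⟩
    k * (w * W * total τ)                             ∎
    where
    open ≤-Reasoning
    W S : ℕ
    W = w ^ nsort cs
    S = Σ< k (λ i → total (srt i τ))
    l₁ : ∀ a b c → a * (b * c) ≡ b * (a * c)
    l₁ = solve-∀
    l₂ : ∀ W w k t → W * (w * (k * t)) ≡ k * (w * W * t)
    l₂ = solve-∀
    l₃ : ∀ k S t → 5 * k * S + k * t ≡ k * (5 * S + t)
    l₃ = solve-∀
    l₄ : ∀ k t → k * (5 * (k * t)) ≡ 5 * k * (k * t)
    l₄ = solve-∀
    l₅ : ∀ w a → (1 + w) * a ≡ w * a + a
    l₅ = solve-∀
    core : suc w * S ≤ w * (k * total τ)
    core = +-cancelʳ-≤ (k * total τ) _ _ (begin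
      suc w * S + k * total τ          ≡⟨ cong (λ t → t * S + k * total τ) (sym 5k≡) ⟩
      5 * k * S + k * total τ          ≡⟨ l₃ k S (total τ) ⟩
      k * (5 * S + total τ)            ≤⟨ *-monoʳ-≤ k (total-mean τ h) ⟩
      k * (5 * (k * total τ))          ≡⟨ l₄ k (total τ) ⟩
      5 * k * (k * total τ)            ≡⟨ cong (_* (k * total τ)) 5k≡ ⟩
      suc w * (k * total τ)            ≡⟨ l₅ w (k * total τ) ⟩
      w * (k * total τ) + k * total τ  ∎)
  V₁-step mixK cs (π , σ , τ) h = ≤-reflexive (trans (*-identityˡ _) (ΣF-const {k} _))

  V₂ : List Kind → St → ℕ
  V₂ cs (π , σ , τ) = Ψ (suc (8 * k) ^ nsort cs * α) ((8 * k) ^ nsort cs) τ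

  N₂ : Kind → ℕ
  N₂ srtK = suc (8 * k) ^ k
  N₂ mixK = 1

  V₂-step : ∀ c cs s → InvT s → N₂ c * ΣF (λ i → V₂ cs (act c i s)) ≤ k * V₂ (c ∷ cs) s
  V₂-step srtK cs (π , σ , τ) h = begin
    g ^ k * ΣF {k} (λ i → Ψ a b (srt (toℕ i) τ))   ≤⟨ *-monoʳ-≤ (g ^ k) (ΣF-≤ {k} _ (λ i → Ψ a b (srt i τ)) (λ i → ≤-refl)) ⟩
    g ^ k * Σ< k (λ i → Ψ a b (srt i τ))       ≤⟨ Ψ-step a b τ (*-mono-≤ (m^n>0 g (nsort cs)) 1≤α) h small ⟩
    k * Ψ (g * a) (8 * k * b) τ                ≡⟨ cong (λ t → k * Ψ t (8 * k * b) τ) (sym (*-assoc g (g ^ nsort cs) α)) ⟩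
    k * V₂ (srtK ∷ cs) (π , σ , τ)             ∎
    where
    open ≤-Reasoning
    g a b : ℕ
    g = suc (8 * k)
    a = g ^ nsort cs * α
    b = (8 * k) ^ nsort cs
    l : ∀ b f → 16 * (b * f) ≡ b * (16 * f)
    l = solve-∀
    small : ∀ j → j < k → 16 * (b * profile (suc j) τ) ≤ a
    small j j<k = ≤-trans (≤-reflexive (l b (profile (suc j) τ))) (*-mono-≤ (^-monoˡ-≤ (nsort cs) (n≤1+n (8 * k))) (*-monoʳ-≤ 16 (proj₂ h j j<k)))
  V₂-step mixK cs (π , σ , τ) h = ≤-reflexive (trans (*-identityˡ _) (ΣF-const {k} _))

  norm-pow : ∀ (N : Kind → ℕ) B → N srtK ≡ B → N mixK ≡ 1 → ∀ cs → norm (act {k}) N cs ≡ B ^ nsort cs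
  norm-pow N B p r []          = refl
  norm-pow N B p r (srtK ∷ cs) = cong₂ _*_ p (norm-pow N B p r cs)
  norm-pow N B p r (mixK ∷ cs) = trans (cong (_* norm (act {k}) N cs) r) (trans (+-identityʳ _) (norm-pow N B p r cs))

  total-≤ : ∀ τ → SInv τ → total τ ≤ k * F
  total-≤ τ h = ≤-trans (Σ-mono k (proj₂ h)) (≤-reflexive (Σ-const k F))

  -- Since (1 - 1/(5k)) ^ (5 k a) ≤ 2 ^ (- a), Markov's inequality suffices. The gain must beat the
  -- initial bound k F, which in the application restricts this to A of order log n or more.
  first-moment : ∀ a T cs s → InvT s → 5 * k * a ≤ nsort cs →
                 2 ^ a * (T * Ex act cs (λ s → le T (total (proj₂ (proj₂ s)))) s) ≤ k ^ length cs * (k * F)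
  first-moment a T cs s@(π , σ , τ) h ns≥ = *-cancelˡ-≤ (w ^ m) {{m^n≢0 w m {{>-nonZero 1≤w}}}} (begin
    w ^ m * (2 ^ a * (T * E))            ≡⟨ l₁ (w ^ m) (2 ^ a) (T * E) ⟩
    2 ^ a * w ^ m * (T * E)              ≤⟨ *-mono-≤ ratio (≤-trans (≤-reflexive (sym (Ex-* act cs T _ s))) (Ex-mono act cs (λ s → le-markov {T} id) s)) ⟩
    suc w ^ m * Ex act cs X s            ≡⟨ cong₂ _*_ (sym (norm-pow N₁ (suc w) refl refl cs)) (Ex-mono≡ cs) ⟩
    norm (act {k}) N₁ cs * Ex act cs (V₁ []) s ≤⟨ Ex-super act InvT InvT-act N₁ V₁ V₁-step cs s h ⟩
    k ^ length cs * (w ^ m * total τ)    ≤⟨ *-monoʳ-≤ (k ^ length cs) (*-monoʳ-≤ (w ^ m) (total-≤ τ h)) ⟩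
    k ^ length cs * (w ^ m * (k * F))    ≡⟨ l₂ (k ^ length cs) (w ^ m) (k * F) ⟩
    w ^ m * (k ^ length cs * (k * F))    ∎)
    where
    open ≤-Reasoning
    m E : ℕ
    m = nsort cs
    X : St → ℕ
    X s = total (proj₂ (proj₂ s))
    E = Ex act cs (λ s → le T (X s)) s
    Ex-mono≡ : ∀ cs → Ex act cs X s ≡ Ex act cs (V₁ []) s
    Ex-mono≡ cs = ≤-antisym (Ex-mono act cs (λ s → ≤-reflexive (sym (+-identityʳ (X s)))) s) (Ex-mono act cs (λ s → ≤-reflexive (+-identityʳ (X s))) s)
    1≤w : 1 ≤ w
    1≤w = m+n≤o⇒m≤o∸n 1 (≤-trans (m≤m+n 2 3) (*-monoʳ-≤ 5 1≤k))
    ratio : 2 ^ a * w ^ m ≤ suc w ^ m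
    ratio with m≤n⇒∃[o]m+o≡n (≤-trans (*-monoˡ-≤ a (≤-trans (n≤1+n w) (≤-reflexive (sym 5k≡)))) ns≥)
    ... | r , eq = subst (λ e → 2 ^ a * w ^ e ≤ suc w ^ e) eq (double-pow w a r 1≤w)
    l₁ : ∀ a b c → a * (b * c) ≡ b * a * c
    l₁ = solve-∀
    l₂ : ∀ a b c → a * (b * c) ≡ b * (a * c)
    l₂ = solve-∀

  -- After the decay is anticipated, every initial factor is at most 1 + 2 ^ (- a), while a final
  -- total of c α forces a product of at least 2 ^ c by `Π≥2^`. The gain counts units of α, which
  -- suits small scales.
  large-deviation : ∀ a c cs s → InvT s → 8 * k * a ≤ nsort cs →
                 (2 ^ a) ^ k * (2 ^ c * Ex act cs (λ s → le (c * α) (total (proj₂ (proj₂ s)))) s) ≤ k ^ length cs * suc (2 ^ a) ^ k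
  large-deviation a c cs s@(π , σ , τ) h ns≥ = *-cancelˡ-≤ ((g ^ m * α) ^ k) {{m^n≢0 _ k {{m*n≢0 _ _ {{m^n≢0 g m}} {{>-nonZero 1≤α}}}}}} (begin
    (g ^ m * α) ^ k * (C ^ k * (2 ^ c * E))         ≡⟨ cong (_* (C ^ k * (2 ^ c * E))) gα ⟩
    (g ^ k) ^ m * α ^ k * (C ^ k * (2 ^ c * E))      ≡⟨ l₁ ((g ^ k) ^ m) (α ^ k) (C ^ k) (2 ^ c) E ⟩
    C ^ k * ((g ^ k) ^ m * (2 ^ c * α ^ k * E))      ≡⟨ cong (λ t → C ^ k * ((g ^ k) ^ m * t)) (Ex-* act cs (2 ^ c * α ^ k) _ s) ⟨
    C ^ k * ((g ^ k) ^ m * Ex act cs (λ s → 2 ^ c * α ^ k * le (c * α) (X s)) s)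
      ≤⟨ *-monoʳ-≤ (C ^ k) (*-monoʳ-≤ ((g ^ k) ^ m) (Ex-mono-inv act InvT InvT-act cs (λ s h → le-markov {c * α} (end s h)) s h)) ⟩
    C ^ k * ((g ^ k) ^ m * Ex act cs (V₂ []) s)      ≡⟨ cong (λ t → C ^ k * (t * Ex act cs (V₂ []) s)) (norm-pow N₂ (g ^ k) refl refl cs) ⟨
    C ^ k * (norm (act {k}) N₂ cs * Ex act cs (V₂ []) s) ≤⟨ *-monoʳ-≤ (C ^ k) (Ex-super act InvT InvT-act N₂ V₂ V₂-step cs s h) ⟩
    C ^ k * (k ^ length cs * V₂ cs s)               ≡⟨ l₂ (C ^ k) (k ^ length cs) _ ⟩
    k ^ length cs * (C ^ k * V₂ cs s)               ≤⟨ *-monoʳ-≤ (k ^ length cs) initial ⟩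
    k ^ length cs * ((g ^ m * α) ^ k * suc C ^ k)   ≡⟨ l₂ (k ^ length cs) ((g ^ m * α) ^ k) (suc C ^ k) ⟩
    (g ^ m * α) ^ k * (k ^ length cs * suc C ^ k)   ∎)
    where
    open ≤-Reasoning
    g m C E : ℕ
    g = suc (8 * k)
    m = nsort cs
    C = 2 ^ a
    X : St → ℕ
    X s = total (proj₂ (proj₂ s))
    E = Ex act cs (λ s → le (c * α) (X s)) s
    gα : (g ^ m * α) ^ k ≡ (g ^ k) ^ m * α ^ k
    gα = trans (^-distribʳ-* k (g ^ m) α) (cong (_* α ^ k) (trans (^-*-assoc g m k) (trans (cong (g ^_) (*-comm m k)) (sym (^-*-assoc g k m)))))
    end : ∀ s → InvT s → c * α ≤ X s → 2 ^ c * α ^ k ≤ V₂ [] s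
    end (π , σ , τ) h le = *-cancelˡ-≤ α {{>-nonZero 1≤α}} (begin
      α * (2 ^ c * α ^ k)              ≡⟨ l₃ α (2 ^ c) (α ^ k) ⟩
      2 ^ c * (α + 0) * α ^ k          ≤⟨ Π≥2^ α 1≤α k (λ i → profile (suc i) τ) (λ i i<k → ≤-trans (proj₂ h i i<k) (m≤m+n F _)) c 0 z≤n (subst (_≤ total τ) (sym (+-identityʳ (c * α))) le) ⟩
      α * Π< k (λ i → α + profile (suc i) τ) ≡⟨ cong (α *_) (Π-cong k (λ i _ → sym (cong₂ _+_ (+-identityʳ α) (+-identityʳ _)))) ⟩
      α * V₂ [] (π , σ , τ)            ∎)
      where
      l₃ : ∀ a t b → a * (t * b) ≡ t * (a + 0) * b
      l₃ = solve-∀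
    ratio : C * (8 * k) ^ m ≤ g ^ m
    ratio with m≤n⇒∃[o]m+o≡n ns≥
    ... | r , eq = subst (λ e → 2 ^ a * (8 * k) ^ e ≤ g ^ e) eq (double-pow (8 * k) a r (*-mono-≤ {1} {8} (s≤s z≤n) 1≤k))
    initial : C ^ k * V₂ cs s ≤ (g ^ m * α) ^ k * suc C ^ k
    initial = begin
      C ^ k * V₂ cs s                  ≡⟨ cong (_* V₂ cs s) (Π-const k C) ⟨
      Π< k (λ _ → C) * V₂ cs s         ≡⟨ Π-* k (λ _ → C) _ ⟨
      Π< k (λ i → C * (g ^ m * α + (8 * k) ^ m * profile (suc i) τ)) ≤⟨ Π-mono k (λ i i<k → term (profile (suc i) τ) (proj₂ h i i<k)) ⟩
      Π< k (λ _ → g ^ m * α * suc C)   ≡⟨ Π-const k _ ⟩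
      (g ^ m * α * suc C) ^ k          ≡⟨ ^-distribʳ-* k (g ^ m * α) (suc C) ⟩
      (g ^ m * α) ^ k * suc C ^ k      ∎
      where
      term : ∀ f → f ≤ F → C * (g ^ m * α + (8 * k) ^ m * f) ≤ g ^ m * α * suc C
      term f f≤ = begin
        C * (g ^ m * α + (8 * k) ^ m * f)         ≡⟨ l₄ C (g ^ m * α) ((8 * k) ^ m) f ⟩
        C * (g ^ m * α) + C * (8 * k) ^ m * f     ≤⟨ +-monoʳ-≤ (C * (g ^ m * α)) (*-mono-≤ ratio (≤-trans f≤ (m≤m+n F _))) ⟩
        C * (g ^ m * α) + g ^ m * α               ≡⟨ l₅ C (g ^ m * α) ⟩
        g ^ m * α * suc C                         ∎
        where
        l₄ : ∀ C x y f → C * (x + y * f) ≡ C * x + C * y * f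
        l₄ = solve-∀
        l₅ : ∀ C x → C * x + x ≡ x * (1 + C)
        l₅ = solve-∀
    l₁ : ∀ x y c t e → (x * y) * (c * (t * e)) ≡ c * (x * (t * y * e))
    l₁ = solve-∀
    l₂ : ∀ x y t → x * (y * t) ≡ y * (x * t)
    l₂ = solve-∀

-- Counting lemmas

n<2^n : ∀ n → n < 2 ^ n
n<2^n zero    = s≤s z≤n
n<2^n (suc n) = subst (suc (suc n) ≤_) (cong (2 ^ n +_) (sym (+-identityʳ _))) (+-mono-≤ (m^n>0 2 n) (n<2^n n))

val≤k : ∀ {k} (π : Permutation′ (suc k)) x → val π x ≤ k
val≤k {k} π x with x <? suc k
... | yes x<n = ≤-pred (val<n π x x<n)
... | no  x≮n = subst (_≤ k) (sym (ext-out (λ i → toℕ (π ⟨$⟩ʳ i)) x (≮⇒≥ x≮n))) z≤n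

interval-≥ : ∀ N x v → v ≤ N → v ∸ x ≤ Σ< N (λ s → le x s * le (suc s) v)
interval-≥ N       x       zero    _       = ≤-trans (≤-reflexive (0∸n≡0 x)) z≤n
interval-≥ (suc N) zero    (suc v) (s≤s h) = s≤s (interval-≥ N zero v h)
interval-≥ (suc N) (suc x) (suc v) (s≤s h) = interval-≥ N x v h

Σ-le-≤ : ∀ N a → Σ< N (λ s → le s a) ≤ suc a
Σ-le-≤ zero    a       = z≤n
Σ-le-≤ (suc N) zero    = s≤s (≤-reflexive (trans (Σ-const N 0) (*-zeroʳ N)))
Σ-le-≤ (suc N) (suc a) = s≤s (Σ-le-≤ N a)

Σ-le-∸ : ∀ N a b → Σ< N (λ s → le s a ∸ le s b) ≤ a ∸ b
Σ-le-∸ zero    a       b       = z≤n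
Σ-le-∸ (suc N) zero    b       = ≤-trans (≤-reflexive (trans (Σ-cong N (λ s _ → 0∸n≡0 (le (suc s) b))) (trans (Σ-const N 0) (*-zeroʳ N)))) z≤n
Σ-le-∸ (suc N) (suc a) zero    = Σ-le-≤ N a
Σ-le-∸ (suc N) (suc a) (suc b) = Σ-le-∸ N a b

Σ-below : ∀ N J (g : ℕ → ℕ) → Σ< N (λ s → le (suc s) J * g s) ≤ Σ< J g
Σ-below zero    J       g = z≤n
Σ-below (suc N) zero    g = ≤-reflexive (trans (Σ-const N 0) (*-zeroʳ N))
Σ-below (suc N) (suc J) g = +-mono-≤ (≤-reflexive (+-identityʳ (g 0))) (Σ-below N J (λ s → g (suc s)))

Σ-le-count : ∀ n s → s ≤ n → Σ< n (λ v → le s v) + s ≡ n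
Σ-le-count n       zero    _       = trans (+-identityʳ _) (trans (Σ-const n 1) (*-identityʳ n))
Σ-le-count (suc n) (suc s) (s≤s h) = trans (+-suc _ s) (cong suc (Σ-le-count n s h))

Σ-le-shift : ∀ s A j → Σ< j (λ x → le s (x + A)) ≤ (j + A) ∸ s
Σ-le-shift s A zero    = z≤n
Σ-le-shift s A (suc j) = ≤-trans (≤-reflexive (Σ-last j _)) go
  where
  go : Σ< j (λ x → le s (x + A)) + le s (j + A) ≤ suc (j + A) ∸ s
  go with s ≤? j + A
  ... | yes s≤ = subst (Σ< j (λ x → le s (x + A)) + le s (j + A) ≤_) (trans (+-comm (j + A ∸ s) 1) (sym (+-∸-assoc 1 s≤)))
                   (+-mono-≤ (Σ-le-shift s A j) (le≤1 s (j + A)))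
  ... | no  s≰ = subst (_≤ suc (j + A) ∸ s) (sym (trans (cong (Σ< j (λ x → le s (x + A)) +_) (le-false (≰⇒> s≰))) (+-identityʳ _)))
                   (≤-trans (Σ-le-shift s A j) (∸-monoˡ-≤ s (n≤1+n (j + A))))

∸-exchange : ∀ a d g r → (a ∸ d) + ((a + g) ∸ (d + r)) ≤ (a ∸ (d + r)) + ((a + g) ∸ d)
∸-exchange zero    d       g r = subst₂ (λ u w → u + (g ∸ (d + r)) ≤ w + (g ∸ d)) (sym (0∸n≡0 d)) (sym (0∸n≡0 (d + r))) (∸-monoʳ-≤ g (m≤m+n d r))
∸-exchange (suc a) zero    g r = begin
  suc a + (suc a + g ∸ r)       ≤⟨ +-monoʳ-≤ (suc a) (m≤n+o⇒m∸n≤o (suc a + g) r (≤-trans (+-monoˡ-≤ g (m≤n+m∸n (suc a) r)) (≤-reflexive (+-assoc r _ g)))) ⟩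
  suc a + ((suc a ∸ r) + g)     ≡⟨ lem (suc a) (suc a ∸ r) g ⟩
  (suc a ∸ r) + (suc a + g)     ∎
  where
  open ≤-Reasoning
  lem : ∀ a b c → a + (b + c) ≡ b + (a + c)
  lem = solve-∀
∸-exchange (suc a) (suc d) g r = ∸-exchange a d g r

-- The positive part is convex in the difference, so pairing smaller with smaller and larger with
-- larger cannot increase the sum.
∸-⊓⊔ : ∀ a b c d → ((a ⊓ b) ∸ (c ⊓ d)) + ((a ⊔ b) ∸ (c ⊔ d)) ≤ (a ∸ c) + (b ∸ d)
∸-⊓⊔ a b c d with ≤-total a b | ≤-total c d
... | inj₁ p | inj₁ q rewrite m≤n⇒m⊓n≡m p | m≤n⇒m⊔n≡n p | m≤n⇒m⊓n≡m q | m≤n⇒m⊔n≡n q = ≤-refl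
... | inj₂ p | inj₂ q rewrite m≥n⇒m⊓n≡n p | m≥n⇒m⊔n≡m p | m≥n⇒m⊓n≡n q | m≥n⇒m⊔n≡m q = ≤-reflexive (+-comm (b ∸ d) (a ∸ c))
... | inj₁ p | inj₂ q rewrite m≤n⇒m⊓n≡m p | m≤n⇒m⊔n≡n p | m≥n⇒m⊓n≡n q | m≥n⇒m⊔n≡m q with m≤n⇒∃[o]m+o≡n p | m≤n⇒∃[o]m+o≡n q
...   | g , refl | r , refl = ∸-exchange a d g r
∸-⊓⊔ a b c d | inj₂ p | inj₁ q rewrite m≥n⇒m⊓n≡n p | m≥n⇒m⊔n≡m p | m≤n⇒m⊓n≡m q | m≤n⇒m⊔n≡n q with m≤n⇒∃[o]m+o≡n p | m≤n⇒∃[o]m+o≡n q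
...   | g , refl | r , refl = ≤-trans (∸-exchange b c g r) (≤-reflexive (+-comm (b ∸ (c + r)) _))

Σ-∸-srt : ∀ n i (σ τ : Seq) → suc i < n → Σ< n (λ x → srt i σ x ∸ srt i τ x) ≤ Σ< n (λ x → σ x ∸ τ x)
Σ-∸-srt n i σ τ i<n with Σ-pair n i (λ x → σ x ∸ τ x) i<n
... | r , eq = begin
  Σ< n (λ x → srt i σ x ∸ srt i τ x)   ≡⟨ eq _ (λ x p q → cong₂ _∸_ (srt-off i σ x p q) (srt-off i τ x p q)) ⟩
  r + ((srt i σ i ∸ srt i τ i) + (srt i σ (suc i) ∸ srt i τ (suc i)))
    ≡⟨ cong (r +_) (cong₂ _+_ (cong₂ _∸_ (srt-lo i σ) (srt-lo i τ)) (cong₂ _∸_ (srt-hi i σ) (srt-hi i τ))) ⟩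
  r + (((σ i ⊓ σ (suc i)) ∸ (τ i ⊓ τ (suc i))) + ((σ i ⊔ σ (suc i)) ∸ (τ i ⊔ τ (suc i))))
    ≤⟨ +-monoʳ-≤ r (∸-⊓⊔ (σ i) (σ (suc i)) (τ i) (τ (suc i))) ⟩
  r + ((σ i ∸ τ i) + (σ (suc i) ∸ τ (suc i))) ≡⟨ eq _ (λ _ _ _ → refl) ⟨
  Σ< n (λ x → σ x ∸ τ x)               ∎
  where open ≤-Reasoning

Σ-srt : ∀ n i (σ : Seq) → suc i < n → Σ< n (srt i σ) ≡ Σ< n σ
Σ-srt n i σ i<n with Σ-pair n i σ i<n
... | r , eq = trans (eq _ (srt-off i σ)) (trans (cong (r +_) (trans (cong₂ _+_ (srt-lo i σ) (srt-hi i σ)) (⊓⊔ (σ i) (σ (suc i))))) (sym (eq σ (λ _ _ _ → refl))))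
  where
  ⊓⊔ : ∀ a b → (a ⊓ b) + (a ⊔ b) ≡ a + b
  ⊓⊔ a b with ≤-total a b
  ... | inj₁ p rewrite m≤n⇒m⊓n≡m p | m≤n⇒m⊔n≡n p = refl
  ... | inj₂ p rewrite m≥n⇒m⊓n≡n p | m≥n⇒m⊔n≡m p = +-comm b a

∣-∣-∸ : ∀ a b → ∣ a - b ∣ ≡ (a ∸ b) + (b ∸ a)
∣-∣-∸ zero    b       = cong (_+ b) (sym (0∸n≡0 b))
∣-∣-∸ (suc a) zero    = cong suc (sym (+-identityʳ a))
∣-∣-∸ (suc a) (suc b) = ∣-∣-∸ a b

∸-swap : ∀ a b → a + (b ∸ a) ≡ b + (a ∸ b)
∸-swap zero    b       = sym (trans (cong (b +_) (0∸n≡0 b)) (+-identityʳ b))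
∸-swap (suc a) zero    = cong suc (+-identityʳ a)
∸-swap (suc a) (suc b) = cong suc (∸-swap a b)

-- The point of the interval [x - A, x + A], cut off at 0, that is nearest to v.
clamp : ℕ → ℕ → ℕ → ℕ
clamp A x v = (x ∸ A) ⊔ (v ⊓ (x + A))

clamp-≤ : ∀ A x v → clamp A x v ≤ x + A
clamp-≤ A x v = ⊔-lub (≤-trans (m∸n≤m x A) (m≤m+n x A)) (m⊓n≤n v (x + A))

clamp-≥ : ∀ A x v → x ∸ A ≤ clamp A x v
clamp-≥ A x v = m≤m⊔n (x ∸ A) _

clamp-dist : ∀ A x v → (clamp A x v ∸ v) + (v ∸ clamp A x v) ≤ ∣ v - x ∣ ∸ A
clamp-dist A x v with ≤-total v (x + A)
... | inj₂ hi rewrite m≥n⇒m⊓n≡n hi | m≤n⇒m⊔n≡n (≤-trans (m∸n≤m x A) (m≤m+n x A)) | m≤n⇒m∸n≡0 hi | sym (∸-+-assoc v x A) =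
  ∸-monoˡ-≤ A (≤-trans (m≤m+n (v ∸ x) (x ∸ v)) (≤-reflexive (sym (∣-∣-∸ v x))))
... | inj₁ lo rewrite m≤n⇒m⊓n≡m lo with ≤-total (x ∸ A) v
...   | inj₁ p rewrite m≤n⇒m⊔n≡n p | n∸n≡0 v = z≤n
...   | inj₂ p rewrite m≥n⇒m⊔n≡m p | m≤n⇒m∸n≡0 p | +-identityʳ (x ∸ A ∸ v) | ∸-+-assoc x A v | +-comm A v | sym (∸-+-assoc x v A) =
  ∸-monoˡ-≤ A (≤-trans (m≤n+m (x ∸ v) (v ∸ x)) (≤-reflexive (sym (∣-∣-∸ v x))))

far : ∀ {n} → ℕ → Permutation′ n → ℕ
far {n} A π = Σ< n (λ x → ∣ val π x - x ∣ ∸ A)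

-- On the diagonal j = s the tilt times 4 ^ s is at least 2 ^ (2n), because m ≤ s, and 4 ^ (e + 1) -
-- 2 ≥ e + 1 handles the rest. The number s - m is the height there in a sorted sequence with m
-- entries below s.
pot-diag : ∀ n m s τ → m ≤ s → s ≤ n → 2 ^ (2 * n) * (height s s τ ∸ (s ∸ m)) ≤ pot n m s s τ
pot-diag n m s τ m≤s s≤n with m≤n⇒∃[o]m+o≡n m≤s
... | d , refl rewrite m+n∸m≡n m d with height (m + d) (m + d) τ ≤? d
...   | yes h≤d rewrite m≤n⇒m∸n≡0 h≤d | *-zeroʳ (2 ^ (2 * n)) = z≤n
...   | no  h≰d with m≤n⇒∃[o]m+o≡n (≰⇒> h≰d)
...     | e , eq rewrite sym eq = begin
  2 ^ (2 * n) * (suc d + e ∸ d)                ≡⟨ cong (2 ^ (2 * n) *_) (trans (cong (_∸ d) (sym (+-suc d e))) (m+n∸m≡n d (suc e))) ⟩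
  2 ^ (2 * n) * suc e                          ≤⟨ *-monoˡ-≤ (suc e) (^-monoʳ-≤ 2 expo) ⟩
  2 ^ (g + 2 * (m + d)) * suc e                ≡⟨ cong (_* suc e) (^-distribˡ-+-* 2 g _) ⟩
  2 ^ g * 2 ^ (2 * (m + d)) * suc e            ≡⟨ cong (λ t → 2 ^ g * t * suc e) (sym (^-*-assoc 2 2 (m + d))) ⟩
  2 ^ g * 4 ^ (m + d) * suc e                  ≡⟨ *-assoc (2 ^ g) _ _ ⟩
  2 ^ g * (4 ^ (m + d) * suc e)                ≤⟨ *-monoʳ-≤ (2 ^ g) (m+n≤o⇒m≤o∸n (4 ^ (m + d) * suc e) core) ⟩
  2 ^ g * (4 ^ (m + (suc d + e)) ∸ (4 ^ m + 4 ^ (m + d))) ∎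
  where
  open ≤-Reasoning
  g = 2 * n ∸ (m + (m + d))
  expo : 2 * n ≤ g + 2 * (m + d)
  expo = begin
    2 * n                            ≤⟨ m≤n+m∸n (2 * n) (m + (m + d)) ⟩
    m + (m + d) + g                  ≤⟨ m≤m+n _ d ⟩
    m + (m + d) + g + d              ≡⟨ lem m d g ⟩
    g + 2 * (m + d)                  ∎
    where
    lem : ∀ m d g → m + (m + d) + g + d ≡ g + 2 * (m + d)
    lem = solve-∀
  four : ∀ e → suc e + 2 ≤ 4 * 4 ^ e
  four zero    = s≤s (s≤s (s≤s z≤n))
  four (suc e) = ≤-trans (s≤s (four e)) (+-mono-≤ (≤-trans (m^n>0 4 e) (m≤m+n (4 ^ e) (3 * 4 ^ e))) (m≤m+n (4 ^ suc e) (2 * 4 ^ suc e)))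
  core : 4 ^ (m + d) * suc e + (4 ^ m + 4 ^ (m + d)) ≤ 4 ^ (m + (suc d + e))
  core = begin
    4 ^ (m + d) * suc e + (4 ^ m + 4 ^ (m + d))        ≤⟨ +-monoʳ-≤ (4 ^ (m + d) * suc e) (+-monoˡ-≤ _ (^-monoʳ-≤ 4 (m≤m+n m d))) ⟩
    4 ^ (m + d) * suc e + (4 ^ (m + d) + 4 ^ (m + d))  ≡⟨ lem (4 ^ (m + d)) e ⟩
    4 ^ (m + d) * (suc e + 2)                          ≤⟨ *-monoʳ-≤ (4 ^ (m + d)) (four e) ⟩
    4 ^ (m + d) * 4 ^ suc e                            ≡⟨ ^-distribˡ-+-* 4 (m + d) (suc e) ⟨
    4 ^ (m + d + suc e)                                ≡⟨ cong (4 ^_) (trans (+-assoc m d (suc e)) (cong (m +_) (+-suc d e))) ⟩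
    4 ^ (m + (suc d + e))                              ∎
    where
    lem : ∀ a e → a * (1 + e) + (a + a) ≡ a * ((1 + e) + 2)
    lem = solve-∀

-- One window: coupling with pure sorting

height-≤j : ∀ s j τ → height s j τ ≤ j
height-≤j s j τ = ≤-trans (Σ-mono j (λ x _ → le≤1 s (τ x))) (≤-reflexive (trans (Σ-const j 1) (*-identityʳ j)))

module Window (k : ℕ) (1≤k : 1 ≤ k) (A : ℕ) (π : Permutation′ (suc k)) where
  n F : ℕ
  n = suc k
  F = 2 ^ (2 * n) * 2 ^ (7 * A)

  τ₀ : Seq
  τ₀ x = clamp A x (val π x)

  -- The number of entries of `τ₀` below s, capped by s. Clamping destroys the permutation property,
  -- so this number can differ from s; the cap supplies m ≤ s for `pot-diag`.
  M : ℕ → ℕ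
  M s = s ⊓ (n ∸ height s n τ₀)

  M≤ : ∀ s → M s ≤ suc k
  M≤ s = ≤-trans (m⊓n≤n s _) (m∸n≤m n (height s n τ₀))

  1≤F : 1 ≤ F
  1≤F = *-mono-≤ (m^n>0 2 (2 * n)) (m^n>0 2 (7 * A))

  open Sorting k 1≤k M M≤ F 1≤F public hiding (n)

  room : ∀ s → M s + height s n τ₀ ≤ n
  room s = ≤-trans (+-monoˡ-≤ _ (m⊓n≤n s (n ∸ height s n τ₀))) (≤-reflexive (m∸n+n≡m (height-≤j s n τ₀)))

  height-left : ∀ s j → j + A ≤ s → height s j τ₀ ≡ 0
  height-left s j le = trans (Σ-cong j (λ x x<j → le-false (≤-<-trans (clamp-≤ A x (val π x)) (<-≤-trans (+-monoˡ-< A x<j) le))))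
                             (trans (Σ-const j 0) (*-zeroʳ j))

  height-mid : ∀ s j → height s j τ₀ ≤ (j + A) ∸ s
  height-mid s j = ≤-trans (Σ-mono j (λ x _ → le-mono {s} {τ₀ x} {s} {x + A} (λ h → ≤-trans h (clamp-≤ A x (val π x))))) (Σ-le-shift s A j)

  height-right : ∀ s j r → s + A ≤ j → height s j τ₀ + r ≤ height s (j + r) τ₀
  height-right s j zero    h = ≤-reflexive (trans (+-identityʳ _) (cong (λ i → height s i τ₀) (sym (+-identityʳ j))))
  height-right s j (suc r) h = begin
    height s j τ₀ + suc r               ≡⟨ trans (+-suc _ r) (+-comm 1 (height s j τ₀ + r)) ⟩
    height s j τ₀ + r + 1               ≤⟨ +-mono-≤ (height-right s j r h) (≤-reflexive (sym (le-true one))) ⟩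
    height s (j + r) τ₀ + le s (τ₀ (j + r)) ≡⟨ Σ-last (j + r) (λ x → le s (τ₀ x)) ⟨
    height s (suc (j + r)) τ₀           ≡⟨ cong (λ i → height s i τ₀) (+-suc j r) ⟨
    height s (j + suc r) τ₀             ∎
    where
    open ≤-Reasoning
    one : s ≤ τ₀ (j + r)
    one = ≤-trans (m+n≤o⇒m≤o∸n s (≤-trans h (m≤m+n j r))) (clamp-≥ A (j + r) (val π (j + r)))

  -- Clamping confines the disorder to |s - j| < A. To the left the height is 0, to the right every
  -- later position counts, so that M s + height ≤ j; in both cases the truncation yields 0. Inside,
  -- height ≤ 2A and M s ≤ j + A give the exponent 2n + 5A.
  pot-start : ∀ s j → j ≤ n → pot n (M s) s j τ₀ ≤ 2 ^ (2 * n) * 2 ^ (5 * A) * (le (suc s) (j + A) * le (suc j) (s + A))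
  pot-start s j j≤n with suc s ≤? j + A | suc j ≤? s + A
  ... | no  p | _ rewrite height-left s j (≤-pred (≰⇒> p)) | +-identityʳ (M s) | m≤n⇒m∸n≡0 (m≤m+n (4 ^ M s) (4 ^ j)) | *-zeroʳ (2 ^ (2 * n ∸ (M s + j))) = z≤n
  ... | yes _ | no  q with m≤n⇒∃[o]m+o≡n j≤n
  ...   | r , eq = subst (_≤ 2 ^ (2 * n) * 2 ^ (5 * A) * (le (suc s) (j + A) * le (suc j) (s + A)))
      (sym (trans (cong (2 ^ (2 * n ∸ (M s + j)) *_) (m≤n⇒m∸n≡0 (≤-trans (^-monoʳ-≤ 4 small) (m≤n+m (4 ^ j) (4 ^ M s))))) (*-zeroʳ (2 ^ (2 * n ∸ (M s + j)))))) z≤n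
      where
      small : M s + height s j τ₀ ≤ j
      small = +-cancelʳ-≤ r _ _ (begin
        M s + height s j τ₀ + r      ≡⟨ +-assoc (M s) _ r ⟩
        M s + (height s j τ₀ + r)    ≤⟨ +-monoʳ-≤ (M s) (height-right s j r (≤-pred (≰⇒> q))) ⟩
        M s + height s (j + r) τ₀    ≡⟨ cong (λ i → M s + height s i τ₀) eq ⟩
        M s + height s n τ₀          ≤⟨ room s ⟩
        n                            ≡⟨ eq ⟨
        j + r                        ∎)
        where open ≤-Reasoning
  pot-start s j j≤n | yes p | yes q rewrite le-true p | le-true q | *-identityʳ (2 ^ (2 * n) * 2 ^ (5 * A)) = begin
    2 ^ g * (4 ^ (M s + H) ∸ (4 ^ M s + 4 ^ j))   ≤⟨ *-monoʳ-≤ (2 ^ g) (m∸n≤m (4 ^ (M s + H)) (4 ^ M s + 4 ^ j)) ⟩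
    2 ^ g * 4 ^ (M s + H)                         ≡⟨ cong (2 ^ g *_) (^-*-assoc 2 2 (M s + H)) ⟩
    2 ^ g * 2 ^ (2 * (M s + H))                   ≡⟨ ^-distribˡ-+-* 2 g _ ⟨
    2 ^ (g + 2 * (M s + H))                       ≤⟨ ^-monoʳ-≤ 2 expo ⟩
    2 ^ (2 * n + 5 * A)                           ≡⟨ ^-distribˡ-+-* 2 (2 * n) (5 * A) ⟩
    2 ^ (2 * n) * 2 ^ (5 * A)                     ∎
    where
    open ≤-Reasoning
    g H : ℕ
    g = 2 * n ∸ (M s + j)
    H = height s j τ₀
    Mj : M s ≤ j + A
    Mj = ≤-trans (m⊓n≤m s _) (<⇒≤ p)
    H≤ : H ≤ A + A
    H≤ = ≤-trans (height-mid s j) (m≤n+o⇒m∸n≤o (j + A) s (≤-trans (+-monoˡ-≤ A (<⇒≤ q)) (≤-reflexive (+-assoc s A A))))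
    fits : M s + j ≤ 2 * n
    fits = +-mono-≤ (M≤ s) (≤-trans j≤n (m≤m+n n 0))
    expo : g + 2 * (M s + H) ≤ 2 * n + 5 * A
    expo = begin
      g + 2 * (M s + H)                   ≡⟨ lem g (M s) H ⟩
      g + M s + M s + 2 * H               ≤⟨ +-mono-≤ (+-monoʳ-≤ (g + M s) Mj) (*-monoʳ-≤ 2 H≤) ⟩
      g + M s + (j + A) + 2 * (A + A)     ≡⟨ lem₂ g (M s) j A ⟩
      g + (M s + j) + 5 * A               ≡⟨ cong (_+ 5 * A) (m∸n+n≡m fits) ⟩
      2 * n + 5 * A                       ∎
      where
      lem : ∀ g m h → g + 2 * (m + h) ≡ g + m + m + 2 * h
      lem = solve-∀
      lem₂ : ∀ g m j A → g + m + (j + A) + 2 * (A + A) ≡ g + (m + j) + 5 * A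
      lem₂ = solve-∀

  -- At most 2A thresholds meet the band at a given site, and 2A ≤ 2 ^ (2A) turns 5A into the 7A of
  -- `F`.
  field-start : ∀ j → j ≤ n → profile j τ₀ ≤ F
  field-start j j≤n = begin
    Σ< n (λ s → pot n (M s) s j τ₀)               ≤⟨ Σ-mono n (λ s _ → pot-start s j j≤n) ⟩
    Σ< n (λ s → c * (le (suc s) (j + A) * le (suc j) (s + A))) ≡⟨ Σ-* n c (λ s → le (suc s) (j + A) * le (suc j) (s + A)) ⟩
    c * Σ< n (λ s → le (suc s) (j + A) * le (suc j) (s + A)) ≤⟨ *-monoʳ-≤ c (Σ-below n (j + A) (λ s → le (suc j) (s + A))) ⟩
    c * Σ< (j + A) (λ s → le (suc j) (s + A))     ≤⟨ *-monoʳ-≤ c (Σ-le-shift (suc j) A (j + A)) ⟩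
    c * ((j + A + A) ∸ suc j)                     ≤⟨ *-monoʳ-≤ c (m≤n+o⇒m∸n≤o (j + A + A) (suc j) (≤-trans (≤-reflexive (+-assoc j A A)) (n≤1+n _))) ⟩
    c * (A + A)                                   ≤⟨ *-monoʳ-≤ c (≤-trans (≤-reflexive (cong (A +_) (sym (+-identityʳ A)))) (<⇒≤ (n<2^n (2 * A)))) ⟩
    2 ^ (2 * n) * 2 ^ (5 * A) * 2 ^ (2 * A)       ≡⟨ trans (*-assoc (2 ^ (2 * n)) _ _) (cong (2 ^ (2 * n) *_) (trans (sym (^-distribˡ-+-* 2 (5 * A) (2 * A))) (cong (2 ^_) (lem A)))) ⟩
    F                                             ∎
    where
    open ≤-Reasoning
    c = 2 ^ (2 * n) * 2 ^ (5 * A)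
    lem : ∀ A → 5 * A + 2 * A ≡ 7 * A
    lem = solve-∀

  SInv₀ : SInv τ₀
  SInv₀ = (λ s _ → room s) , (λ j j<k → field-start (suc j) (s≤s (<⇒≤ j<k)))

  s₀ : St
  s₀ = π , val π , τ₀

  DInv : St → Set
  DInv (ρ , σ , τ) = (∀ x → σ x ≤ k) × (Σ< n σ ≡ Σ< n (λ x → x)) × (Σ< n (λ x → σ x ∸ τ x) ≤ Σ< n (λ x → val π x ∸ τ₀ x))

  DInv-act : ∀ c (i : Fin k) s → DInv s → DInv (act c i s)
  DInv-act srtK i (ρ , σ , τ) (h , e , d) = srt-≤ (toℕ i) σ h , trans (Σ-srt n (toℕ i) σ (s≤s (toℕ<n i))) e , ≤-trans (Σ-∸-srt n (toℕ i) σ τ (s≤s (toℕ<n i))) d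
  DInv-act mixK i s h = h

  DInv₀ : DInv s₀
  DInv₀ = val≤k π , Σ-reindex π (λ x v → v) , ≤-refl

  -- The shortfall s - M s is at most the number of entries that clamping lifts across the threshold
  -- s; over all s, an entry is counted at most as often as it is lifted.
  deficit : Σ< n (λ s → s ∸ M s) ≤ Σ< n (λ x → τ₀ x ∸ val π x)
  deficit = begin
    Σ< n (λ s → s ∸ M s)                                       ≤⟨ Σ-mono n per ⟩
    Σ< n (λ s → Σ< n (λ x → le s (τ₀ x) ∸ le s (val π x)))     ≡⟨ Σ-comm n n (λ s x → le s (τ₀ x) ∸ le s (val π x)) ⟩
    Σ< n (λ x → Σ< n (λ s → le s (τ₀ x) ∸ le s (val π x)))     ≤⟨ Σ-mono n (λ x _ → Σ-le-∸ n (τ₀ x) (val π x)) ⟩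
    Σ< n (λ x → τ₀ x ∸ val π x)                                ∎
    where
    open ≤-Reasoning
    per : ∀ s → s < n → s ∸ M s ≤ Σ< n (λ x → le s (τ₀ x) ∸ le s (val π x))
    per s s<n = m≤n+o⇒m∸n≤o s (M s) go
      where
      D = Σ< n (λ x → le s (τ₀ x) ∸ le s (val π x))
      hπ : height s n (val π) + s ≡ n
      hπ = trans (cong (_+ s) (Σ-reindex π (λ x v → le s v))) (Σ-le-count n s (<⇒≤ s<n))
      hτ : height s n τ₀ ≤ height s n (val π) + D
      hτ = ≤-trans (Σ-mono n (λ x _ → m≤n+m∸n (le s (τ₀ x)) (le s (val π x)))) (≤-reflexive (Σ-+ n (λ x → le s (val π x)) (λ x → le s (τ₀ x) ∸ le s (val π x))))
      go : s ≤ M s + D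
      go with ≤-total s (n ∸ height s n τ₀)
      ... | inj₁ p rewrite m≤n⇒m⊓n≡m p = m≤m+n s D
      ... | inj₂ p rewrite m≥n⇒m⊓n≡n p = +-cancelˡ-≤ (height s n τ₀) _ _ (begin
        height s n τ₀ + s                                ≤⟨ +-monoˡ-≤ s hτ ⟩
        height s n (val π) + D + s                       ≡⟨ lem (height s n (val π)) D s ⟩
        height s n (val π) + s + D                       ≡⟨ cong (_+ D) hπ ⟩
        n + D                                            ≡⟨ cong (_+ D) (m+[n∸m]≡n (height-≤j s n τ₀)) ⟨
        height s n τ₀ + (n ∸ height s n τ₀) + D          ≡⟨ +-assoc (height s n τ₀) _ D ⟩
        height s n τ₀ + (n ∸ height s n τ₀ + D)          ∎)
        where
        lem : ∀ a b c → a + b + c ≡ a + c + b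
        lem = solve-∀

  -- An entry above its position is counted by the diagonal height at each threshold s with x < s ≤
  -- σ x, since x is then among the first s positions.
  rise : ∀ σ → (∀ x → σ x ≤ k) → Σ< n (λ x → σ x ∸ x) ≤ Σ< n (λ s → height s s σ)
  rise σ h = begin
    Σ< n (λ x → σ x ∸ x)                                     ≤⟨ Σ-mono n (λ x _ → interval-≥ k x (σ x) (h x)) ⟩
    Σ< n (λ x → Σ< n (λ s → le (suc x) s * le s (σ x)))      ≡⟨ Σ-comm n n (λ x s → le (suc x) s * le s (σ x)) ⟩
    Σ< n (λ s → Σ< n (λ x → le (suc x) s * le s (σ x)))      ≤⟨ Σ-mono n (λ s _ → Σ-below n s (λ x → le s (σ x))) ⟩
    Σ< n (λ s → height s s σ)                                ∎
    where open ≤-Reasoning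

  height-compare : ∀ σ τ → Σ< n (λ s → height s s σ) ≤ Σ< n (λ s → height s s τ) + Σ< n (λ x → σ x ∸ τ x)
  height-compare σ τ = begin
    Σ< n (λ s → height s s σ)                  ≤⟨ Σ-mono n (λ s s<n → per s (<⇒≤ s<n)) ⟩
    Σ< n (λ s → height s s τ + Σ< n (λ x → le s (σ x) ∸ le s (τ x))) ≡⟨ Σ-+ n (λ s → height s s τ) (λ s → Σ< n (λ x → le s (σ x) ∸ le s (τ x))) ⟩
    Σ< n (λ s → height s s τ) + Σ< n (λ s → Σ< n (λ x → le s (σ x) ∸ le s (τ x)))
      ≤⟨ +-monoʳ-≤ (Σ< n (λ s → height s s τ)) (≤-trans (≤-reflexive (Σ-comm n n (λ s x → le s (σ x) ∸ le s (τ x)))) (Σ-mono n (λ x _ → Σ-le-∸ n (σ x) (τ x)))) ⟩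
    Σ< n (λ s → height s s τ) + Σ< n (λ x → σ x ∸ τ x) ∎
    where
    open ≤-Reasoning
    extend : ∀ j r (f : ℕ → ℕ) → Σ< j f ≤ Σ< (j + r) f
    extend zero    r f = z≤n
    extend (suc j) r f = +-monoʳ-≤ (f 0) (extend j r (λ x → f (suc x)))
    per : ∀ s → s ≤ n → height s s σ ≤ height s s τ + Σ< n (λ x → le s (σ x) ∸ le s (τ x))
    per s s≤n with m≤n⇒∃[o]m+o≡n s≤n
    ... | r , eq = ≤-trans (Σ-mono s (λ x _ → m≤n+m∸n (le s (σ x)) (le s (τ x))))
                  (≤-trans (≤-reflexive (Σ-+ s _ _)) (+-monoʳ-≤ (height s s τ)
                    (subst (λ N → Σ< s (λ x → le s (σ x) ∸ le s (τ x)) ≤ Σ< N (λ x → le s (σ x) ∸ le s (τ x))) eq (extend s r _))))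

  diagonal : ∀ τ → 2 ^ (2 * n) * Σ< n (λ s → height s s τ ∸ (s ∸ M s)) ≤ total τ
  diagonal τ = begin
    2 ^ (2 * n) * Σ< n (λ s → height s s τ ∸ (s ∸ M s))            ≡⟨ Σ-* n (2 ^ (2 * n)) (λ s → height s s τ ∸ (s ∸ M s)) ⟨
    2 ^ (2 * n) * (0 ∸ (0 ∸ M 0)) + Σ< k (λ i → 2 ^ (2 * n) * (height (suc i) (suc i) τ ∸ (suc i ∸ M (suc i))))
      ≡⟨ cong (_+ Σ< k (λ i → 2 ^ (2 * n) * (height (suc i) (suc i) τ ∸ (suc i ∸ M (suc i))))) (trans (cong (2 ^ (2 * n) *_) (0∸n≡0 (0 ∸ M 0))) (*-zeroʳ (2 ^ (2 * n)))) ⟩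
    Σ< k (λ i → 2 ^ (2 * n) * (height (suc i) (suc i) τ ∸ (suc i ∸ M (suc i))))
      ≤⟨ Σ-mono k (λ i i<k → ≤-trans (pot-diag n (M (suc i)) (suc i) τ (m⊓n≤m (suc i) _) (s≤s (<⇒≤ i<k)))
                                (Σ-term≤ n (λ s → pot n (M s) s (suc i) τ) (s≤s i<k))) ⟩
    total τ                                                        ∎
    where open ≤-Reasoning

  gap⁺ gap⁻ : ℕ → St → ℕ
  gap⁺ D (ρ , σ , τ) = Σ< n (λ x → (val ρ x ∸ σ x) ∸ D)
  gap⁻ D (ρ , σ , τ) = Σ< n (λ x → (σ x ∸ val ρ x) ∸ D)

  -- Three losses: the shortfall s - M s, the excess of heights over the sorted profile, and the
  -- distance from σ to τ. The first and the last are the upward and downward parts of the clamping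
  -- and together make up `far A π`.
  sorted-rise : ∀ T s → DInv s → total (proj₂ (proj₂ s)) < T * 2 ^ (2 * n) → Σ< n (λ x → proj₁ (proj₂ s) x ∸ x) ≤ far A π + T
  sorted-rise T (ρ , σ , τ) (h , e , d) t< = begin
    Σ< n (λ x → σ x ∸ x)                         ≤⟨ rise σ h ⟩
    Σ< n (λ s → height s s σ)                    ≤⟨ height-compare σ τ ⟩
    Σ< n (λ s → height s s τ) + Σ< n (λ x → σ x ∸ τ x) ≤⟨ +-mono-≤ (≤-trans (Σ-mono n (λ s _ → m≤n+m∸n (height s s τ) (s ∸ M s))) (≤-reflexive (Σ-+ n (λ s → s ∸ M s) (λ s → height s s τ ∸ (s ∸ M s))))) d ⟩
    Σ< n (λ s → s ∸ M s) + E + Σ< n (λ x → val π x ∸ τ₀ x) ≤⟨ +-monoˡ-≤ _ (+-mono-≤ deficit E≤) ⟩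
    Σ< n (λ x → τ₀ x ∸ val π x) + T + Σ< n (λ x → val π x ∸ τ₀ x) ≡⟨ lem (Σ< n (λ x → τ₀ x ∸ val π x)) T _ ⟩
    Σ< n (λ x → τ₀ x ∸ val π x) + Σ< n (λ x → val π x ∸ τ₀ x) + T ≡⟨ cong (_+ T) (Σ-+ n (λ x → τ₀ x ∸ val π x) (λ x → val π x ∸ τ₀ x)) ⟨
    Σ< n (λ x → (τ₀ x ∸ val π x) + (val π x ∸ τ₀ x)) + T ≤⟨ +-monoˡ-≤ T (Σ-mono n (λ x _ → clamp-dist A x (val π x))) ⟩
    far A π + T                                  ∎
    where
    open ≤-Reasoning
    E = Σ< n (λ s → height s s τ ∸ (s ∸ M s))
    E≤ : E ≤ T
    E≤ = *-cancelˡ-≤ (2 ^ (2 * n)) {{m^n≢0 2 (2 * n)}} (≤-trans (diagonal τ) (≤-trans (<⇒≤ t<) (≤-reflexive (*-comm T _))))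
    lem : ∀ a b c → a + b + c ≡ a + c + b
    lem = solve-∀

  -- Triangle inequality through σ, with the cut-off D charged only to the difference of the real
  -- permutation and σ. As σ has the same sum as the positions, its upward and downward
  -- displacements are equal in total, whence the factor 2.
  conclusion : ∀ D T s → DInv s → total (proj₂ (proj₂ s)) < T * 2 ^ (2 * n) →
               far D (proj₁ s) ≤ 2 * (far A π + T) + (gap⁺ D s + gap⁻ D s)
  conclusion D T s@(ρ , σ , τ) inv@(h , e , d) t< = begin
    Σ< n (λ x → ∣ val ρ x - x ∣ ∸ D)             ≤⟨ Σ-mono n (λ x _ → triangle (val ρ x) (σ x) x) ⟩
    Σ< n (λ x → ((σ x ∸ x) + (x ∸ σ x)) + (((val ρ x ∸ σ x) ∸ D) + ((σ x ∸ val ρ x) ∸ D)))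
      ≡⟨ trans (Σ-+ n (λ x → (σ x ∸ x) + (x ∸ σ x)) (λ x → ((val ρ x ∸ σ x) ∸ D) + ((σ x ∸ val ρ x) ∸ D)))
                 (cong₂ _+_ (Σ-+ n (λ x → σ x ∸ x) (λ x → x ∸ σ x)) (Σ-+ n (λ x → (val ρ x ∸ σ x) ∸ D) (λ x → (σ x ∸ val ρ x) ∸ D))) ⟩
    (U + Σ< n (λ x → x ∸ σ x)) + (gap⁺ D s + gap⁻ D s) ≡⟨ cong (λ t → (U + t) + (gap⁺ D s + gap⁻ D s)) balance ⟩
    (U + U) + (gap⁺ D s + gap⁻ D s)              ≤⟨ +-monoˡ-≤ _ (+-mono-≤ (sorted-rise T s inv t<) (≤-trans (sorted-rise T s inv t<) (≤-reflexive (sym (+-identityʳ _))))) ⟩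
    2 * (far A π + T) + (gap⁺ D s + gap⁻ D s)    ∎
    where
    open ≤-Reasoning
    U = Σ< n (λ x → σ x ∸ x)
    balance : Σ< n (λ x → x ∸ σ x) ≡ U
    balance = +-cancelˡ-≡ (Σ< n σ) _ _ (trans (sym (Σ-+ n σ (λ x → x ∸ σ x))) (trans (Σ-cong n (λ x _ → ∸-swap (σ x) x)) (trans (Σ-+ n (λ x → x) (λ x → σ x ∸ x)) (cong (_+ U) (sym e)))))
    triangle : ∀ p s x → ∣ p - x ∣ ∸ D ≤ ((s ∸ x) + (x ∸ s)) + (((p ∸ s) ∸ D) + ((s ∸ p) ∸ D))
    triangle p s x = m≤n+o⇒m∸n≤o ∣ p - x ∣ D (begin
      ∣ p - x ∣                        ≤⟨ ∣-∣-triangle p s x ⟩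
      ∣ p - s ∣ + ∣ s - x ∣            ≤⟨ +-mono-≤ near (≤-reflexive (∣-∣-∸ s x)) ⟩
      D + (((p ∸ s) ∸ D) + ((s ∸ p) ∸ D)) + ((s ∸ x) + (x ∸ s)) ≡⟨ lem D _ _ ⟩
      D + (((s ∸ x) + (x ∸ s)) + (((p ∸ s) ∸ D) + ((s ∸ p) ∸ D))) ∎)
      where
      lem : ∀ a b c → a + b + c ≡ a + (c + b)
      lem = solve-∀
      near : ∣ p - s ∣ ≤ D + (((p ∸ s) ∸ D) + ((s ∸ p) ∸ D))
      near with ≤-total p s
      ... | inj₁ q = ≤-trans (≤-reflexive (m≤n⇒∣m-n∣≡n∸m q)) (≤-trans (m≤n+m∸n (s ∸ p) D) (+-monoʳ-≤ D (m≤n+m _ ((p ∸ s) ∸ D))))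
      ... | inj₂ q = ≤-trans (≤-reflexive (m≤n⇒∣n-m∣≡n∸m q)) (≤-trans (m≤n+m∸n (p ∸ s) D) (+-monoʳ-≤ D (m≤m+n _ ((s ∸ p) ∸ D))))

-- One window: failure probability

actP : ∀ {k} → Kind → Fin k → Permutation′ (suc k) → Permutation′ (suc k)
actP srtK = sortStep
actP mixK = mixStep

Ex-proj : ∀ {k} cs (f : Permutation′ (suc k) → ℕ) s → Ex (act {k}) cs (λ s → f (proj₁ s)) s ≡ Ex actP cs f (proj₁ s)
Ex-proj []          f s = refl
Ex-proj {k} (srtK ∷ cs) f s@(π , σ , τ) = ΣF-cong {k} _ _ (λ i → Ex-proj cs f (act srtK i s))
Ex-proj {k} (mixK ∷ cs) f s@(π , σ , τ) = ΣF-cong {k} _ _ (λ i → Ex-proj cs f (act mixK i s))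

-- By Bernoulli's inequality 1 + (v + 1)/C ≤ (1 + 1/C) ^ (v + 1), and `half-pow` bounds powers of 1
-- + 1/C.
growth : ∀ C h v n m → 1 ≤ C → 2 * h ≤ suc C → suc v * n ≤ h * m → (C + suc v) ^ n ≤ 2 ^ m * C ^ n
growth C h v n m 1≤C 2h≤ vn≤ = *-cancelˡ-≤ ((C ^ v) ^ n) {{m^n≢0 _ n {{m^n≢0 C v {{>-nonZero 1≤C}}}}}} (begin
  (C ^ v) ^ n * (C + suc v) ^ n        ≡⟨ ^-distribʳ-* n (C ^ v) (C + suc v) ⟨
  (C ^ v * (C + suc v)) ^ n            ≤⟨ ^-monoˡ-≤ n (≤-trans (≤-reflexive (lem (C ^ v) C v)) (bernoulli C v)) ⟩
  (suc C ^ suc v) ^ n                  ≡⟨ ^-*-assoc (suc C) (suc v) n ⟩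
  suc C ^ (suc v * n)                  ≤⟨ half-pow C h m (suc v * n) 1≤C 2h≤ vn≤ ⟩
  2 ^ m * C ^ (suc v * n)              ≡⟨ cong (2 ^ m *_) (sym (^-*-assoc C (suc v) n)) ⟩
  2 ^ m * (C * C ^ v) ^ n              ≡⟨ cong (2 ^ m *_) (^-distribʳ-* n C (C ^ v)) ⟩
  2 ^ m * (C ^ n * (C ^ v) ^ n)        ≡⟨ lem₂ (2 ^ m) (C ^ n) ((C ^ v) ^ n) ⟩
  (C ^ v) ^ n * (2 ^ m * C ^ n)        ∎)
  where
  open ≤-Reasoning
  lem : ∀ c C v → c * (C + (1 + v)) ≡ C * c + (1 + v) * c
  lem = solve-∀
  lem₂ : ∀ a b c → a * (b * c) ≡ c * (a * b)
  lem₂ = solve-∀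

transfer : ∀ w n m S E K Z → 1 ≤ w → w ^ n * (2 ^ (m + S) * E) ≤ K * Z → Z ≤ 2 ^ m * w ^ n → 2 ^ S * E ≤ K
transfer w n m S E K Z 1≤w h g = *-cancelˡ-≤ (w ^ n * 2 ^ m) {{m*n≢0 _ _ {{m^n≢0 w n {{>-nonZero 1≤w}}}} {{m^n≢0 2 m}}}} (begin
  w ^ n * 2 ^ m * (2 ^ S * E)     ≡⟨ lem (w ^ n) (2 ^ m) (2 ^ S) E ⟩
  w ^ n * (2 ^ m * 2 ^ S * E)     ≡⟨ cong (λ t → w ^ n * (t * E)) (^-distribˡ-+-* 2 m S) ⟨
  w ^ n * (2 ^ (m + S) * E)       ≤⟨ h ⟩
  K * Z                           ≤⟨ *-monoʳ-≤ K g ⟩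
  K * (2 ^ m * w ^ n)             ≡⟨ lem₂ K (2 ^ m) (w ^ n) ⟩
  w ^ n * 2 ^ m * K               ∎)
  where
  open ≤-Reasoning
  lem : ∀ a b c d → a * b * (c * d) ≡ a * (b * c * d)
  lem = solve-∀
  lem₂ : ∀ a b c → a * (b * c) ≡ c * b * a
  lem₂ = solve-∀

-- With e = r / 16 + 1 one has r < 16 e and e ^ 16 ≤ 2 ^ r, and 16 * 16 ^ 6 = 2 ^ 28 ≤ 8 ^ 10. The
-- threshold 112 = 7 * 16 ensures e ≥ 8.
poly-exp : ∀ r → 112 ≤ r → 12 * suc r ^ 6 ≤ 2 ^ r
poly-exp r 112≤r = begin
  12 * suc r ^ 6                    ≤⟨ *-mono-≤ (m≤m+n 12 4) (^-monoˡ-≤ 6 r<) ⟩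
  16 * (16 * e) ^ 6                 ≡⟨ cong (16 *_) (^-distribʳ-* 6 16 e) ⟩
  16 * (16 ^ 6 * e ^ 6)             ≡⟨ *-assoc 16 (16 ^ 6) (e ^ 6) ⟨
  2 ^ 28 * e ^ 6                    ≤⟨ *-monoˡ-≤ (e ^ 6) (≤-trans (^-monoʳ-≤ 2 (m≤m+n 28 2)) (≤-trans (≤-reflexive (sym (^-*-assoc 2 3 10))) (^-monoˡ-≤ 10 8≤e))) ⟩
  e ^ 10 * e ^ 6                    ≡⟨ ^-distribˡ-+-* e 10 6 ⟨
  e ^ 16                            ≤⟨ ^-monoˡ-≤ 16 (n<2^n d) ⟩
  (2 ^ d) ^ 16                      ≡⟨ ^-*-assoc 2 d 16 ⟩
  2 ^ (d * 16)                      ≤⟨ ^-monoʳ-≤ 2 (≤-trans (m≤n+m (d * 16) (r % 16)) (≤-reflexive (sym (m≡m%n+[m/n]*n r 16)))) ⟩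
  2 ^ r                             ∎
  where
  open ≤-Reasoning
  d e : ℕ
  d = r / 16
  e = suc d
  r< : suc r ≤ 16 * e
  r< = ≤-trans (s≤s (≤-reflexive (m≡m%n+[m/n]*n r 16))) (≤-trans (+-monoˡ-≤ (d * 16) (m%n<n r 16)) (≤-reflexive (*-comm e 16)))
  8≤e : 8 ≤ e
  8≤e = s≤s (/-monoˡ-≤ 16 112≤r)

≤1-cases : ∀ {a b c d x y} → (x < a → y < b → c < d → ⊥) → 1 ≤ le a x + le b y + le d c
≤1-cases {a} {b} {c} {d} {x} {y} h with a ≤? x | b ≤? y | d ≤? c
... | yes p | _ | _ rewrite le-true p = s≤s z≤n
... | no _ | yes p | _ rewrite le-true p = ≤-trans (m≤n+m 1 (le a x)) (m≤m+n _ (le d c))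
... | no _ | no _ | yes p rewrite le-true p = m≤n+m 1 (le a x + le b y)
... | no p | no q | no r = ⊥-elim (h (≰⇒> p) (≰⇒> q) (≰⇒> r))

module WindowBound (k q : ℕ) (1≤k : 1 ≤ k) (1≤q : 1 ≤ q) (A u T m S w : ℕ) (π : Permutation′ (suc k)) (cs : List Kind) where
  private
    module Wi = Window k 1≤k A π
    module N⁺ = Noise (above k q) 1≤k 1≤q
    module N⁻ = Noise (below k q) 1≤k 1≤q
    n K D : ℕ
    n = suc k
    K = k ^ length cs
    D = 8 * (q * u)
    E⁺ E⁻ Eₛ : ℕ
    E⁺ = Ex act cs (λ s → le (q * (m + S)) (Wi.gap⁺ D s)) Wi.s₀
    E⁻ = Ex act cs (λ s → le (q * (m + S)) (Wi.gap⁻ D s)) Wi.s₀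
    Eₛ = Ex act cs (λ s → le (T * 2 ^ (2 * n)) (Wi.total (proj₂ (proj₂ s)))) Wi.s₀

  -- Three bad events: too much displacement above σ, too much below σ, too little sorting. Each is
  -- later shown to have probability at most 1 / (12 n^3).
  union : Ex actP cs (λ ρ → le (suc (2 * (far A π + T) + 2 * (q * (m + S)))) (far D ρ)) π ≤ E⁺ + E⁻ + Eₛ
  union = begin
    Ex actP cs (λ ρ → le y (far D ρ)) π             ≡⟨ Ex-proj cs (λ ρ → le y (far D ρ)) Wi.s₀ ⟨
    Ex act cs (λ s → le y (far D (proj₁ s))) Wi.s₀  ≤⟨ Ex-mono-inv act Wi.DInv Wi.DInv-act cs one Wi.s₀ Wi.DInv₀ ⟩
    Ex act cs (λ s → e⁺ s + e⁻ s + eₛ s) Wi.s₀      ≡⟨ trans (Ex-+ act cs (λ s → e⁺ s + e⁻ s) eₛ Wi.s₀) (cong (_+ Eₛ) (Ex-+ act cs e⁺ e⁻ Wi.s₀)) ⟩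
    E⁺ + E⁻ + Eₛ                                    ∎
    where
    open ≤-Reasoning
    y : ℕ
    y = suc (2 * (far A π + T) + 2 * (q * (m + S)))
    e⁺ e⁻ eₛ : Wi.St → ℕ
    e⁺ s = le (q * (m + S)) (Wi.gap⁺ D s)
    e⁻ s = le (q * (m + S)) (Wi.gap⁻ D s)
    eₛ s = le (T * 2 ^ (2 * n)) (Wi.total (proj₂ (proj₂ s)))
    one : ∀ s → Wi.DInv s → le y (far D (proj₁ s)) ≤ e⁺ s + e⁻ s + eₛ s
    one s inv = subst (_≤ e⁺ s + e⁻ s + eₛ s) (*-identityˡ _) (le-markov {y} {far D (proj₁ s)} {1} (λ bad →
      ≤1-cases {q * (m + S)} {q * (m + S)} (λ a b c → <⇒≱ bad (≤-trans (Wi.conclusion D T s inv c)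
        (+-monoʳ-≤ (2 * (far A π + T)) (+-mono-≤ (<⇒≤ a) (≤-trans (<⇒≤ b) (≤-reflexive (sym (+-identityʳ _))))))))))

  module _ (2w≤ : 2 * w ≤ suc (q * suc q * k)) (mixes : nmix cs ≤ w * (2 * u)) (1≤u : 1 ≤ u)
           (m≥ : (2 + q) * n ≤ 2 ^ (6 * u ∸ 1) * m) (S≥ : 12 * n ^ 3 ≤ 2 ^ S) where
    private
      C = 2 ^ (6 * u)
      2h : 2 * 2 ^ (6 * u ∸ 1) ≤ suc C
      2h = ≤-trans (≤-reflexive (cong (2 ^_) (m+[n∸m]≡n {1} {6 * u} (≤-trans 1≤u (m≤m+n u _))))) (n≤1+n C)
      g : (C + (2 + q)) ^ n ≤ 2 ^ m * C ^ n
      g = growth C (2 ^ (6 * u ∸ 1)) (suc q) n m (m^n>0 2 (6 * u)) 2h m≥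

    noise⁺ : 12 * n ^ 3 * E⁺ ≤ K
    noise⁺ = ≤-trans (*-monoˡ-≤ E⁺ S≥) (transfer C n m S E⁺ K _ (m^n>0 2 (6 * u)) (N⁺.noise-bound u w (m + S) π Wi.τ₀ cs 2w≤ mixes) g)

    noise⁻ : 12 * n ^ 3 * E⁻ ≤ K
    noise⁻ = ≤-trans (*-monoˡ-≤ E⁻ S≥) (transfer C n m S E⁻ K _ (m^n>0 2 (6 * u)) (N⁻.noise-bound u w (m + S) π Wi.τ₀ cs 2w≤ mixes) g)

  module _ (2≤A : 2 ≤ A) (T≥ : n ≤ T * 2 ^ A) (sorts : k * (A * 512) ≤ nsort cs) where
    private
      -- `G` converts n into units: 2 α = 32 * 2 ^ (2n + 7A), and T ≥ n 2 ^ (- A) brings a further 2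
      -- ^ A. The threshold T 2 ^ (2n) is therefore worth at least 2 r units α.
      G r : ℕ
      G = 2 ^ (8 * A + 5)
      instance
        G≢0 : NonZero G
        G≢0 = m^n≢0 2 (8 * A + 5)
      r = n / G
      n< : n < G * suc r
      n< = ≤-trans (s≤s (≤-reflexive (m≡m%n+[m/n]*n n G))) (≤-trans (+-monoˡ-≤ (r * G) (m%n<n n G)) (≤-reflexive (*-comm (suc r) G)))
      1≤T : 1 ≤ T
      1≤T = ≰⇒> (λ T≤0 → <⇒≱ (s≤s (z≤n {k})) (≤-trans T≥ (*-monoˡ-≤ (2 ^ A) T≤0)))

    -- Small scales: of the gain 2 ^ (2r), one factor 2 ^ r pays for (1 + 2 ^ (- 64 A)) ^ k, and the
    -- other exceeds 12 n^3 because n < G (r + 1) ≤ (r + 1)^2.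
    bulk : G ≤ r → 12 * n ^ 3 * Eₛ ≤ K
    bulk G≤r = ≤-trans (*-mono-≤ n³ Eₛ≤) (transfer B k r r E′ K _ (m^n>0 2 (64 * A)) dev≤ grow)
      where
      open ≤-Reasoning
      B E′ : ℕ
      B = 2 ^ (64 * A)
      E′ = Ex act cs (λ s → le ((r + r) * Wi.α) (Wi.total (proj₂ (proj₂ s)))) Wi.s₀
      32≤G : 112 ≤ G
      32≤G = ≤-trans (m≤m+n 112 16) (^-monoʳ-≤ 2 {7} (≤-trans (m≤m+n 7 14) (+-monoˡ-≤ 5 (*-monoʳ-≤ 8 2≤A))))
      n³ : 12 * n ^ 3 ≤ 2 ^ r
      n³ = ≤-trans (*-monoʳ-≤ 12 (≤-trans (^-monoˡ-≤ 3 (≤-trans (<⇒≤ n<) (*-monoˡ-≤ (suc r) (≤-trans G≤r (n≤1+n r)))))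
                     (≤-reflexive (trans (^-distribʳ-* 3 (suc r) (suc r)) (sym (^-distribˡ-+-* (suc r) 3 3))))))
                   (poly-exp r (≤-trans 32≤G G≤r))
      thr : (r + r) * Wi.α ≤ T * 2 ^ (2 * n)
      thr = *-cancelʳ-≤ _ _ (2 ^ A) {{m^n≢0 2 A}} (begin
        (r + r) * Wi.α * 2 ^ A               ≡⟨ lem r (2 ^ (2 * n)) (2 ^ (7 * A)) (2 ^ A) ⟩
        r * (32 * (2 ^ (7 * A) * 2 ^ A)) * 2 ^ (2 * n) ≡⟨ cong (λ t → r * (32 * t) * 2 ^ (2 * n)) (trans (sym (^-distribˡ-+-* 2 (7 * A) A)) (cong (2 ^_) (lem₂ A))) ⟩
        r * (32 * 2 ^ (8 * A)) * 2 ^ (2 * n) ≡⟨ cong (λ t → r * t * 2 ^ (2 * n)) (trans (*-comm 32 (2 ^ (8 * A))) (sym (^-distribˡ-+-* 2 (8 * A) 5))) ⟩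
        r * G * 2 ^ (2 * n)                  ≤⟨ *-monoˡ-≤ (2 ^ (2 * n)) (≤-trans (≤-trans (m≤n+m (r * G) (n % G)) (≤-reflexive (sym (m≡m%n+[m/n]*n n G)))) T≥) ⟩
        T * 2 ^ A * 2 ^ (2 * n)              ≡⟨ lem₃ T (2 ^ A) (2 ^ (2 * n)) ⟩
        T * 2 ^ (2 * n) * 2 ^ A              ∎)
        where
        lem : ∀ r a b c → (r + r) * (16 * (a * b)) * c ≡ r * (32 * (b * c)) * a
        lem = solve-∀
        lem₂ : ∀ A → 7 * A + A ≡ 8 * A
        lem₂ = solve-∀
        lem₃ : ∀ a b c → a * b * c ≡ a * c * b
        lem₃ = solve-∀
      Eₛ≤ : Eₛ ≤ E′
      Eₛ≤ = Ex-mono act cs (λ s → le-mono {T * 2 ^ (2 * n)} {_} {(r + r) * Wi.α} (≤-trans thr)) Wi.s₀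
      dev≤ : B ^ k * (2 ^ (r + r) * E′) ≤ K * suc B ^ k
      dev≤ = Wi.large-deviation (64 * A) (r + r) cs Wi.s₀ Wi.SInv₀ (≤-trans (≤-reflexive (lem k A)) sorts)
        where
        lem : ∀ k A → 8 * k * (64 * A) ≡ k * (A * 512)
        lem = solve-∀
      grow : suc B ^ k ≤ 2 ^ r * B ^ k
      grow = subst (λ t → t ^ k ≤ 2 ^ r * B ^ k) (+-comm B 1) (growth B (2 ^ (64 * A ∸ 1)) 0 k r (m^n>0 2 (64 * A)) 2h k≤)
        where
        64A≥ : 1 ≤ 64 * A
        64A≥ = ≤-trans (≤-trans (n≤1+n 1) 2≤A) (m≤m+n A _)
        2h : 2 * 2 ^ (64 * A ∸ 1) ≤ suc B
        2h = ≤-trans (≤-reflexive (cong (2 ^_) (m+[n∸m]≡n 64A≥))) (n≤1+n B)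
        k≤ : 1 * k ≤ 2 ^ (64 * A ∸ 1) * r
        k≤ = begin
          1 * k                           ≡⟨ *-identityˡ k ⟩
          k                               ≤⟨ ≤-trans (n≤1+n k) (<⇒≤ n<) ⟩
          G * suc r                       ≤⟨ *-monoʳ-≤ G (≤-trans (+-monoˡ-≤ r (≤-trans (m^n>0 2 (8 * A + 5)) G≤r)) (≤-reflexive (cong (r +_) (sym (+-identityʳ r))))) ⟩
          G * (2 * r)                     ≡⟨ lem G r ⟩
          2 * G * r                       ≤⟨ *-monoˡ-≤ r (^-monoʳ-≤ 2 expo) ⟩
          2 ^ (64 * A ∸ 1) * r            ∎
          where
          lem : ∀ G r → G * (2 * r) ≡ 2 * G * r
          lem = solve-∀
          expo : suc (8 * A + 5) ≤ 64 * A ∸ 1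
          expo = m+n≤o⇒m≤o∸n (suc (8 * A + 5)) (begin
            suc (8 * A + 5) + 1           ≡⟨ lem₂ A ⟩
            8 * A + 7                     ≤⟨ +-monoʳ-≤ (8 * A) (≤-trans (m≤m+n 7 105) (*-monoʳ-≤ 56 2≤A)) ⟩
            8 * A + 56 * A                ≡⟨ lem₃ A ⟩
            64 * A                        ∎)
            where
            lem₂ : ∀ A → 1 + (8 * A + 5) + 1 ≡ 8 * A + 7
            lem₂ = solve-∀
            lem₃ : ∀ A → 8 * A + 56 * A ≡ 64 * A
            lem₃ = solve-∀

    -- Large scales: now n ≤ 2 ^ (16 A + 10), so powers of n are exponential in A. Of the exponent
    -- 102 A, 95 A pays for 12 n^4 and 7 A for `F`. The window length 512 covers 5 * 102 here and 8
    -- * 64 in `bulk`.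
    sparse : r < G → 12 * n ^ 3 * Eₛ ≤ K
    sparse r<G = *-cancelˡ-≤ (n * 2 ^ (7 * A) * 2 ^ (2 * n)) {{m*n≢0 (n * 2 ^ (7 * A)) _ {{m*n≢0 n (2 ^ (7 * A)) {{_}} {{m^n≢0 2 (7 * A)}}}} {{m^n≢0 2 (2 * n)}}}} (begin
      n * 2 ^ (7 * A) * 2 ^ (2 * n) * (12 * n ^ 3 * Eₛ)      ≡⟨ lem n (2 ^ (7 * A)) (2 ^ (2 * n)) Eₛ ⟩
      12 * n ^ 4 * 2 ^ (7 * A) * (2 ^ (2 * n) * Eₛ)          ≤⟨ *-mono-≤ (*-monoˡ-≤ (2 ^ (7 * A)) n⁴) (*-monoˡ-≤ Eₛ (≤-trans (≤-reflexive (sym (*-identityˡ _))) (*-monoˡ-≤ (2 ^ (2 * n)) 1≤T))) ⟩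
      2 ^ (95 * A) * 2 ^ (7 * A) * (T * 2 ^ (2 * n) * Eₛ)    ≡⟨ cong (_* (T * 2 ^ (2 * n) * Eₛ)) (trans (sym (^-distribˡ-+-* 2 (95 * A) (7 * A))) (cong (2 ^_) (lem₂ A))) ⟩
      2 ^ (102 * A) * (T * 2 ^ (2 * n) * Eₛ)                 ≤⟨ Wi.first-moment (102 * A) (T * 2 ^ (2 * n)) cs Wi.s₀ Wi.SInv₀ (≤-trans (≤-trans (m≤m+n _ (k * (A * 2))) (≤-reflexive (lem₃ k A))) sorts) ⟩
      K * (k * (2 ^ (2 * n) * 2 ^ (7 * A)))                  ≤⟨ *-monoʳ-≤ K (*-monoˡ-≤ (2 ^ (2 * n) * 2 ^ (7 * A)) (n≤1+n k)) ⟩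
      K * (n * (2 ^ (2 * n) * 2 ^ (7 * A)))                  ≡⟨ lem₄ K n (2 ^ (2 * n)) (2 ^ (7 * A)) ⟩
      n * 2 ^ (7 * A) * 2 ^ (2 * n) * K                      ∎)
      where
      open ≤-Reasoning
      lem : ∀ n a b e → n * a * b * (12 * (n * (n * (n * 1))) * e) ≡ 12 * (n * (n * (n * (n * 1)))) * a * (b * e)
      lem = solve-∀
      lem₂ : ∀ A → 95 * A + 7 * A ≡ 102 * A
      lem₂ = solve-∀
      lem₃ : ∀ k A → 5 * k * (102 * A) + k * (A * 2) ≡ k * (A * 512)
      lem₃ = solve-∀
      lem₄ : ∀ K n a b → K * (n * (a * b)) ≡ n * b * a * K
      lem₄ = solve-∀
      n≤ : n ≤ 2 ^ (16 * A + 10)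
      n≤ = begin
        n                                    ≤⟨ <⇒≤ n< ⟩
        G * suc r                            ≤⟨ *-monoʳ-≤ G r<G ⟩
        G * G                                ≡⟨ ^-distribˡ-+-* 2 (8 * A + 5) (8 * A + 5) ⟨
        2 ^ (8 * A + 5 + (8 * A + 5))        ≡⟨ cong (2 ^_) (lem₅ A) ⟩
        2 ^ (16 * A + 10)                    ∎
        where
        lem₅ : ∀ A → 8 * A + 5 + (8 * A + 5) ≡ 16 * A + 10
        lem₅ = solve-∀
      n⁴ : 12 * n ^ 4 ≤ 2 ^ (95 * A)
      n⁴ = begin
        12 * n ^ 4                           ≤⟨ *-mono-≤ (m≤m+n 12 4) (^-monoˡ-≤ 4 n≤) ⟩
        2 ^ 4 * (2 ^ (16 * A + 10)) ^ 4      ≡⟨ cong (2 ^ 4 *_) (^-*-assoc 2 (16 * A + 10) 4) ⟩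
        2 ^ 4 * 2 ^ ((16 * A + 10) * 4)      ≡⟨ ^-distribˡ-+-* 2 4 ((16 * A + 10) * 4) ⟨
        2 ^ (4 + (16 * A + 10) * 4)          ≤⟨ ^-monoʳ-≤ 2 expo ⟩
        2 ^ (95 * A)                         ∎
        where
        expo : 4 + (16 * A + 10) * 4 ≤ 95 * A
        expo = begin
          4 + (16 * A + 10) * 4              ≡⟨ lem₅ A ⟩
          64 * A + 44                        ≤⟨ +-monoʳ-≤ (64 * A) (≤-trans (m≤m+n 44 18) (*-monoʳ-≤ 31 2≤A)) ⟩
          64 * A + 31 * A                    ≡⟨ lem₆ A ⟩
          95 * A                             ∎
          where
          lem₅ : ∀ A → 4 + (16 * A + 10) * 4 ≡ 64 * A + 44
          lem₅ = solve-∀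
          lem₆ : ∀ A → 64 * A + 31 * A ≡ 95 * A
          lem₆ = solve-∀

    unsorted : 12 * n ^ 3 * Eₛ ≤ K
    unsorted with G ≤? r
    ... | yes p = bulk p
    ... | no  p = sparse (≰⇒> p)

  window-bound : 2 * w ≤ suc (q * suc q * k) → nmix cs ≤ w * (2 * u) → 1 ≤ u →
                 (2 + q) * n ≤ 2 ^ (6 * u ∸ 1) * m → 12 * n ^ 3 ≤ 2 ^ S →
                 2 ≤ A → n ≤ T * 2 ^ A → k * (A * 512) ≤ nsort cs →
                 4 * n ^ 3 * Ex actP cs (λ ρ → le (suc (2 * (far A π + T) + 2 * (q * (m + S)))) (far D ρ)) π ≤ K
  window-bound a b c d e f g h = *-cancelˡ-≤ 3 (begin
    3 * (4 * n ^ 3 * X)                 ≡⟨ lem (n ^ 3) X ⟩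
    12 * n ^ 3 * X                      ≤⟨ *-monoʳ-≤ (12 * n ^ 3) union ⟩
    12 * n ^ 3 * (E⁺ + E⁻ + Eₛ)         ≡⟨ lem₂ (12 * n ^ 3) E⁺ E⁻ Eₛ ⟩
    12 * n ^ 3 * E⁺ + 12 * n ^ 3 * E⁻ + 12 * n ^ 3 * Eₛ ≤⟨ +-mono-≤ (+-mono-≤ (noise⁺ a b c d e) (noise⁻ a b c d e)) (unsorted f g h) ⟩
    K + K + K                           ≡⟨ lem₃ K ⟩
    3 * K                               ∎)
    where
    open ≤-Reasoning
    X = Ex actP cs (λ ρ → le (suc (2 * (far A π + T) + 2 * (q * (m + S)))) (far D ρ)) π
    lem : ∀ a x → 3 * (4 * a * x) ≡ 12 * a * x
    lem = solve-∀
    lem₂ : ∀ a x y z → a * (x + y + z) ≡ a * x + a * y + a * z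
    lem₂ = solve-∀
    lem₃ : ∀ K → K + K + K ≡ 3 * K
    lem₃ = solve-∀

-- Chaining the windows

kind : ℕ → ℕ → Kind
kind b t with t % suc b ≟ 0
... | yes _ = srtK
... | no  _ = mixK

step-kind : ∀ {k} b t (i : Fin k) π → step b t i π ≡ actP (kind b t) i π
step-kind b t i π with t % suc b ≟ 0
... | yes _ = refl
... | no  _ = refl

sched : ℕ → ℕ → ℕ → List Kind
sched b t zero    = []
sched b t (suc r) = kind b t ∷ sched b (suc t) r

length-sched : ∀ b t r → length (sched b t r) ≡ r
length-sched b t zero    = refl
length-sched b t (suc r) = cong suc (length-sched b (suc t) r)

sched-+ : ∀ b t r r' → sched b t (r + r') ≡ sched b t r ++ sched b (r + t) r'
sched-+ b t zero    r' = refl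
sched-+ b t (suc r) r' = cong (kind b t ∷_) (trans (sched-+ b (suc t) r r') (cong (λ s → sched b (suc t) r ++ sched b s r') (+-suc r t)))

count-++ : ∀ w cs ds → count w (cs ++ ds) ≡ count w cs + count w ds
count-++ w []       ds = refl
count-++ w (c ∷ cs) ds = trans (cong (w c +_) (count-++ w cs ds)) (sym (+-assoc (w c) _ _))

nmix≤length : ∀ cs → nmix cs ≤ length cs
nmix≤length []          = z≤n
nmix≤length (srtK ∷ cs) = m≤n⇒m≤1+n (nmix≤length cs)
nmix≤length (mixK ∷ cs) = s≤s (nmix≤length cs)

sort-occurs : ∀ b t o r → o < r → (o + t) % suc b ≡ 0 → 1 ≤ nsort (sched b t r)
sort-occurs b t zero (suc r) _ e with t % suc b ≟ 0
... | yes _ = s≤s z≤n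
... | no  p = ⊥-elim (p e)
sort-occurs b t (suc o) (suc r) (s≤s o<r) e =
  ≤-trans (sort-occurs b (suc t) o r o<r (trans (cong (_% suc b) (+-suc o t)) e)) (m≤n+m _ (isSort (kind b t)))

-- Modulo b + 1 the number b t is -t, so its residue is the offset of the next sorting step.
period-sort : ∀ b t → 1 ≤ nsort (sched b t (suc b))
period-sort b t = sort-occurs b t ((b * t) % suc b) (suc b) (m%n<n (b * t) (suc b)) (begin
  ((b * t) % suc b + t) % suc b                         ≡⟨ %-distribˡ-+ ((b * t) % suc b) t (suc b) ⟩
  ((b * t) % suc b % suc b + t % suc b) % suc b         ≡⟨ cong (λ a → (a + t % suc b) % suc b) (m%n%n≡m%n (b * t) (suc b)) ⟩
  ((b * t) % suc b + t % suc b) % suc b                 ≡⟨ %-distribˡ-+ (b * t) t (suc b) ⟨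
  (b * t + t) % suc b                                   ≡⟨ cong (_% suc b) (lem b t) ⟩
  (t * suc b) % suc b                                   ≡⟨ m*n%n≡0 t (suc b) ⟩
  0                                                     ∎)
  where
  open Relation.Binary.PropositionalEquality.≡-Reasoning
  lem : ∀ b t → b * t + t ≡ t * (1 + b)
  lem = solve-∀

-- It holds for every phase t, so windows can be laid out backwards from the final time.
nsort-≥ : ∀ b t r → r ≤ nsort (sched b t (r * suc b))
nsort-≥ b t zero    = z≤n
nsort-≥ b t (suc r) = begin
  suc r                                                           ≤⟨ +-mono-≤ (period-sort b t) (nsort-≥ b (suc b + t) r) ⟩
  nsort (sched b t (suc b)) + nsort (sched b (suc b + t) (r * suc b)) ≡⟨ count-++ isSort (sched b t (suc b)) _ ⟨
  nsort (sched b t (suc b) ++ sched b (suc b + t) (r * suc b))     ≡⟨ cong nsort (sched-+ b t (suc b) (r * suc b)) ⟨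
  nsort (sched b t (suc b + r * suc b))                            ∎
  where open ≤-Reasoning

dev-far : ∀ {k} D (ρ : Permutation′ (suc k)) → dev ρ ≤ far D ρ + suc k * D
dev-far {k} D ρ = begin
  dev ρ                                          ≡⟨ sum-ext F ⟩
  Σ< n (ext F)                                   ≤⟨ Σ-mono n (λ x x<n → ≤-trans (≤-reflexive (ext-elim F (λ x y → y ≡ ∣ val ρ x - x ∣) (λ i → cong (λ v → ∣ v - toℕ i ∣) (sym (val-toℕ ρ i))) x x<n))
                                                       (≤-trans (m≤n+m∸n ∣ val ρ x - x ∣ D) (≤-reflexive (+-comm D _)))) ⟩
  Σ< n (λ x → (∣ val ρ x - x ∣ ∸ D) + D)         ≡⟨ trans (Σ-+ n (λ x → ∣ val ρ x - x ∣ ∸ D) (λ _ → D)) (cong (far D ρ +_) (Σ-const n D)) ⟩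
  far D ρ + n * D                                ∎
  where
  open ≤-Reasoning
  n = suc k
  F : Fin n → ℕ
  F i = ∣ toℕ (ρ ⟨$⟩ʳ i) - toℕ i ∣

far-large : ∀ {k} A (π : Permutation′ (suc k)) → suc k ≤ A → far A π ≡ 0
far-large {k} A π n≤A = trans (Σ-cong (suc k) (λ x x<n → m≤n⇒m∸n≡0 (≤-trans (∣m-n∣≤m⊔n (val π x) x) (⊔-lub (≤-trans (val≤n π x) n≤A) (≤-trans (<⇒≤ x<n) n≤A)))))
  (trans (Σ-const (suc k) 0) (*-zeroʳ k))

good+bad : ∀ {k} b c t r (π : Permutation′ (suc k)) →
           goodCount b c t r π + Ex actP (sched b t r) (λ ρ → le (suc (c * suc k)) (dev ρ)) π ≡ k ^ r
good+bad {k} b c t zero π with dev π ≤? c * suc k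
... | yes p = cong (1 +_) (le-false (s≤s p))
... | no  p = le-true (≰⇒> p)
good+bad {k} b c t (suc r) π = begin
  sum (map (λ i → goodCount b c (suc t) r (step b t i π)) (allFin k)) + ΣF {k} B
    ≡⟨ cong (_+ ΣF {k} B) (trans (sum-ext {k} _) (ΣF-cong {k} _ G (λ i → cong (goodCount b c (suc t) r) (step-kind b t i π)))) ⟩
  ΣF {k} G + ΣF {k} B              ≡⟨ ΣF-+ {k} G B ⟨
  ΣF {k} (λ i → G i + B i)         ≡⟨ trans (ΣF-cong {k} _ (λ _ → k ^ r) (λ i → good+bad b c (suc t) r (actP (kind b t) i π))) (ΣF-const {k} _) ⟩
  k * k ^ r                        ∎
  where
  open Relation.Binary.PropositionalEquality.≡-Reasoning
  G B : Fin k → ℕ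
  G i = goodCount b c (suc t) r (actP (kind b t) i π)
  B i = Ex actP (sched b (suc t) r) (λ ρ → le (suc (c * suc k)) (dev ρ)) (actP (kind b t) i π)

-- All 512 k A (b + 1) steps of a window are charged as mixing steps. With A = 32 q u they fit into
-- w * 2u for w = q' (q + 1) k, half of the z of `Noise`, because q = 2 (b + 1) * 8192 and 32 * 512
-- = 2 * 8192.
mix-budget : ∀ k u b q q' c d e → c * d ≡ 2 * e → q ≡ 2 * q' → q' ≡ b * e → k * (c * (q * u) * d) * b ≤ q' * suc q * k * (2 * u)
mix-budget k u b q q' c d e cd hq hq' = begin
  k * (c * (q * u) * d) * b              ≡⟨ l₁ k q u b c d ⟩
  b * (c * d) * (q * (k * u))            ≡⟨ cong (λ x → b * x * (q * (k * u))) cd ⟩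
  b * (2 * e) * (q * (k * u))            ≡⟨ cong (_* (q * (k * u))) (l₂ b 2 e) ⟩
  2 * (b * e) * (q * (k * u))            ≡⟨ cong (λ a → 2 * a * (q * (k * u))) hq' ⟨
  2 * q' * (q * (k * u))                 ≤⟨ *-monoʳ-≤ (2 * q') (*-monoˡ-≤ (k * u) (n≤1+n q)) ⟩
  2 * q' * (suc q * (k * u))             ≡⟨ l₃ q' (suc q) k u ⟩
  q' * suc q * k * (2 * u)               ∎
  where
  open ≤-Reasoning
  l₁ : ∀ k q u b c d → k * (c * (q * u) * d) * b ≡ b * (c * d) * (q * (k * u))
  l₁ = solve-∀
  l₂ : ∀ b c d → b * (c * d) ≡ c * (b * d)
  l₂ = solve-∀
  l₃ : ∀ q' p k u → 2 * q' * (p * (k * u)) ≡ q' * p * k * (2 * u)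
  l₃ = solve-∀

round-budget : ∀ n b d c → 16 * d ≡ c → 4 * (n * (4 * n * d) * b) ≡ c * b * (n ^ 2)
round-budget n b d c h = trans (lem n b d) (cong (λ x → x * b * (n ^ 2)) h)
  where
  lem : ∀ n b d → 4 * (n * (4 * n * d) * b) ≡ 16 * d * b * (n * (n * 1))
  lem = solve-∀

cube-bound : ∀ n e → n ≤ 2 ^ e → 12 * n ^ 3 ≤ 2 ^ (e * 3 + 4)
cube-bound n e n≤ = begin
  12 * n ^ 3            ≤⟨ *-mono-≤ (m≤m+n 12 4) (^-monoˡ-≤ 3 n≤) ⟩
  16 * (2 ^ e) ^ 3      ≡⟨ cong (16 *_) (^-*-assoc 2 e 3) ⟩
  16 * 2 ^ (e * 3)      ≡⟨ *-comm 16 (2 ^ (e * 3)) ⟩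
  2 ^ (e * 3) * 2 ^ 4   ≡⟨ ^-distribˡ-+-* 2 (e * 3) 4 ⟨
  2 ^ (e * 3 + 4)       ∎
  where open ≤-Reasoning

pow-bound : ∀ q J → 32 * q * 4 ^ J ≤ 2 ^ (q + 2 * J + 5)
pow-bound q J = begin
  32 * q * 4 ^ J               ≤⟨ *-mono-≤ (*-monoʳ-≤ 32 (<⇒≤ (n<2^n q))) (≤-reflexive (^-*-assoc 2 2 J)) ⟩
  32 * 2 ^ q * 2 ^ (2 * J)     ≡⟨ lem 32 (2 ^ q) (2 ^ (2 * J)) ⟩
  2 ^ q * 2 ^ (2 * J) * 2 ^ 5  ≡⟨ cong (_* 2 ^ 5) (^-distribˡ-+-* 2 q (2 * J)) ⟨
  2 ^ (q + 2 * J) * 2 ^ 5      ≡⟨ ^-distribˡ-+-* 2 (q + 2 * J) 5 ⟨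
  2 ^ (q + 2 * J + 5)          ∎
  where
  open ≤-Reasoning
  lem : ∀ a b c → a * b * c ≡ b * c * a
  lem = solve-∀

positive : ∀ a c → 1 ≤ a → 1 ≤ c → 1 ≤ a * c
positive a c = *-mono-≤

module Chain (b k q q' S : ℕ) (1≤k : 1 ≤ k) (hq : q ≡ 2 * q') (hq' : q' ≡ suc b * 8192) where
  n v : ℕ
  n = suc k
  v = 2 + q

  1≤q : 1 ≤ q
  1≤q = subst (1 ≤_) (sym (trans hq (cong (2 *_) hq'))) (positive 2 (suc b * 8192) (s≤s z≤n) (positive (suc b) 8192 (s≤s z≤n) (s≤s z≤n)))

  -- The ratio is 4 because the cut-off 8 q 4 ^ (j + 1) of one window is the clamping radius 32 q 4
  -- ^ j of the next.
  scale : ℕ → ℕ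
  scale j = 32 * (q * 4 ^ j)

  share : ℕ → ℕ
  share j = _/_ (v * n) (4 ^ j) {{m^n≢0 4 j}}

  -- It serves twice: as the tolerated unsortedness T and as the exponent m that pays for (1 + (2 +
  -- q) 2 ^ (- 6u)) ^ n. The successor rounds the quotient up.
  slack : ℕ → ℕ
  slack j = suc (share j)

  rounds Len : ℕ → ℕ
  rounds j = k * (scale j * 512)
  Len zero    = rounds 0 * suc b
  Len (suc j) = rounds (suc j) * suc b + Len j

  next : ℕ → ℕ → ℕ
  next j y = 2 * (y + slack j) + 2 * (q * (slack j + S))

  bound : ℕ → ℕ → ℕ
  bound zero    y = next 0 y
  bound (suc j) y = bound j (next (suc j) y)

  share-≤ : ∀ j → share j * 4 ^ j ≤ v * n
  share-≤ j = ≤-trans (m≤n+m _ _) (≤-reflexive (sym (m≡m%n+[m/n]*n (v * n) (4 ^ j) {{m^n≢0 4 j}})))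

  slack-≥ : ∀ j → v * n ≤ slack j * 4 ^ j
  slack-≥ j = ≤-trans (≤-reflexive (m≡m%n+[m/n]*n (v * n) (4 ^ j) {{m^n≢0 4 j}})) (+-monoˡ-≤ (share j * 4 ^ j) (<⇒≤ (m%n<n (v * n) (4 ^ j) {{m^n≢0 4 j}})))

  j≤4^j : ∀ j → suc j ≤ 4 ^ j
  j≤4^j j = ≤-trans (n<2^n j) (^-monoˡ-≤ j (m≤m+n 2 2))

  4^j≤ : ∀ j e → 2 * j ≤ e → 4 ^ j ≤ 2 ^ e
  4^j≤ j e h = ≤-trans (≤-reflexive (^-*-assoc 2 2 j)) (^-monoʳ-≤ 2 h)

  single : ∀ t y (π : Permutation′ (suc k)) j → 12 * n ^ 3 ≤ 2 ^ S → far (scale j) π ≤ y →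
           4 * n ^ 3 * Ex actP (sched b t (rounds j * suc b)) (λ ρ → le (suc (next j y)) (far (8 * (q * 4 ^ j)) ρ)) π ≤ k ^ (rounds j * suc b)
  single t y π j S≥ far≤ = begin
    4 * n ^ 3 * Ex actP cs (λ ρ → le (suc (next j y)) (far D ρ)) π
      ≤⟨ *-monoʳ-≤ (4 * n ^ 3) (Ex-mono actP cs (λ ρ → le-mono {suc (next j y)} {far D ρ} {suc (2 * (far A π + T) + 2 * (q * (T + S)))} (≤-trans (s≤s (+-monoˡ-≤ (2 * (q * (T + S))) (*-monoʳ-≤ 2 (+-monoˡ-≤ T far≤)))))) π) ⟩
    4 * n ^ 3 * Ex actP cs (λ ρ → le (suc (2 * (far A π + T) + 2 * (q * (T + S)))) (far D ρ)) π
      ≤⟨ WindowBound.window-bound k q 1≤k 1≤q A u T T S w π cs 2w≤ mixes 1≤u m≥ S≥ 2≤A T≥ (nsort-≥ b t (rounds j)) ⟩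
    k ^ length cs                            ≡⟨ cong (k ^_) (length-sched b t (rounds j * suc b)) ⟩
    k ^ (rounds j * suc b)                   ∎
    where
    open ≤-Reasoning
    u A D T w : ℕ
    u = 4 ^ j
    A = scale j
    D = 8 * (q * u)
    T = slack j
    w = q' * suc q * k
    cs = sched b t (rounds j * suc b)
    1≤u : 1 ≤ u
    1≤u = m^n>0 4 j
    u≤A : 32 * u ≤ A
    u≤A = *-monoʳ-≤ 32 (≤-trans (≤-reflexive (sym (*-identityˡ u))) (*-monoˡ-≤ u 1≤q))
    2≤A : 2 ≤ A
    2≤A = ≤-trans (≤-trans (m≤m+n 2 30) (*-monoʳ-≤ 32 1≤u)) u≤A
    2w≤ : 2 * w ≤ suc (q * suc q * k)
    2w≤ = ≤-trans (≤-reflexive (trans (lem q' (suc q) k) (cong (λ a → a * suc q * k) (sym hq)))) (n≤1+n _)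
      where
      lem : ∀ a b c → 2 * (a * b * c) ≡ 2 * a * b * c
      lem = solve-∀
    mixes : nmix cs ≤ w * (2 * u)
    mixes = ≤-trans (nmix≤length cs) (≤-trans (≤-reflexive (length-sched b t (rounds j * suc b)))
      (mix-budget k u (suc b) q q' 32 512 8192 refl hq hq'))
    m≥ : (2 + q) * n ≤ 2 ^ (6 * u ∸ 1) * T
    m≥ = ≤-trans (slack-≥ j) (≤-trans (≤-reflexive (*-comm T u)) (*-monoˡ-≤ T (4^j≤ j _ (m+n≤o⇒m≤o∸n (2 * j) (begin
      2 * j + 1                              ≤⟨ +-monoʳ-≤ (2 * j) (s≤s z≤n) ⟩
      2 * j + 2                              ≡⟨ lem j ⟩
      2 * suc j                              ≤⟨ *-monoʳ-≤ 2 (j≤4^j j) ⟩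
      2 * u                                  ≤⟨ *-monoˡ-≤ u (m≤m+n 2 4) ⟩
      6 * u                                  ∎)))))
      where
      lem : ∀ j → 2 * j + 2 ≡ 2 * (1 + j)
      lem = solve-∀
    T≥ : n ≤ T * 2 ^ A
    T≥ = ≤-trans (m≤m+n n (suc q * n)) (≤-trans (slack-≥ j) (*-monoʳ-≤ T (4^j≤ j A (≤-trans (*-monoʳ-≤ 2 (≤-trans (n≤1+n j) (j≤4^j j))) (≤-trans (*-monoˡ-≤ u (m≤m+n 2 30)) u≤A)))))

  -- Union bound over the windows: if the first succeeds, induction applies to the permutation it
  -- reaches; if it fails, all continuations are counted as bad.
  chain : ∀ j t y (π : Permutation′ (suc k)) → 12 * n ^ 3 ≤ 2 ^ S → far (scale j) π ≤ y →
          4 * n ^ 3 * Ex actP (sched b t (Len j)) (λ ρ → le (suc (bound j y)) (far (8 * (q * 1)) ρ)) π ≤ suc j * k ^ Len j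
  chain zero    t y π S≥ far≤ = ≤-trans (single t y π 0 S≥ far≤) (≤-reflexive (sym (*-identityˡ _)))
  chain (suc j) t y π S≥ far≤ = begin
    N³ * Ex actP (sched b t (L₁ + L₂)) f π           ≡⟨ cong (λ cs → N³ * Ex actP cs f π) (sched-+ b t L₁ L₂) ⟩
    N³ * Ex actP (s₁ ++ s₂) f π                      ≡⟨ cong (N³ *_) (Ex-++ actP s₁ s₂ f π) ⟩
    N³ * Ex actP s₁ (Ex actP s₂ f) π                 ≡⟨ Ex-* actP s₁ N³ (Ex actP s₂ f) π ⟨
    Ex actP s₁ (λ ρ → N³ * Ex actP s₂ f ρ) π         ≤⟨ Ex-mono actP s₁ split π ⟩
    Ex actP s₁ (λ ρ → suc j * k ^ L₂ + N³ * k ^ L₂ * e ρ) π ≡⟨ trans (Ex-+ actP s₁ (λ _ → suc j * k ^ L₂) (λ ρ → N³ * k ^ L₂ * e ρ) π) (cong₂ _+_ (Ex-const actP s₁ (suc j * k ^ L₂) π) (Ex-* actP s₁ (N³ * k ^ L₂) e π)) ⟩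
    k ^ length s₁ * (suc j * k ^ L₂) + N³ * k ^ L₂ * Ex actP s₁ e π ≡⟨ cong₂ _+_ (cong (λ l → k ^ l * (suc j * k ^ L₂)) (length-sched b t L₁)) (lem N³ (k ^ L₂) _) ⟩
    k ^ L₁ * (suc j * k ^ L₂) + k ^ L₂ * (N³ * Ex actP s₁ e π) ≤⟨ +-monoʳ-≤ (k ^ L₁ * (suc j * k ^ L₂)) (*-monoʳ-≤ (k ^ L₂) (single t y π (suc j) S≥ far≤)) ⟩
    k ^ L₁ * (suc j * k ^ L₂) + k ^ L₂ * k ^ L₁      ≡⟨ lem₂ (k ^ L₁) j (k ^ L₂) ⟩
    suc (suc j) * (k ^ L₁ * k ^ L₂)                  ≡⟨ cong (suc (suc j) *_) (^-distribˡ-+-* k L₁ L₂) ⟨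
    suc (suc j) * k ^ (L₁ + L₂)                      ∎
    where
    open ≤-Reasoning
    N³ L₁ L₂ y' : ℕ
    N³ = 4 * n ^ 3
    L₁ = rounds (suc j) * suc b
    L₂ = Len j
    y' = next (suc j) y
    s₁ s₂ : List Kind
    s₁ = sched b t L₁
    s₂ = sched b (L₁ + t) L₂
    f e : Permutation′ (suc k) → ℕ
    f ρ = le (suc (bound j y')) (far (8 * (q * 1)) ρ)
    e ρ = le (suc y') (far (8 * (q * 4 ^ suc j)) ρ)
    lem : ∀ a b c → a * b * c ≡ b * (a * c)
    lem = solve-∀
    lem₂ : ∀ a j c → a * ((1 + j) * c) + c * a ≡ (2 + j) * (a * c)
    lem₂ = solve-∀
    same-scale : 8 * (q * 4 ^ suc j) ≡ scale j
    same-scale = lem₃ q (4 ^ j)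
      where
      lem₃ : ∀ q a → 8 * (q * (4 * a)) ≡ 32 * (q * a)
      lem₃ = solve-∀
    split : ∀ ρ → N³ * Ex actP s₂ f ρ ≤ suc j * k ^ L₂ + N³ * k ^ L₂ * e ρ
    split ρ with suc y' ≤? far (8 * (q * 4 ^ suc j)) ρ
    ... | no  p = ≤-trans (chain j (L₁ + t) y' ρ S≥ (subst (λ d → far d ρ ≤ y') same-scale (≤-pred (≰⇒> p)))) (m≤m+n (suc j * k ^ L₂) (N³ * k ^ L₂ * e ρ))
    ... | yes p rewrite le-true p | *-identityʳ (N³ * k ^ L₂) = ≤-trans (*-monoʳ-≤ N³ (begin
      Ex actP s₂ f ρ                       ≤⟨ Ex-mono actP s₂ (λ x → le≤1 (suc (bound j y')) (far (8 * (q * 1)) x)) ρ ⟩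
      Ex actP s₂ (λ _ → 1) ρ               ≡⟨ Ex-const actP s₂ 1 ρ ⟩
      k ^ length s₂ * 1                    ≡⟨ trans (*-identityʳ _) (cong (k ^_) (length-sched b (L₁ + t) L₂)) ⟩
      k ^ L₂                               ∎)) (m≤n+m (N³ * k ^ L₂) (suc j * k ^ L₂))

  -- Lengths grow by a factor 4, so the longest window takes at least three quarters of the total.
  Len-≤ : ∀ j → 3 * Len j ≤ 4 * (rounds j * suc b)
  Len-≤ zero    = *-monoˡ-≤ (Len 0) (m≤m+n 3 1)
  Len-≤ (suc j) = begin
    3 * (rounds (suc j) * suc b + Len j)             ≡⟨ *-distribˡ-+ 3 (rounds (suc j) * suc b) _ ⟩
    3 * (rounds (suc j) * suc b) + 3 * Len j         ≤⟨ +-monoʳ-≤ (3 * (rounds (suc j) * suc b)) (Len-≤ j) ⟩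
    3 * (rounds (suc j) * suc b) + 4 * (rounds j * suc b) ≡⟨ cong (λ t → 3 * t + 4 * (rounds j * suc b)) quadruple ⟩
    3 * (4 * (rounds j * suc b)) + 4 * (rounds j * suc b) ≡⟨ lem₂ (rounds j * suc b) ⟩
    4 * (4 * (rounds j * suc b))                     ≡⟨ cong (4 *_) quadruple ⟨
    4 * (rounds (suc j) * suc b)                     ∎
    where
    open ≤-Reasoning
    lem : ∀ k q a b c d → k * (c * (q * (4 * a)) * d) * b ≡ 4 * (k * (c * (q * a) * d) * b)
    lem = solve-∀
    lem₂ : ∀ x → 3 * (4 * x) + 4 * x ≡ 4 * (4 * x)
    lem₂ = solve-∀
    quadruple : rounds (suc j) * suc b ≡ 4 * (rounds j * suc b)
    quadruple = lem k q (4 ^ j) (suc b) 32 512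

  base : ℕ
  base = 2 + 2 * q + 2 * q * S

  tail : ℕ → ℕ
  tail zero    = share 0
  tail (suc j) = 2 ^ suc j * share (suc j) + tail j

  -- What enters at scale j is doubled there and at every smaller scale. `tail` collects the shares,
  -- which are proportional to n, and `base` what each window adds besides: the rounding of `slack`
  -- and the confidence term S.
  bound-≤ : ∀ j y → bound j y ≤ 2 ^ suc j * y + (2 + 2 * q) * tail j + 2 ^ suc j * base
  bound-≤ zero y = ≤-trans (m≤m+n _ base) (≤-reflexive (lem y (share 0) q S))
    where
    lem : ∀ y s q S → 2 * (y + (1 + s)) + 2 * (q * ((1 + s) + S)) + (2 + 2 * q + 2 * q * S) ≡ 2 * y + (2 + 2 * q) * s + 2 * (2 + 2 * q + 2 * q * S)
    lem = solve-∀
  bound-≤ (suc j) y = ≤-trans (bound-≤ j (next (suc j) y)) (≤-reflexive (lem (2 ^ suc j) y (share (suc j)) q S (tail j)))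
    where
    lem : ∀ a y s q S t → a * (2 * (y + (1 + s)) + 2 * (q * ((1 + s) + S))) + (2 + 2 * q) * t + a * (2 + 2 * q + 2 * q * S)
          ≡ 2 * a * y + (2 + 2 * q) * (a * s + t) + 2 * a * (2 + 2 * q + 2 * q * S)
    lem = solve-∀

  -- The share at scale j is at most v n / 4 ^ j and is weighted by 2 ^ j: a geometric series. The
  -- induction keeps the sharper form (2 - 2 ^ (- j)) v n, multiplied out.
  tail-≤ : ∀ j → tail j ≤ 2 * (v * n)
  tail-≤ j = *-cancelˡ-≤ (2 ^ j) {{m^n≢0 2 j}} (≤-trans (≤-trans (m≤m+n _ (v * n)) (go j)) (≤-reflexive (lem (2 ^ j) (v * n))))
    where
    open ≤-Reasoning
    lem : ∀ a X → 2 * a * X ≡ a * (2 * X)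
    lem = solve-∀
    go : ∀ j → 2 ^ j * tail j + v * n ≤ 2 ^ suc j * (v * n)
    go zero    = ≤-trans (+-monoˡ-≤ (v * n) (≤-trans (≤-reflexive (*-comm 1 (share 0))) (share-≤ 0))) (≤-reflexive (cong (v * n +_) (sym (+-identityʳ _))))
    go (suc j) = begin
      a * (a * share (suc j) + tail j) + v * n           ≡⟨ l₁ (2 ^ j) (share (suc j)) (tail j) (v * n) ⟩
      share (suc j) * (a * a) + 2 * (2 ^ j * tail j) + v * n ≤⟨ +-monoˡ-≤ (v * n) (+-monoˡ-≤ (2 * (2 ^ j * tail j)) (≤-trans (≤-reflexive (cong (share (suc j) *_) (sym (^-distribʳ-* (suc j) 2 2)))) (share-≤ (suc j)))) ⟩
      v * n + 2 * (2 ^ j * tail j) + v * n               ≡⟨ l₂ (v * n) (2 ^ j * tail j) ⟩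
      2 * (2 ^ j * tail j + v * n)                       ≤⟨ *-monoʳ-≤ 2 (go j) ⟩
      2 * (2 ^ suc j * (v * n))                          ≡⟨ *-assoc 2 (2 ^ suc j) (v * n) ⟨
      2 ^ suc (suc j) * (v * n)                          ∎
      where
      a = 2 ^ suc j
      l₁ : ∀ p s t X → 2 * p * (2 * p * s + t) + X ≡ s * (2 * p * (2 * p)) + 2 * (p * t) + X
      l₁ = solve-∀
      l₂ : ∀ X t → X + 2 * t + X ≡ 2 * (t + X)
      l₂ = solve-∀

-- Choice of the largest scale and of the constants

find-scale : ∀ a n → 1 ≤ a → a ≤ n → ∃ λ J → n ≤ a * 4 ^ J × a * 4 ^ J ≤ 4 * n
find-scale a n 1≤a a≤n with search n
  where
  search : ∀ f → (∃ λ J → n ≤ a * 4 ^ J × a * 4 ^ J ≤ 4 * n) ⊎ (a * 4 ^ f < n)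
  search zero with n ≤? a * 1
  ... | yes p = inj₁ (0 , p , ≤-trans (≤-reflexive (*-identityʳ a)) (≤-trans a≤n (m≤m+n n _)))
  ... | no  p = inj₂ (≰⇒> p)
  search (suc f) with search f
  ... | inj₁ r = inj₁ r
  ... | inj₂ lt with n ≤? a * 4 ^ suc f
  ...   | no  p = inj₂ (≰⇒> p)
  ...   | yes p = inj₁ (suc f , p , ≤-trans (≤-reflexive (lem a (4 ^ f))) (*-monoʳ-≤ 4 (<⇒≤ lt)))
    where
    lem : ∀ a b → a * (4 * b) ≡ 4 * (a * b)
    lem = solve-∀
... | inj₁ r  = r
... | inj₂ lt = ⊥-elim (<⇒≱ lt (≤-trans (<⇒≤ (n<2^n n)) (≤-trans (^-monoˡ-≤ n (m≤m+n 2 2)) (≤-trans (≤-reflexive (sym (*-identityˡ _))) (*-monoˡ-≤ (4 ^ n) 1≤a)))))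

module Final (b q q' C : ℕ) (hC : 16 * 512 ≡ C) (hq : q ≡ 2 * q') (hq' : q' ≡ suc b * 8192) where
  -- The summands of `c` come from `tail`, from `base`, and from the cut-off 8 q when `far` is
  -- turned back into `dev`. `c₀` bounds `base` per unit of J + 1, as S = 6 J + 19 + 3 q ≤ (25 + 3
  -- q)(J + 1); then (J + 1) 2 ^ J ≤ 4 ^ J ≤ n makes this part linear too.
  c₀ c : ℕ
  c₀ = 2 + 2 * q + 2 * q * (25 + 3 * q)
  c = (2 + 2 * q) * (2 * (2 + q)) + 2 * c₀ + 8 * q

  module _ (k : ℕ) (1≤k : 1 ≤ k) (large : 32 * q ≤ suc k) (π : Permutation′ (suc k)) (m : ℕ)
           (long : C * suc b * (suc k ^ 2) ≤ m) where
    private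
      n : ℕ
      n = suc k
      bad : ℕ
      bad = Ex actP (sched b 0 m) (λ ρ → le (suc (c * n)) (dev ρ)) π

    bad-≤ : n ^ 2 * bad ≤ k ^ m
    bad-≤ with find-scale (32 * q) n (*-mono-≤ {1} {32} (s≤s z≤n) (Chain.1≤q b k q q' 0 1≤k hq hq')) large
    ... | J , n≤ , ≤4n = *-cancelˡ-≤ n (begin
      n * (n ^ 2 * bad)                          ≤⟨ ≤-trans (≤-reflexive (lem n bad)) (*-monoˡ-≤ bad (m≤m+n (n ^ 3) (3 * n ^ 3))) ⟩
      4 * n ^ 3 * bad                            ≡⟨ cong (λ cs → 4 * n ^ 3 * Ex actP cs f π) (trans (cong (sched b 0) (sym pre≡)) (sched-+ b 0 pre L)) ⟩
      4 * n ^ 3 * Ex actP (sched b 0 pre ++ s₂) f π ≡⟨ cong (4 * n ^ 3 *_) (Ex-++ actP (sched b 0 pre) s₂ f π) ⟩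
      4 * n ^ 3 * Ex actP (sched b 0 pre) (Ex actP s₂ f) π ≡⟨ Ex-* actP (sched b 0 pre) (4 * n ^ 3) (Ex actP s₂ f) π ⟨
      Ex actP (sched b 0 pre) (λ ρ → 4 * n ^ 3 * Ex actP s₂ f ρ) π ≤⟨ Ex-mono actP (sched b 0 pre) windows π ⟩
      Ex actP (sched b 0 pre) (λ _ → n * k ^ L) π ≡⟨ trans (Ex-const actP (sched b 0 pre) (n * k ^ L) π) (cong (λ l → k ^ l * (n * k ^ L)) (length-sched b 0 pre)) ⟩
      k ^ pre * (n * k ^ L)                      ≡⟨ lem₂ (k ^ pre) n (k ^ L) ⟩
      n * (k ^ pre * k ^ L)                      ≡⟨ cong (n *_) (trans (sym (^-distribˡ-+-* k pre L)) (cong (k ^_) pre≡)) ⟩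
      n * k ^ m                                  ∎)
      where
      open ≤-Reasoning
      S : ℕ
      -- From n ≤ 32 q 4 ^ J ≤ 2 ^ (q + 2J + 5) it follows that 2 ^ S ≥ 16 n^3, enough for a noise
      -- failure of 1 / (12 n^3).
      S = (q + 2 * J + 5) * 3 + 4
      open Chain b k q q' S 1≤k hq hq' hiding (n)
      L pre : ℕ
      L = Len J
      -- The first m - L steps are arbitrary: the windows may start from any permutation, because
      -- the largest scale is at least n and `far` vanishes there.
      pre = m ∸ L
      s₂ : List Kind
      s₂ = sched b (pre + 0) L
      f : Permutation′ (suc k) → ℕ
      f ρ = le (suc (c * n)) (dev ρ)
      lem : ∀ n x → n * (n * (n * 1) * x) ≡ n * (n * (n * 1)) * x
      lem = solve-∀
      lem₂ : ∀ a n x → a * (n * x) ≡ n * (a * x)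
      lem₂ = solve-∀
      scale≡ : scale J ≡ 32 * q * 4 ^ J
      scale≡ = sym (*-assoc 32 q (4 ^ J))
      L≤m : L ≤ m
      -- The largest scale is at most 4 n, and `Len-≤` brings another factor 4; times 512 this is
      -- the constant 16 * 128 * 4 of the hypothesis on m.
      L≤m = *-cancelˡ-≤ 3 (begin
        3 * L                                        ≤⟨ Len-≤ J ⟩
        4 * (k * (scale J * 512) * suc b)            ≤⟨ *-monoʳ-≤ 4 (*-monoˡ-≤ (suc b) (*-mono-≤ (n≤1+n k) (*-monoˡ-≤ 512 (≤-trans (≤-reflexive scale≡) ≤4n)))) ⟩
        4 * (n * (4 * n * 512) * suc b)              ≡⟨ round-budget n (suc b) 512 C hC ⟩
        C * suc b * (n ^ 2)               ≤⟨ long ⟩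
        m                                            ≤⟨ m≤m+n m _ ⟩
        3 * m                                        ∎)
      pre≡ : pre + L ≡ m
      pre≡ = m∸n+n≡m L≤m
      4^J≤n : 4 ^ J ≤ n
      4^J≤n = *-cancelˡ-≤ 4 (≤-trans (*-monoˡ-≤ (4 ^ J) (≤-trans (m≤m+n 4 28) (≤-trans (≤-reflexive (*-comm 1 32)) (*-monoʳ-≤ 32 1≤q)))) ≤4n)
      S≥ : 12 * n ^ 3 ≤ 2 ^ S
      S≥ = cube-bound n (q + 2 * J + 5) (≤-trans n≤ (pow-bound q J))
      bound≤ : bound J 0 ≤ ((2 + 2 * q) * (2 * (2 + q)) + 2 * c₀) * n
      bound≤ = begin
        bound J 0                                    ≤⟨ bound-≤ J 0 ⟩
        2 ^ suc J * 0 + (2 + 2 * q) * tail J + 2 ^ suc J * base ≤⟨ +-mono-≤ (+-mono-≤ (≤-reflexive (*-zeroʳ (2 ^ suc J))) (*-monoʳ-≤ (2 + 2 * q) (tail-≤ J))) (*-monoʳ-≤ (2 ^ suc J) base≤) ⟩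
        0 + (2 + 2 * q) * (2 * (v * n)) + 2 ^ suc J * (c₀ * suc J) ≡⟨ lem₃ (2 + 2 * q) v n (2 ^ J) c₀ (suc J) ⟩
        (2 + 2 * q) * (2 * v) * n + 2 * c₀ * (2 ^ J * suc J) ≤⟨ +-monoʳ-≤ ((2 + 2 * q) * (2 * v) * n) (*-monoʳ-≤ (2 * c₀) (≤-trans (*-monoʳ-≤ (2 ^ J) (n<2^n J)) (≤-trans (≤-reflexive (sym (^-distribʳ-* J 2 2))) 4^J≤n))) ⟩
        (2 + 2 * q) * (2 * v) * n + 2 * c₀ * n       ≡⟨ *-distribʳ-+ n ((2 + 2 * q) * (2 * v)) (2 * c₀) ⟨
        ((2 + 2 * q) * (2 * v) + 2 * c₀) * n         ∎
        where
        lem₃ : ∀ a v n p c j → 0 + a * (2 * (v * n)) + 2 * p * (c * j) ≡ a * (2 * v) * n + 2 * c * (p * j)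
        lem₃ = solve-∀
        base≤ : base ≤ c₀ * suc J
        base≤ = ≤-trans (m≤m+n _ (J * (2 + 2 * q) + 2 * q * (6 + 19 * J + 3 * q * J))) (≤-reflexive (lem₄ q J))
          where
          lem₄ : ∀ q J → 2 + 2 * q + 2 * q * ((q + 2 * J + 5) * 3 + 4) + (J * (2 + 2 * q) + 2 * q * (6 + 19 * J + 3 * q * J)) ≡ (2 + 2 * q + 2 * q * (25 + 3 * q)) * (1 + J)
          lem₄ = solve-∀
      windows : ∀ ρ → 4 * n ^ 3 * Ex actP s₂ f ρ ≤ n * k ^ L
      windows ρ = begin
        4 * n ^ 3 * Ex actP s₂ f ρ                   ≤⟨ *-monoʳ-≤ (4 * n ^ 3) (Ex-mono actP s₂ (λ x → le-mono {suc (c * n)} {dev x} {suc (bound J 0)} {far D x} (event x)) ρ) ⟩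
        4 * n ^ 3 * Ex actP s₂ (λ x → le (suc (bound J 0)) (far D x)) ρ ≤⟨ chain J (pre + 0) 0 ρ S≥ (≤-reflexive (far-large (scale J) ρ (≤-trans n≤ (≤-reflexive (sym scale≡))))) ⟩
        suc J * k ^ L                                ≤⟨ *-monoˡ-≤ (k ^ L) (≤-trans (j≤4^j J) 4^J≤n) ⟩
        n * k ^ L                                    ∎
        where
        D = 8 * (q * 1)
        event : ∀ x → suc (c * n) ≤ dev x → suc (bound J 0) ≤ far D x
        event x h = +-cancelʳ-≤ (n * D) _ _ (begin
          suc (bound J 0) + n * D                    ≤⟨ s≤s (+-mono-≤ bound≤ (≤-reflexive (lem₃ n q))) ⟩
          suc (((2 + 2 * q) * (2 * (2 + q)) + 2 * c₀) * n + 8 * q * n) ≡⟨ cong suc (*-distribʳ-+ n ((2 + 2 * q) * (2 * (2 + q)) + 2 * c₀) (8 * q)) ⟨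
          suc (c * n)                                ≤⟨ h ⟩
          dev x                                      ≤⟨ dev-far D x ⟩
          far D x + n * D                            ∎)
          where
          lem₃ : ∀ n q → n * (8 * (q * 1)) ≡ 8 * q * n
          lem₃ = solve-∀

    good-≥ : (n ^ 2 ∸ 1) * k ^ m ≤ goodCount b c 0 m π * n ^ 2
    good-≥ = ≤-trans (≤-reflexive (trans (*-distribʳ-∸ (k ^ m) (n ^ 2) 1) (cong (n ^ 2 * k ^ m ∸_) (*-identityˡ (k ^ m)))))
      (m≤n+o⇒m∸n≤o (n ^ 2 * k ^ m) (k ^ m) (begin
        n ^ 2 * k ^ m                                ≡⟨ cong (n ^ 2 *_) (good+bad b c 0 m π) ⟨
        n ^ 2 * (goodCount b c 0 m π + bad)          ≡⟨ lem (n ^ 2) (goodCount b c 0 m π) bad ⟩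
        n ^ 2 * bad + goodCount b c 0 m π * n ^ 2    ≤⟨ +-monoˡ-≤ _ bad-≤ ⟩
        k ^ m + goodCount b c 0 m π * n ^ 2          ∎))
      where
      open ≤-Reasoning
      lem : ∀ a g e → a * (g + e) ≡ a * e + g * a
      lem = solve-∀

deviation-bound : ∀ b q q' C → 16 * 512 ≡ C → q ≡ 2 * q' → q' ≡ suc b * 8192 →
    ∃ λ (c : ℕ) → 1 ≤ c × ∃ λ (N : ℕ) →
    ∀ (k : ℕ) → 2 ≤ suc k → N ≤ suc k →
    ∀ (π₀ : Permutation′ (suc k)) (m : ℕ) →
    C * suc b * (suc k ^ 2) ≤ m →
    (suc k ^ 2 ∸ 1) * k ^ m ≤ goodCount b c 0 m π₀ * suc k ^ 2
deviation-bound b q q' C hC hq hq' =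
  Final.c b q q' C hC hq hq' , s≤s z≤n , 32 * q ,
  λ k 2≤n N≤n π₀ m m≥ → Final.good-≥ b q q' C hC hq hq' k (≤-pred 2≤n) N≤n π₀ m m≥

theorem4p3 : ∀ (b : ℕ) → 1 ≤ b →
    ∃ λ (c : ℕ) → 1 ≤ c × ∃ λ (N : ℕ) →
    ∀ (k : ℕ) → 2 ≤ suc k → N ≤ suc k →
    ∀ (π₀ : Permutation′ (suc k)) (m : ℕ) →
    16 * 128 * 4 * suc b * (suc k ^ 2) ≤ m →
    (suc k ^ 2 ∸ 1) * k ^ m ≤ goodCount b c 0 m π₀ * suc k ^ 2
theorem4p3 b _ = deviation-bound b (2 * (suc b * 8192)) (suc b * 8192) (16 * 128 * 4) refl refl refl
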